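{- $\mathrm{MC}(\overline{\phantom{c}},/)$ is $\mathrm{P}$-hard under logarithmic-space many-one reductions.
   Context: Natural numbers include $0$. For $A,B\subseteq\mathbb N$: $A\cup B$, $A\cap B$ are the usual operations, $\overline{A}=\mathbb N\setminus A$, $A+B=\{a+b: a\in A, b\in B\}$, $A\times B=\{a\cdot b: a\in A, b\in B\}$, and $A/B=\{c\in\mathbb N:\exists a\in A\ \exists b\in B\setminus\{0\}: a=c\cdot b\}$ (exact integer division without remainder or rounding). For $\emptyset\ne\mathcal O\subseteq\{\cup,\cap,\overline{\phantom{c}},+,\times,/\}$, an $\mathcal O$-circuit $C=(V,E,g_C,\alpha)$ is a finite acyclic directed multigraph with gate set $V\subseteq\mathbb N$, every gate having indegree $0$, $1$ or $2$, a designated output gate $g_C\in V$, and a labeling $\alpha$: gates of indegree $0$ (input gates) are labeled by natural numbers, gates of indegree $1$ are labeled $\overline{\phantom{c}}$ (allowed only if $\overline{\phantom{c}}\in\mathcal O$), and gates of indegree $2$ are labeled by an operation in $\mathcal O\setminus\{\overline{\phantom{c}}\}$. The result set $I(g)\subseteq\mathbb N$ is defined inductively: $I(g)=\{\alpha(g)\}$ for an input gate; $I(g)=\mathbb N\setminus I(p)$ for a complement gate with predecessor $p$; $I(g)=I(g_1)\,\sigma\,I(g_2)$ for a gate labeled $\sigma$ with predecessors $g_1\le g_2$ (a double edge from one gate gives $g_1=g_2$). $I(C)=I(g_C)$. A circuit is encoded as a bit string listing its gates in reverse topological order, each gate as the triple (gate name, label, list of predecessors), with all numbers (including input labels) in binary;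 $|C|$ denotes the length of this encoding. The membership problem is $\mathrm{MC}(\mathcal O)=\{(C,b): C \text{ is an } \mathcal O\text{ -circuit},\ b\in\mathbb N,\ b\in I(C)\}$, with $b$ given in binary; $\mathrm{MC}(\sigma_1,\dots,\sigma_n)$ abbreviates $\mathrm{MC}(\{\sigma_1,\dots,\sigma_n\})$. -}

module Defs where

open import Data.Bool using (Bool; true; false; if_then_else_)
open import Data.Fin as Fin using (Fin)
open import Data.Fin.Induction using (spo-wellFounded)
open import Data.Fin.Permutation using (Permutation′; _⟨$⟩ʳ_; _⟨$⟩ˡ_)
open import Data.List using
  (List; []; _∷_; _++_; map; concat; concatMap; allFin; reverse; length; fromMaybe)
open import Data.List.Membership.Propositional using () renaming (_∈_ to _∈ₗ_)
open import Data.List.Relation.Unary.Any using (here; there)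
open import Data.Maybe using (Maybe; just; nothing; maybe′)
open import Data.Nat using (ℕ; zero; suc; pred; _+_; _*_; _^_; _⊓_; _≤_; _≤ᵇ_)
open import Data.Nat.Logarithm using (⌈log₂_⌉)
open import Data.Product using (Σ; ∃; ∃₂; _×_; _,_; proj₁; proj₂)
open import Data.Sum using (_⊎_)
open import Data.Unit using (⊤)
open import Data.Vec as Vec using (Vec)
open import Data.Vec.Relation.Unary.All using (All)
open import Function using (_∘_; Injective)
open import Function.Bundles using (_↔_; _⇔_)
open import Induction.WellFounded using (WellFounded; Acc; acc)
open import Level using (0ℓ) renaming (suc to lsuc)
open import Relation.Binary using (IsStrictPartialOrder)
open import Relation.Binary.Construct.Closure.Transitive as ⁺ using (TransClosure)
open import Relation.Binary.PropositionalEquality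
  using (_≡_; _≢_; refl; isEquivalence; resp₂)
open import Relation.Nullary using (¬_)
open import Relation.Unary using (Pred; _∈_; _∉_; ｛_｝; ∁; _∪_; _∩_)

------------------------------------------------------------------------
-- Circuits

data BinOp : Set where
  union intersection sum product quotient : BinOp

data Op : Set where
  complement : Op
  binary     : BinOp → Op

⟦_⟧ : BinOp → Pred ℕ 0ℓ → Pred ℕ 0ℓ → Pred ℕ 0ℓ
⟦ union        ⟧ A B = A ∪ B
⟦ intersection ⟧ A B = A ∩ B
⟦ sum          ⟧ A B = λ c → ∃₂ λ a b → a ∈ A × b ∈ B × c ≡ a + b
⟦ product      ⟧ A B = λ c → ∃₂ λ a b → a ∈ A × b ∈ B × c ≡ a * b
⟦ quotient     ⟧ A B = λ c → ∃₂ λ a b → a ∈ A × (b ∈ B × b ≢ 0) × a ≡ c * b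

-- A labelled gate together with its incoming edges, one for each predecessor
-- listed; a double edge lists the same predecessor twice.
data Node (G : Set) : Set where
  input : ℕ → Node G
  compl : G → Node G
  bin   : BinOp → G → G → Node G

preds : ∀ {G} → Node G → List G
preds (input _)   = []
preds (compl p)   = p ∷ []
preds (bin _ p q) = p ∷ q ∷ []

Allowed : ∀ {G} → Pred Op 0ℓ → Node G → Set
Allowed 𝒪 (input _)   = ⊤
Allowed 𝒪 (compl _)   = complement ∈ 𝒪
Allowed 𝒪 (bin σ _ _) = binary σ ∈ 𝒪

-- The gate set V ⊆ ℕ is the image of `name`.
record Circuit (𝒪 : Pred Op 0ℓ) : Set where
  field
    size           : ℕ
    name           : Fin size → ℕ
    name-injective : Injective _≡_ _≡_ name
    node           : Fin size → Node (Fin size)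
    allowed        : ∀ g → Allowed 𝒪 (node g)
    output         : Fin size

  _⟶_ : Fin size → Fin size → Set
  p ⟶ g = p ∈ₗ preds (node g)

  field
    acyclic : ∀ g → ¬ TransClosure _⟶_ g g

  ⟶-wellFounded : WellFounded _⟶_
  ⟶-wellFounded = ⁺.wellFounded⁻ _⟶_ (spo-wellFounded {_≈_ = _≡_} record
    { isEquivalence = isEquivalence
    ; irrefl        = λ { refl → acyclic _ }
    ; trans         = ⁺.transitive _⟶_
    ; <-resp-≈      = resp₂ (TransClosure _⟶_)
    })

  -- The incoming edges of a gate are unordered: the operand order is the
  -- numerical order of the names, not the order in which `bin` holds them.
  evalNode : (ν : Node (Fin size)) → (∀ {p} → p ∈ₗ preds ν → Pred ℕ 0ℓ) → Pred ℕ 0ℓ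
  evalNode (input n)   I = ｛ n ｝
  evalNode (compl p)   I = ∁ (I (here refl))
  evalNode (bin σ p q) I =
    if name p ≤ᵇ name q then ⟦ σ ⟧ Iₚ I_q else ⟦ σ ⟧ I_q Iₚ
    where
    Iₚ  = I {p} (here refl)
    I_q = I {q} (there (here refl))

  evalGate : ∀ g → Acc _⟶_ g → Pred ℕ 0ℓ
  evalGate g (acc rs) = evalNode (node g) λ p⟶g → evalGate _ (rs p⟶g)

  gateResult : Fin size → Pred ℕ 0ℓ
  gateResult g = evalGate g (⟶-wellFounded g)

  result : Pred ℕ 0ℓ
  result = gateResult output

------------------------------------------------------------------------
-- Encoding of instances

-- Little-endian increment.
increment : List Bool → List Bool
increment []           = true ∷ []
increment (false ∷ bs) = true ∷ bs
increment (true  ∷ bs) = false ∷ increment bs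

littleEndian : ℕ → List Bool
littleEndian zero    = false ∷ []
littleEndian (suc n) = increment (littleEndian n)

-- Most significant bit first, no leading zeros (0 is written "0").
toBinary : ℕ → List Bool
toBinary = reverse ∘ littleEndian

data Token : Set where
  digit     : Bool → Token
  comma end : Token

tokenBits : Token → List Bool
tokenBits (digit b) = false ∷ b ∷ []
tokenBits comma     = true ∷ false ∷ []
tokenBits end       = true ∷ true ∷ []

encodeRecord : List ℕ → List Bool
encodeRecord ns =
  concatMap tokenBits (concatMap (λ n → map digit (toBinary n) ++ comma ∷ []) ns ++ end ∷ [])

-- Sharing codes between operations and input labels is unambiguous: the number
-- of predecessors tells the two apart.
opCode : Op → ℕ
opCode complement            = 0
opCode (binary union)        = 1
opCode (binary intersection) = 2
opCode (binary sum)          = 3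
opCode (binary product)      = 4
opCode (binary quotient)     = 5

labelCode : ∀ {G} → Node G → ℕ
labelCode (input n)   = n
labelCode (compl _)   = opCode complement
labelCode (bin σ _ _) = opCode (binary σ)

module _ {𝒪 : Pred Op 0ℓ} (C : Circuit 𝒪) where
  open Circuit C

  -- `order ⟨$⟩ʳ i` is the gate in place i; every gate precedes its predecessors.
  ReverseTopological : Permutation′ size → Set
  ReverseTopological order = ∀ {p g} → p ⟶ g → order ⟨$⟩ˡ g Fin.< order ⟨$⟩ˡ p

  encodeGate : Fin size → List Bool
  encodeGate g = encodeRecord (name g ∷ labelCode (node g) ∷ map name (preds (node g)))

  encodeCircuit : Permutation′ size → List Bool
  encodeCircuit order =
    encodeRecord (name output ∷ []) ++ concatMap (λ i → encodeGate (order ⟨$⟩ʳ i)) (allFin size)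

  encodeInstance : Permutation′ size → ℕ → List Bool
  encodeInstance order b = encodeCircuit order ++ encodeRecord (b ∷ [])

Language : Set₁
Language = Pred (List Bool) 0ℓ

MC : Pred Op 0ℓ → Language
MC 𝒪 w =
  Σ (Circuit 𝒪) λ C → ∃₂ λ order b →
    ReverseTopological C order × w ≡ encodeInstance C order b × b ∈ Circuit.result C

------------------------------------------------------------------------
-- Turing machines

Finite : Set → Set
Finite A = ∃ λ n → A ↔ Fin n

data Dir : Set where
  left stay right : Dir

-- A one-way infinite tape.  `before` holds the cells left of the head, nearest
-- first; `after` the cells right of the head visited or filled so far, nearest
-- first.  All further cells are blank.
record Tape (Γ : Set) : Set where
  constructor tape
  field
    before  : List Γ
    scanned : Γ
    after   : List Γ

  cells : ℕ
  cells = length before + suc (length after)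

open Tape public using (scanned; cells)

-- Moving left from the leftmost cell leaves the head where it is.
module _ {Γ : Set} (blank : Γ) where

  blankTape : Tape Γ
  blankTape = tape [] blank []

  move : Dir → Tape Γ → Tape Γ
  move left  (tape []       a rs)       = tape [] a rs
  move left  (tape (l ∷ ls) a rs)       = tape ls l (a ∷ rs)
  move stay  t                          = t
  move right (tape ls       a [])       = tape (a ∷ ls) blank []
  move right (tape ls       a (r ∷ rs)) = tape (a ∷ ls) r rs

  writeMove : Tape Γ → Γ × Dir → Tape Γ
  writeMove (tape ls _ rs) (a , d) = move d (tape ls a rs)

iterate : {A : Set} → (A → A) → ℕ → A → A
iterate f zero    x = x
iterate f (suc t) x = iterate f t (f x)

-- Deterministic single-tape deciders.

data Cell (Aux : Set) : Set where
  blank : Cell Aux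
  bit   : Bool → Cell Aux
  aux   : Aux → Cell Aux

record Decider : Set₁ where
  field
    State Aux    : Set
    state-finite : Finite State
    aux-finite   : Finite Aux
    start        : State
    verdict      : State → Maybe Bool  -- `just` on halting states
    δ            : State → Cell Aux → State × Cell Aux × Dir

  Config : Set
  Config = State × Tape (Cell Aux)

  inputTape : List Bool → Tape (Cell Aux)
  inputTape []      = blankTape blank
  inputTape (b ∷ x) = tape [] (bit b) (map bit x)

  initial : List Bool → Config
  initial x = start , inputTape x

  step : Config → Config
  step (q , t) = maybe′ (λ _ → q , t) (q′ , writeMove blank t action) (verdict q)
    where
    q′     = proj₁ (δ q (scanned t))
    action = proj₂ (δ q (scanned t))

  run : ℕ → List Bool → Config
  run n x = iterate step n (initial x)

-- Bounds O(nᵏ) are captured by n^k + k for a large enough k.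
P : Pred Language (lsuc 0ℓ)
P L = Σ Decider λ M → let open Decider M in
  ∃ λ k → ∀ x → ∃ λ t → t ≤ length x ^ k + k ×
    ( (verdict (proj₁ (run t x)) ≡ just true  × x ∈ L)
    ⊎ (verdict (proj₁ (run t x)) ≡ just false × x ∉ L))

-- Transducers with a two-way read-only input tape delimited by end markers,
-- `k` work tapes and a write-only output tape.

data InputSymbol : Set where
  leftEnd rightEnd : InputSymbol
  bit              : Bool → InputSymbol

-- Positions are 0 (left end marker), 1, …, length x, suc (length x) (right end
-- marker); the head cannot leave this range.
readInput : List Bool → ℕ → InputSymbol
readInput x       zero          = leftEnd
readInput []      (suc i)       = rightEnd
readInput (b ∷ x) (suc zero)    = bit b
readInput (b ∷ x) (suc (suc i)) = readInput x (suc i)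

moveInput : List Bool → Dir → ℕ → ℕ
moveInput x left  i = pred i
moveInput x stay  i = i
moveInput x right i = suc i ⊓ suc (length x)

record TransducerConfig (State Γ : Set) (k : ℕ) : Set where
  constructor config
  field
    state  : State
    inHead : ℕ
    work   : Vec (Tape Γ) k
    out    : List Bool

open TransducerConfig public

record Transducer : Set₁ where
  field
    State Γ      : Set
    state-finite : Finite State
    Γ-finite     : Finite Γ
    blankΓ       : Γ
    k            : ℕ
    start        : State
    halting      : State → Bool
    δ            : State → InputSymbol → Vec Γ k → State × Dir × Vec (Γ × Dir) k × Maybe Bool

  Config : Set
  Config = TransducerConfig State Γ k

  initial : Config
  initial = config start 1 (Vec.replicate k (blankTape blankΓ)) []

  step : List Bool → Config → Config
  step x c@(config q i ts o) =
    if halting q then c else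
      let (q′ , d , actions , b) = δ q (readInput x i) (Vec.map scanned ts)
      in config q′ (moveInput x d i) (Vec.zipWith (writeMove blankΓ) ts actions) (o ++ fromMaybe b)

  run : ℕ → List Bool → Config
  run n x = iterate (step x) n initial

-- Only the work tapes count towards the space used.
LogspaceComputable : Pred (List Bool → List Bool) (lsuc 0ℓ)
LogspaceComputable f = Σ Transducer λ M → let open Transducer M in
    (∀ x → ∃ λ t → halting (state (run t x)) ≡ true × out (run t x) ≡ f x)
  × (∃ λ c → ∀ x t → All (λ τ → cells τ ≤ c * ⌈log₂ length x ⌉ + c) (work (run t x)))

_≤ᴸₘ_ : Language → Language → Set₁
L ≤ᴸₘ L′ = ∃ λ f → LogspaceComputable f × (∀ x → x ∈ L ⇔ f x ∈ L′)

P-hard : Pred Language (lsuc 0ℓ)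
P-hard L = ∀ L′ → L′ ∈ P → L′ ≤ᴸₘ L

{-# OPTIONS --safe #-}

-- A set represents the truth value of "it contains 1".  On sets with no
-- nonzero element other than 1 the quotient acts as conjunction, whichever
-- operand is the numerator, and {1} divided by the complement of such a set is
-- again such a set and represents the negation.  Hence Boolean circuits can be
-- simulated, provided that the gate for {1} has the smallest name.
--
-- A decider is simulated by a cellular automaton of radius 1 whose diagram, N
-- cells over N steps, is the circuit to be printed.  N is a power of a fixed
-- base with about log |x| digits as exponent, so that gate names are built
-- from two counters of fixed width, and the transducer only has to increment
-- and decrement these counters while sweeping over its tape.
module Submission where

open import Defs
open import Data.Bool using (Bool; true; false; if_then_else_; not; _∧_; _∨_; T)
open import Data.Bool.Properties using (∧-comm; ∨-zeroʳ)
open import Data.Empty using (⊥-elim)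
open import Data.Fin as Fin using (Fin; zero; suc; toℕ; fromℕ; fromℕ<; inject₁; #_)
open import Data.Fin.Permutation as Perm using (Permutation′; _⟨$⟩ʳ_; _⟨$⟩ˡ_)
open import Data.Fin.Properties
  using (toℕ-fromℕ; toℕ-fromℕ<; toℕ-inject₁; toℕ<n; toℕ-injective; +↔⊎; *↔×; 1↔⊤; 2↔Bool)
open import Data.Fin.Relation.Unary.Top using (view; ‵fromℕ; ‵inject₁)
open import Data.List
  using (List; []; _∷_; _++_; _ʳ++_; map; concatMap; reverse; length; replicate; lookup; allFin;
         tabulate; filter; cartesianProduct; fromMaybe; drop; zip; head)
open import Data.List.Membership.Propositional using (find) renaming (_∈_ to _∈ₗ_)
open import Data.List.Membership.Propositional.Properties
  using (∈-map⁺; ∈-map⁻; ∈-lookup; ∈-allFin; ∈-++⁺ʳ; ∈-filter⁺; ∈-filter⁻; ∈-cartesianProduct⁺; ∈-concatMap⁻)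
open import Data.List.Properties
  using (++-assoc; ++-identityʳ; concatMap-++; concatMap-map; concatMap-cong; map-concatMap; map-++;
         map-∘; map-cong; map-tabulate; tabulate-lookup; length-++; length-map; length-replicate;
         reverse-injective; reverse-involutive; reverse-map; unfold-reverse; ʳ++-defn;
         ∷-injective; ∷-injectiveˡ; ∷-injectiveʳ; ∷ʳ-injective)
open import Data.List.Relation.Unary.All as All using (All; []; _∷_)
open import Data.List.Relation.Unary.AllPairs using ([]; _∷_)
open import Data.List.Relation.Unary.Any as Any using (here; there)
open import Data.List.Relation.Unary.Any.Properties using (lookup-index)
open import Data.List.Relation.Unary.Unique.Propositional using (Unique)
import Data.List.Relation.Unary.Unique.Propositional.Properties as Uniqueₚ
open import Data.Maybe using (Maybe; just; nothing; maybe′; _<∣>_)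
open import Data.Maybe.Properties using (just-injective)
open import Data.Nat
open import Data.Nat.Logarithm using (⌈log₂_⌉; ⌈log₂⌉-mono-≤; ⌈log₂2*n⌉≡1+⌈log₂n⌉; ⌈log₂2^n⌉≡n)
open import Data.Nat.Properties
open import Data.Nat.Solver using (module +-*-Solver)
open import Data.Product using (∃; _×_; _,_; proj₁; proj₂; uncurry)
open import Data.Product.Function.NonDependent.Propositional using (_×-↔_)
open import Data.Sum using (_⊎_; inj₁; inj₂)
open import Data.Sum.Function.Propositional using (_⊎-↔_)
open import Data.Unit using (⊤; tt)
open import Data.Vec as Vec using (Vec; []; _∷_)
open import Data.Vec.Relation.Unary.All using ([]; _∷_) renaming (All to VecAll)
open import Function using (_∘_; case_of_)
open import Function.Bundles using (_↔_; mk↔ₛ′; _⇔_; mk⇔; module Inverse; module Equivalence)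
open import Function.Construct.Composition using (_↔-∘_)
open import Function.Construct.Identity using (↔-id)
open import Function.Construct.Symmetry using (↔-sym)
open import Induction.WellFounded using (Acc; acc)
open import Level using (0ℓ)
open import Relation.Binary.Construct.Closure.Transitive using (TransClosure; [_]; _∷_)
open import Relation.Binary.PropositionalEquality hiding ([_])
open import Relation.Nullary using (¬_; Dec; yes; no; does; contradiction)
open import Relation.Unary using (Pred; _∈_; _∉_; ｛_｝; _∪_; ∁)

-- Binary numerals and the encoding of records

-- `MC` asks for some circuit whose encoding is the given word, so the direction from membership to
-- acceptance concerns an unknown circuit. Hence the simulation is a list of entries that names
-- gates by labels only, its semantics is proved for every circuit whose gates match the entries,
-- and the encoding is proved injective. The width `w` of the counters must be easy to compute, yet
-- `N` must exceed a polynomial in n = |x|. With the length of the numeral of n + 1 as `w`, 2^w is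
-- at least n + 2, and the base 2^(k+3) + 2 gives N ≥ (n+2)^(k+3). This leaves room for the t ≤ n^k
-- + k steps of the decider and about t more in which the news of acceptance travels to cell 0,
-- where the output gate looks. Counters of fixed width wrap around, so the diagram is cyclic.
-- Within N - 1 steps the seam on the right cannot influence cell 0.

bitValue : Bool → ℕ
bitValue false = 0
bitValue true  = 1

valueLE : List Bool → ℕ
valueLE []       = 0
valueLE (b ∷ bs) = bitValue b + 2 * valueLE bs

valueLE-increment : ∀ bs → valueLE (increment bs) ≡ suc (valueLE bs)
valueLE-increment []           = refl
valueLE-increment (false ∷ bs) = refl
valueLE-increment (true  ∷ bs) rewrite valueLE-increment bs = *-suc 2 (valueLE bs)

valueLE-littleEndian : ∀ n → valueLE (littleEndian n) ≡ n
valueLE-littleEndian zero    = refl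
valueLE-littleEndian (suc n) =
  trans (valueLE-increment (littleEndian n)) (cong suc (valueLE-littleEndian n))

toBinary-injective : ∀ {m n} → toBinary m ≡ toBinary n → m ≡ n
toBinary-injective {m} {n} eq = begin
  m                        ≡⟨ valueLE-littleEndian m ⟨
  valueLE (littleEndian m) ≡⟨ cong valueLE (reverse-injective {x = littleEndian m} {littleEndian n} eq) ⟩
  valueLE (littleEndian n) ≡⟨ valueLE-littleEndian n ⟩
  n                        ∎
  where open ≡-Reasoning

-- Restricted to positive numbers because `0` is written with one digit: putting another zero in
-- front would not give a numeral.
littleEndian-double : ∀ n → littleEndian (2 * suc n) ≡ false ∷ littleEndian (suc n)
littleEndian-double zero    = refl
littleEndian-double (suc n) = begin
  littleEndian (2 * suc (suc n))                   ≡⟨ cong littleEndian (*-suc 2 (suc n)) ⟩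
  increment (increment (littleEndian (2 * suc n))) ≡⟨ cong (increment ∘ increment) (littleEndian-double n) ⟩
  false ∷ littleEndian (suc (suc n))               ∎
  where open ≡-Reasoning

littleEndian-snoc : ∀ b n → littleEndian (bitValue b + 2 * suc n) ≡ b ∷ littleEndian (suc n)
littleEndian-snoc false n = littleEndian-double n
littleEndian-snoc true  n = cong increment (littleEndian-double n)

appendBits : ℕ → List Bool → ℕ
appendBits n []       = n
appendBits n (b ∷ bs) = appendBits (bitValue b + 2 * n) bs

-- For `n = 1` this makes `gateName []` the least of all gate names, which decides the operand order
-- in normalising quotients.
n≤appendBits : ∀ n bs → n ≤ appendBits n bs
n≤appendBits n []       = ≤-refl
n≤appendBits n (b ∷ bs) = ≤-trans
  (≤-trans (m≤m+n n (n + 0)) (m≤n+m (2 * n) (bitValue b))) (n≤appendBits _ bs)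

toBinary-appendBits : ∀ n bs → toBinary (appendBits (suc n) bs) ≡ toBinary (suc n) ++ bs
toBinary-appendBits n []       = sym (++-identityʳ _)
toBinary-appendBits n (b ∷ bs) with bitValue b + 2 * suc n in eq
... | zero  = contradiction eq (m+1+n≢0 (bitValue b))
... | suc m = begin
  toBinary (appendBits (suc m) bs)                    ≡⟨ toBinary-appendBits m bs ⟩
  toBinary (suc m) ++ bs                              ≡⟨ cong (λ k → toBinary k ++ bs) eq ⟨
  toBinary (bitValue b + 2 * suc n) ++ bs             ≡⟨ cong (λ l → reverse l ++ bs) (littleEndian-snoc b n) ⟩
  reverse (b ∷ littleEndian (suc n)) ++ bs            ≡⟨ cong (_++ bs) (unfold-reverse b (littleEndian (suc n))) ⟩
  (toBinary (suc n) ++ (b ∷ [])) ++ bs                   ≡⟨ ++-assoc (toBinary (suc n)) (b ∷ []) bs ⟩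
  toBinary (suc n) ++ b ∷ bs                          ∎
  where open ≡-Reasoning

-- The sentinel bit makes every bit string the numeral of exactly one gate name.
gateName : List Bool → ℕ
gateName = appendBits 1

toBinary-gateName : ∀ bs → toBinary (gateName bs) ≡ true ∷ bs
toBinary-gateName = toBinary-appendBits 0

gateName-injective : ∀ {bs cs} → gateName bs ≡ gateName cs → bs ≡ cs
gateName-injective {bs} {cs} eq = ∷-injectiveʳ
  (trans (sym (toBinary-gateName bs)) (trans (cong toBinary eq) (toBinary-gateName cs)))

valueLE<2^length : ∀ bs → valueLE bs < 2 ^ length bs
valueLE<2^length []       = s≤s z≤n
valueLE<2^length (b ∷ bs) = begin-strict
  bitValue b + 2 * valueLE bs ≤⟨ +-monoˡ-≤ _ (bit≤1 b) ⟩
  suc (2 * valueLE bs)        <⟨ n<1+n _ ⟩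
  2 + 2 * valueLE bs          ≡⟨ *-suc 2 (valueLE bs) ⟨
  2 * suc (valueLE bs)        ≤⟨ *-monoʳ-≤ 2 (valueLE<2^length bs) ⟩
  2 * 2 ^ length bs           ∎
  where
  open ≤-Reasoning
  bit≤1 : ∀ b → bitValue b ≤ 1
  bit≤1 false = z≤n
  bit≤1 true  = s≤s z≤n

-- A numeral grows only when all its bits are 1; the second alternative records this as a value,
-- from which the upper bound on `2 ^ numeralWidth n` follows.
length-increment : ∀ bs →
  length (increment bs) ≡ length bs
    ⊎ length (increment bs) ≡ suc (length bs) × suc (valueLE bs) ≡ 2 ^ length bs
length-increment []           = inj₂ (refl , refl)
length-increment (false ∷ bs) = inj₁ refl
length-increment (true  ∷ bs) with length-increment bs
... | inj₁ eq         = inj₁ (cong suc eq)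
... | inj₂ (eq , val) = inj₂ (cong suc eq , trans (sym (*-suc 2 (valueLE bs))) (cong (2 *_) val))

-- The numeral of `suc n`, not of `n`: then 2 to this width is at least n + 2, as `time-bound`
-- requires, and it is the width that counting leaves on the tape, where the end marker causes one
-- increment more than there are input bits.
numeralWidth : ℕ → ℕ
numeralWidth n = length (littleEndian (suc n))

n<2^numeralWidth : ∀ n → suc n < 2 ^ numeralWidth n
n<2^numeralWidth n =
  subst (_< 2 ^ numeralWidth n) (valueLE-littleEndian (suc n)) (valueLE<2^length (littleEndian (suc n)))

2^numeralWidth≤ : ∀ n → 2 ^ numeralWidth n ≤ 2 * suc n
2^numeralWidth≤ zero    = s≤s (s≤s z≤n)
2^numeralWidth≤ (suc n) with length-increment (littleEndian (suc n))
... | inj₁ eq rewrite eq = ≤-trans (2^numeralWidth≤ n) (*-monoʳ-≤ 2 (n≤1+n (suc n)))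
... | inj₂ (eq , val) rewrite eq = ≤-reflexive (cong (2 *_)
  (trans (sym val) (cong suc (valueLE-littleEndian (suc n)))))

-- For positive n, take logarithms in 2^w ≤ 2(n + 1) ≤ 4n.
numeralWidth≤log : ∀ n → numeralWidth n ≤ 2 + ⌈log₂ n ⌉
numeralWidth≤log zero    = s≤s z≤n
numeralWidth≤log n@(suc m) = begin
  numeralWidth n                    ≡⟨ ⌈log₂2^n⌉≡n (numeralWidth n) ⟨
  ⌈log₂ 2 ^ numeralWidth n ⌉        ≤⟨ ⌈log₂⌉-mono-≤ (≤-trans (2^numeralWidth≤ n) (*-monoʳ-≤ 2 lem)) ⟩
  ⌈log₂ 2 * (2 * n) ⌉               ≡⟨ ⌈log₂2*n⌉≡1+⌈log₂n⌉ (2 * n) ⟩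
  1 + ⌈log₂ 2 * n ⌉                 ≡⟨ cong suc (⌈log₂2*n⌉≡1+⌈log₂n⌉ n) ⟩
  2 + ⌈log₂ n ⌉                     ∎
  where
  open ≤-Reasoning
  lem : suc n ≤ 2 * n
  lem = s≤s (≤-trans (s≤s (m≤m+n m 0)) (m≤n+m (suc (m + 0)) m))

-- Unique readability of encoded records

numberTokens : ℕ → List Token
numberTokens n = map digit (toBinary n) ++ comma ∷ []

recordTokens : List ℕ → List Token
recordTokens ns = concatMap numberTokens ns ++ end ∷ []

readTokens : List Bool → List Token
readTokens (false ∷ b ∷ bs)     = digit b ∷ readTokens bs
readTokens (true ∷ false ∷ bs)  = comma ∷ readTokens bs
readTokens (true ∷ true ∷ bs)   = end ∷ readTokens bs
readTokens _                    = []

readTokens-tokenBits : ∀ ts → readTokens (concatMap tokenBits ts) ≡ ts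
readTokens-tokenBits []             = refl
readTokens-tokenBits (digit b ∷ ts) = cong (digit b ∷_) (readTokens-tokenBits ts)
readTokens-tokenBits (comma ∷ ts)   = cong (comma ∷_) (readTokens-tokenBits ts)
readTokens-tokenBits (end ∷ ts)     = cong (end ∷_) (readTokens-tokenBits ts)

-- A comma is no digit, so the first comma ends the numeral on both sides.
digits-comma-injective : ∀ bs cs {ts us} →
  map digit bs ++ comma ∷ ts ≡ map digit cs ++ comma ∷ us → bs ≡ cs × ts ≡ us
digits-comma-injective []       []       refl = refl , refl
digits-comma-injective (b ∷ bs) (c ∷ cs) eq with ∷-injective eq
... | refl , eq′ with digits-comma-injective bs cs eq′
... | refl , eq″ = refl , eq″
digits-comma-injective []       (c ∷ cs) ()
digits-comma-injective (b ∷ bs) []       ()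

numberTokens-++ : ∀ n ts → numberTokens n ++ ts ≡ map digit (toBinary n) ++ comma ∷ ts
numberTokens-++ n ts = ++-assoc (map digit (toBinary n)) (comma ∷ []) ts

recordTokens-++ : ∀ n ns ts →
  recordTokens (n ∷ ns) ++ ts ≡ map digit (toBinary n) ++ comma ∷ (recordTokens ns ++ ts)
recordTokens-++ n ns ts = begin
  ((numberTokens n ++ concatMap numberTokens ns) ++ end ∷ []) ++ ts
    ≡⟨ cong (_++ ts) (++-assoc (numberTokens n) _ _) ⟩
  (numberTokens n ++ recordTokens ns) ++ ts ≡⟨ ++-assoc (numberTokens n) _ _ ⟩
  numberTokens n ++ (recordTokens ns ++ ts) ≡⟨ numberTokens-++ n _ ⟩
  map digit (toBinary n) ++ comma ∷ (recordTokens ns ++ ts) ∎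
  where open ≡-Reasoning

end≢digits : ∀ bs {ts us} → end ∷ ts ≢ map digit bs ++ comma ∷ us
end≢digits []       ()
end≢digits (b ∷ bs) ()

recordTokens-injective : ∀ ms ns {ts us} →
  recordTokens ms ++ ts ≡ recordTokens ns ++ us → ms ≡ ns × ts ≡ us
recordTokens-injective []       []       eq = refl , ∷-injectiveʳ eq
recordTokens-injective []       (n ∷ ns) eq =
  ⊥-elim (end≢digits (toBinary n) (trans eq (recordTokens-++ n ns _)))
recordTokens-injective (m ∷ ms) []       eq =
  ⊥-elim (end≢digits (toBinary m) (trans (sym eq) (recordTokens-++ m ms _)))
recordTokens-injective (m ∷ ms) (n ∷ ns) eq
  with digits-comma-injective (toBinary m) (toBinary n)
         (trans (sym (recordTokens-++ m ms _)) (trans eq (recordTokens-++ n ns _)))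
... | eq₁ , eq₂ with toBinary-injective {m} {n} eq₁ | recordTokens-injective ms ns eq₂
... | refl | refl , eq₃ = refl , eq₃

concatMap-recordTokens-injective : ∀ rs ss →
  concatMap recordTokens rs ≡ concatMap recordTokens ss → rs ≡ ss
concatMap-recordTokens-injective []       []       eq = refl
concatMap-recordTokens-injective (r ∷ rs) (s ∷ ss) eq with recordTokens-injective r s eq
... | refl , eq′ = cong (r ∷_) (concatMap-recordTokens-injective rs ss eq′)
concatMap-recordTokens-injective []       (s ∷ ss) eq = ⊥-elim (nonempty s eq)
  where
  nonempty : ∀ s {ts} → [] ≢ recordTokens s ++ ts
  nonempty []      ()
  nonempty (n ∷ s) {ts} eq = lem (toBinary n) (trans eq (recordTokens-++ n s ts))
    where
    lem : ∀ bs {ts} → [] ≢ map digit bs ++ comma ∷ ts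
    lem []       ()
    lem (b ∷ bs) ()
concatMap-recordTokens-injective (r ∷ rs) []       eq
  with concatMap-recordTokens-injective [] (r ∷ rs) (sym eq)
... | ()

concatMap-encodeRecord : ∀ rs →
  concatMap encodeRecord rs ≡ concatMap tokenBits (concatMap recordTokens rs)
concatMap-encodeRecord []       = refl
concatMap-encodeRecord (r ∷ rs) = begin
  encodeRecord r ++ concatMap encodeRecord rs
    ≡⟨ cong (encodeRecord r ++_) (concatMap-encodeRecord rs) ⟩
  concatMap tokenBits (recordTokens r) ++ concatMap tokenBits (concatMap recordTokens rs)
    ≡⟨ concatMap-++ tokenBits (recordTokens r) _ ⟨
  concatMap tokenBits (concatMap recordTokens (r ∷ rs)) ∎
  where open ≡-Reasoning

concatMap-encodeRecord-injective : ∀ rs ss →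
  concatMap encodeRecord rs ≡ concatMap encodeRecord ss → rs ≡ ss
concatMap-encodeRecord-injective rs ss eq = concatMap-recordTokens-injective rs ss (begin
  concatMap recordTokens rs ≡⟨ readTokens-tokenBits _ ⟨
  readTokens (concatMap tokenBits (concatMap recordTokens rs)) ≡⟨ cong readTokens (concatMap-encodeRecord rs) ⟨
  readTokens (concatMap encodeRecord rs) ≡⟨ cong readTokens eq ⟩
  readTokens (concatMap encodeRecord ss) ≡⟨ cong readTokens (concatMap-encodeRecord ss) ⟩
  readTokens (concatMap tokenBits (concatMap recordTokens ss)) ≡⟨ readTokens-tokenBits _ ⟩
  concatMap recordTokens ss ∎)
  where open ≡-Reasoning

-- Fixed-width counters

-- Fixed-width numerals in base suc b, least significant digit first.
module Numerals (b : ℕ) where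

  Digit : Set
  Digit = Fin (suc b)

  base : ℕ
  base = suc b

  incDigit : Bool → Digit → Bool × Digit
  incDigit false d = false , d
  incDigit true  d with view d
  ... | ‵fromℕ     = true , zero
  ... | ‵inject₁ i = false , suc i

  decDigit : Bool → Digit → Bool × Digit
  decDigit false d       = false , d
  decDigit true  zero    = true , fromℕ b
  decDigit true  (suc d) = false , inject₁ d

  -- Parametrised by the digit map, so that increment, decrement and identity are all one
  -- left-to-right pass with a Boolean carry, the kind of pass that a sweep over the tape performs.
  ripple : (Bool → Digit → Bool × Digit) → Bool → List Digit → Bool × List Digit
  ripple f c []       = c , []
  ripple f c (d ∷ ds) =
    proj₁ (ripple f (proj₁ (f c d)) ds) , proj₂ (f c d) ∷ proj₂ (ripple f (proj₁ (f c d)) ds)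

  length-ripple : ∀ f c ds → length (proj₂ (ripple f c ds)) ≡ length ds
  length-ripple f c []       = refl
  length-ripple f c (d ∷ ds) = cong suc (length-ripple f _ ds)

  decDigit-incDigit : ∀ c d → decDigit c (proj₂ (incDigit c d)) ≡ (proj₁ (incDigit c d) , d)
  decDigit-incDigit false d = refl
  decDigit-incDigit true  d with view d
  ... | ‵fromℕ     = refl
  ... | ‵inject₁ i = refl

  -- Borrows arise exactly where carries did. This includes overflow, so the zero numeral decrements
  -- to the largest one.
  decrement-increment : ∀ c ds → proj₂ (ripple decDigit c (proj₂ (ripple incDigit c ds))) ≡ ds
  decrement-increment c []       = refl
  decrement-increment c (d ∷ ds) rewrite decDigit-incDigit c d =
    cong (d ∷_) (decrement-increment (proj₁ (incDigit c d)) ds)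

  value : List Digit → ℕ
  value []       = 0
  value (d ∷ ds) = toℕ d + base * value ds

  value<base^ : ∀ ds → value ds < base ^ length ds
  value<base^ []       = s≤s z≤n
  value<base^ (d ∷ ds) = begin-strict
    toℕ d + base * value ds <⟨ +-monoˡ-< _ (toℕ<n d) ⟩
    base + base * value ds  ≡⟨ *-suc base (value ds) ⟨
    base * suc (value ds)   ≤⟨ *-monoʳ-≤ base (value<base^ ds) ⟩
    base * base ^ length ds ∎
    where open ≤-Reasoning

  incDigit-value : ∀ c d →
    toℕ (proj₂ (incDigit c d)) + bitValue (proj₁ (incDigit c d)) * base ≡ bitValue c + toℕ d
  incDigit-value false d = +-identityʳ _
  incDigit-value true  d with view d
  ... | ‵fromℕ     = trans (+-identityʳ base) (cong suc (sym (toℕ-fromℕ b)))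
  ... | ‵inject₁ i = trans (+-identityʳ _) (cong suc (sym (toℕ-inject₁ i)))

  -- The carry that leaves the last digit is counted with weight `base ^ length ds`, so the equation
  -- survives overflow.
  increment-value : ∀ c ds → let (c′ , ds′) = ripple incDigit c ds in
    value ds′ + bitValue c′ * base ^ length ds ≡ bitValue c + value ds
  increment-value c []       = trans (*-identityʳ (bitValue c)) (sym (+-identityʳ (bitValue c)))
  increment-value c (d ∷ ds) = begin
    (d′ + base * v″) + k″ * (base * p) ≡⟨ shuffle d′ base v″ k″ p ⟩
    d′ + base * (v″ + k″ * p)          ≡⟨ cong (λ m → d′ + base * m) (increment-value c′ ds) ⟩
    d′ + base * (k′ + v)               ≡⟨ regroup d′ base k′ v ⟩
    (d′ + k′ * base) + base * v        ≡⟨ cong (_+ base * v) (incDigit-value c d) ⟩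
    (bitValue c + toℕ d) + base * v    ≡⟨ +-assoc (bitValue c) (toℕ d) _ ⟩
    bitValue c + (toℕ d + base * v)    ∎
    where
    open ≡-Reasoning
    c′ = proj₁ (incDigit c d)
    d′ = toℕ (proj₂ (incDigit c d))
    k′ = bitValue c′
    v″ = value (proj₂ (ripple incDigit c′ ds))
    k″ = bitValue (proj₁ (ripple incDigit c′ ds))
    v  = value ds
    p  = base ^ length ds
    open +-*-Solver
    shuffle : ∀ d B v k p → (d + B * v) + k * (B * p) ≡ d + B * (v + k * p)
    shuffle = solve 5 (λ d B v k p → (d :+ B :* v) :+ k :* (B :* p) := d :+ B :* (v :+ k :* p)) refl
    regroup : ∀ d B k v → d + B * (k + v) ≡ (d + k * B) + B * v
    regroup = solve 4 (λ d B k v → d :+ B :* (k :+ v) := (d :+ k :* B) :+ B :* v) refl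

  value≡0 : ∀ ds → value ds ≡ 0 → ds ≡ replicate (length ds) zero
  value≡0 []           eq = refl
  value≡0 (zero  ∷ ds) eq = cong (zero ∷_) (value≡0 ds (m*n≡0⇒m≡0 (value ds) base (trans (*-comm (value ds) base) eq)))
  value≡0 (suc d ∷ ds) ()

  value-zeros : ∀ w → value (replicate w zero) ≡ 0
  value-zeros zero    = refl
  value-zeros (suc w) = trans (cong (base *_) (value-zeros w)) (*-zeroʳ base)

  -- Built by repeated increments, so that one pass of the counter leads to the next numeral by
  -- definition.
  numeral : ℕ → ℕ → List Digit
  numeral w zero    = replicate w zero
  numeral w (suc n) = proj₂ (ripple incDigit true (numeral w n))

  length-numeral : ∀ w n → length (numeral w n) ≡ w
  length-numeral w zero    = length-replicate w
  length-numeral w (suc n) = trans (length-ripple incDigit true (numeral w n)) (length-numeral w n)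

  carryOut : ℕ → ℕ → Bool
  carryOut w n = proj₁ (ripple incDigit true (numeral w n))

  value-step : ∀ w n → value (numeral w n) ≡ n →
    value (numeral w (suc n)) + bitValue (carryOut w n) * base ^ w ≡ suc n
  value-step w n eq = trans
    (cong (λ l → value (numeral w (suc n)) + bitValue (carryOut w n) * base ^ l) (sym (length-numeral w n)))
    (trans (increment-value true (numeral w n)) (cong suc eq))

  no-carry : ∀ w n → value (numeral w n) ≡ n → suc n < base ^ w → carryOut w n ≡ false
  no-carry w n eq lt with carryOut w n | value-step w n eq
  ... | false | _  = refl
  ... | true  | ov = contradiction
    (≤-trans (≤-reflexive (sym (+-identityʳ (base ^ w)))) (≤-trans (m≤n+m _ (value (numeral w (suc n)))) (≤-reflexive ov)))
    (<⇒≱ lt)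

  value-numeral : ∀ w n → n < base ^ w → value (numeral w n) ≡ n
  value-numeral w zero    lt = value-zeros w
  value-numeral w (suc n) lt = begin
    value (numeral w (suc n))                                        ≡⟨ +-identityʳ _ ⟨
    value (numeral w (suc n)) + 0                                    ≡⟨ cong (λ c → value (numeral w (suc n)) + bitValue c * base ^ w) (no-carry w n ih lt) ⟨
    value (numeral w (suc n)) + bitValue (carryOut w n) * base ^ w   ≡⟨ value-step w n ih ⟩
    suc n                                                            ∎
    where
    open ≡-Reasoning
    ih = value-numeral w n (<-trans (n<1+n n) lt)

  numeral-injective : ∀ w {m n} → m < base ^ w → n < base ^ w → numeral w m ≡ numeral w n → m ≡ n
  numeral-injective w {m} {n} m< n< eq =
    trans (sym (value-numeral w m m<)) (trans (cong value eq) (value-numeral w n n<))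

  carryOut-below : ∀ w n → suc n < base ^ w → carryOut w n ≡ false
  carryOut-below w n lt = no-carry w n (value-numeral w n (<-trans (n<1+n n) lt)) lt

  -- Without a carry the value would be `base ^ w`, too large for `w` digits. With a carry the value
  -- is 0, which at fixed width only the zero numeral has.
  wrap-around : ∀ w n → suc n ≡ base ^ w → carryOut w n ≡ true × numeral w (suc n) ≡ numeral w 0
  wrap-around w n eq with carryOut w n | value-step w n (value-numeral w n (≤-reflexive eq))
  ... | false | v = contradiction (≤-reflexive (trans (sym eq) (trans (sym v) (+-identityʳ _))))
    (<⇒≱ (subst (λ l → value (numeral w (suc n)) < base ^ l) (length-numeral w (suc n)) (value<base^ (numeral w (suc n)))))
  ... | true  | v = refl , (begin
    numeral w (suc n)                              ≡⟨ value≡0 _ lem ⟩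
    replicate (length (numeral w (suc n))) zero    ≡⟨ cong (λ l → replicate l zero) (length-numeral w (suc n)) ⟩
    replicate w zero                               ∎)
    where
    open ≡-Reasoning
    lem : value (numeral w (suc n)) ≡ 0
    lem = +-cancelʳ-≡ (base ^ w) _ 0 (trans (cong (value (numeral w (suc n)) +_) (sym (+-identityʳ (base ^ w)))) (trans v eq))

data Offset : Set where
  before here after : Offset

-- Neighbours are cyclic to match what wrapping counters compute.
shift : ℕ → Offset → ℕ → ℕ
shift N before zero    = pred N
shift N before (suc i) = i
shift N here   i       = i
shift N after  i       = if suc i <ᵇ N then suc i else 0

module _ (b : ℕ) where
  open Numerals b

  offsetDigit : Offset → Bool → Digit → Bool × Digit
  offsetDigit before = decDigit
  offsetDigit here   = _,_
  offsetDigit after  = incDigit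

  ripple-here : ∀ c ds → proj₂ (ripple _,_ c ds) ≡ ds
  ripple-here c []       = refl
  ripple-here c (d ∷ ds) = cong (d ∷_) (ripple-here c ds)

  ripple-offset : ∀ w o {i} → i < base ^ w →
    proj₂ (ripple (offsetDigit o) true (numeral w i)) ≡ numeral w (shift (base ^ w) o i)
  ripple-offset w before {zero} lt with base ^ w in eq
  -- The zero numeral is the increment of the largest one, and the decrement undoes this increment.
  ... | suc n = trans (cong (proj₂ ∘ ripple decDigit true) (sym (proj₂ (wrap-around w n (sym eq)))))
                      (decrement-increment true (numeral w n))
  ripple-offset w before {suc i} lt = decrement-increment true (numeral w i)
  ripple-offset w here   {i}     lt = ripple-here true (numeral w i)
  ripple-offset w after  {i}     lt with suc i <ᵇ base ^ w in eq
  ... | true  = refl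
  ... | false = proj₂ (wrap-around w i (≤-antisym lt (≮⇒≥ λ lt′ → subst T eq (<⇒<ᵇ lt′))))

  shift< : ∀ N o {i} → i < N → shift N o i < N
  shift< (suc N) before {zero}  lt = n<1+n N
  shift< (suc N) before {suc i} lt = <-trans (n<1+n i) lt
  shift< (suc N) here           lt = lt
  shift< (suc N) after  {i}     lt with suc i <ᵇ suc N in eq
  ... | true  = <ᵇ⇒< (suc i) (suc N) (subst T (sym eq) _)
  ... | false = s≤s z≤n

-- Circuits over complement and quotient

𝒬 : Pred Op 0ℓ
𝒬 = ｛ complement ｝ ∪ ｛ binary quotient ｝

-- A normal set may contain 0: `｛ 0 ｝` is the constant for false, 0 as numerator yields only the
-- quotient 0, and 0 is never a divisor. The other case is meant for complements, which may contain
-- arbitrary further numbers.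
Represents : (normal : Bool) → Bool → Pred ℕ 0ℓ → Set
Represents true  v A = (∀ n → n ∈ A → n ≢ 0 → n ≡ 1 × v ≡ true) × (v ≡ true → 1 ∈ A)
Represents false v A = (1 ∈ A → v ≡ true) × (v ≡ true → 1 ∈ A)

1∈⇒true : ∀ m {v A} → Represents m v A → 1 ∈ A → v ≡ true
1∈⇒true true  (f , _) 1∈A = proj₂ (f 1 1∈A λ ())
1∈⇒true false (f , _) 1∈A = f 1∈A

true⇒1∈ : ∀ m {v A} → Represents m v A → v ≡ true → 1 ∈ A
true⇒1∈ true  = proj₂
true⇒1∈ false = proj₂

represents-constant : ∀ v → Represents true v ｛ bitValue v ｝
represents-constant false = (λ { _ refl 0≢0 → contradiction refl 0≢0 }) , λ ()
represents-constant true  = (λ { _ refl _ → refl , refl }) , λ _ → refl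

represents-complement : ∀ m v {A} → Represents m v A → Represents false (not v) (∁ A)
represents-complement m false r = (λ _ → refl) , λ _ 1∈A → case 1∈⇒true m r 1∈A of λ ()
represents-complement m true  r = (λ 1∉A → contradiction (true⇒1∈ m r refl) 1∉A) , λ ()

-- A nonzero quotient c and a divisor b give a nonzero numerator cb; in a normal set it is 1, which
-- forces c = b = 1. So normality is asked of the numerator alone and passes to the quotient.
represents-quotient : ∀ m v v′ {A B} → Represents true v A → Represents m v′ B →
  Represents true (v ∧ v′) (⟦ quotient ⟧ A B)
represents-quotient m v v′ {A} {B} (f , g) r = only-1 , has-1 v v′ g (true⇒1∈ m r)
  where
  only-1 : ∀ c → c ∈ ⟦ quotient ⟧ A B → c ≢ 0 → c ≡ 1 × v ∧ v′ ≡ true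
  only-1 c (a , b , a∈A , (b∈B , b≢0) , a≡cb) c≢0 with f a a∈A a≢0
    where
    a≢0 : a ≢ 0
    a≢0 a≡0 with m*n≡0⇒m≡0∨n≡0 c (trans (sym a≡cb) a≡0)
    ... | inj₁ c≡0 = c≢0 c≡0
    ... | inj₂ b≡0 = b≢0 b≡0
  ... | refl , refl with m*n≡1⇒m≡1 c b (sym a≡cb) | m*n≡1⇒n≡1 c b (sym a≡cb)
  ... | refl | refl = refl , 1∈⇒true m r b∈B

  has-1 : ∀ v v′ → (v ≡ true → 1 ∈ A) → (v′ ≡ true → 1 ∈ B) → v ∧ v′ ≡ true → 1 ∈ ⟦ quotient ⟧ A B
  has-1 true true 1∈A 1∈B _ = 1 , 1 , 1∈A refl , (1∈B refl , λ ()) , refl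

-- A gate described by labels, independently of any circuit, with the truth value it is meant to
-- represent. In a sound list predecessors stand further down, as in the encoding.
record Entry : Set where
  constructor entry
  field
    label  : List Bool
    shape  : Node (List Bool)
    normal : Bool
    truth  : Bool

open Entry

Known : List Entry → List Bool → Bool → Bool → Set
Known es p m v = ∃ λ ν → entry p ν m v ∈ₗ es

-- The gate named gateName [] is the smallest one, hence the numerator of every
-- quotient in which it occurs.
data Justified (es : List Entry) : Entry → Set where
  constant : ∀ {p} v → Justified es (entry p (input (bitValue v)) true v)
  negation : ∀ {p q m v} → Known es q m v → Justified es (entry p (compl q) false (not v))
  conjunction : ∀ {p q r v v′} → Known es q true v → Known es r true v′ →
    Justified es (entry p (bin quotient q r) true (v ∧ v′))
  normalisation : ∀ {p r m v} → Known es [] true true → Known es r m v →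
    Justified es (entry p (bin quotient [] r) true v)

data Sound : List Entry → Set where
  []  : Sound []
  _∷_ : ∀ {e es} → Justified es e → Sound es → Sound (e ∷ es)

known-there : ∀ {e es p m v} → Known es p m v → Known (e ∷ es) p m v
known-there (ν , e∈es) = ν , there e∈es

known-++ : ∀ fs {es p m v} → Known es p m v → Known (fs ++ es) p m v
known-++ fs (ν , e∈es) = ν , ∈-++⁺ʳ fs e∈es

justified-there : ∀ {e es e′} → Justified es e′ → Justified (e ∷ es) e′
justified-there (constant v)        = constant v
justified-there (negation k)        = negation (known-there k)
justified-there (conjunction k l)   = conjunction (known-there k) (known-there l)
justified-there (normalisation k l) = normalisation (known-there k) (known-there l)

sound⇒justified : ∀ {es e} → Sound es → e ∈ₗ es → Justified es e
sound⇒justified (j ∷ s) (here refl) = justified-there j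
sound⇒justified (j ∷ s) (there e∈)  = justified-there (sound⇒justified s e∈)

unique-label : ∀ {es} → Unique (map label es) → ∀ {e f} → e ∈ₗ es → f ∈ₗ es → label e ≡ label f → e ≡ f
unique-label u       (here refl) (here refl) eq = refl
unique-label (n ∷ u) (here refl) (there f∈)  eq = contradiction eq (All.lookup n (∈-map⁺ label f∈))
unique-label (n ∷ u) (there e∈)  (here refl) eq = contradiction (sym eq) (All.lookup n (∈-map⁺ label e∈))
unique-label (n ∷ u) (there e∈)  (there f∈)  eq = unique-label u e∈ f∈ eq

mapNode : ∀ {G H : Set} → (G → H) → Node G → Node H
mapNode f (input n)   = input n
mapNode f (compl p)   = compl (f p)
mapNode f (bin σ p q) = bin σ (f p) (f q)

nodeRecord : ∀ {G : Set} → (G → ℕ) → ℕ → Node G → List ℕ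
nodeRecord f n ν = n ∷ labelCode ν ∷ map f (preds ν)

entryRecord : Entry → List ℕ
entryRecord e = nodeRecord gateName (gateName (label e)) (shape e)

opCode-injective : ∀ σ τ → opCode (binary σ) ≡ opCode (binary τ) → σ ≡ τ
opCode-injective union        union        _ = refl
opCode-injective intersection intersection _ = refl
opCode-injective sum          sum          _ = refl
opCode-injective product      product      _ = refl
opCode-injective quotient     quotient     _ = refl

nodeRecord-injective : ∀ {G H : Set} {f : G → ℕ} {g : H → ℕ} {m n} ν μ →
  nodeRecord f m ν ≡ nodeRecord g n μ → m ≡ n × mapNode f ν ≡ mapNode g μ
nodeRecord-injective (input _)   (input _)   refl = refl , refl
nodeRecord-injective (compl _)   (compl _)   eq   =
  ∷-injectiveˡ eq , cong compl (∷-injectiveˡ (∷-injectiveʳ (∷-injectiveʳ eq)))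
nodeRecord-injective (bin σ _ _) (bin τ _ _) eq
  with opCode-injective σ τ (∷-injectiveˡ (∷-injectiveʳ eq)) | ∷-injectiveʳ (∷-injectiveʳ eq)
... | refl | eq′ =
  ∷-injectiveˡ eq , cong₂ (bin σ) (∷-injectiveˡ eq′) (∷-injectiveˡ (∷-injectiveʳ eq′))
nodeRecord-injective (input _)   (compl _)   ()
nodeRecord-injective (input _)   (bin _ _ _) ()
nodeRecord-injective (compl _)   (input _)   ()
nodeRecord-injective (compl _)   (bin _ _ _) ()
nodeRecord-injective (bin _ _ _) (input _)   ()
nodeRecord-injective (bin _ _ _) (compl _)   ()

bin-injective : ∀ {G : Set} {σ τ} {p q r s : G} → bin σ p q ≡ bin τ r s → σ ≡ τ × p ≡ r × q ≡ s
bin-injective refl = refl , refl , refl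

-- The circuit is known only through the records of its gates, because both the constructed circuit
-- and an unknown witness of membership have to be covered.
module Semantics {𝒪 : Pred Op 0ℓ} (C : Circuit 𝒪) (es : List Entry)
  (sound : Sound es) (unique : Unique (map label es))
  (described : ∀ g → ∃ λ e →
    e ∈ₗ es × nodeRecord (Circuit.name C) (Circuit.name C g) (Circuit.node C g) ≡ entryRecord e)
  where
  open Circuit C

  Correct : Fin size → Pred ℕ 0ℓ → Set
  Correct g A = ∀ {e} → e ∈ₗ es → gateName (label e) ≡ name g → Represents (normal e) (truth e) A

  correct : ∀ {p A q m v} → Correct p A → Known es q m v → name p ≡ gateName q → Represents m v A
  correct c (_ , e∈) eq = c e∈ (sym eq)

  evalNode-correct : ∀ {e} (ν : Node (Fin size)) (I : ∀ {p} → p ∈ₗ preds ν → Pred ℕ 0ℓ) →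
    Justified es e → mapNode name ν ≡ mapNode gateName (shape e) →
    (∀ {p} (p∈ : p ∈ₗ preds ν) → Correct p (I p∈)) →
    Represents (normal e) (truth e) (evalNode ν I)
  evalNode-correct (input _) I (constant v) refl ih = represents-constant v
  evalNode-correct (compl p) I (negation {m = m} {v} k) eq ih =
    represents-complement m v (correct (ih (here refl)) k (compl-injective eq))
    where
    compl-injective : ∀ {p q : ℕ} → compl p ≡ compl q → p ≡ q
    compl-injective refl = refl
  evalNode-correct (bin σ p q) I (conjunction {v = v} {v′} k l) eq ih with bin-injective eq
  ... | refl , eqₚ , eq_q with name p ≤ᵇ name q
  ... | true  = represents-quotient true v v′ (correct (ih (here refl)) k eqₚ) (correct (ih (there (here refl))) l eq_q)
  -- Both operands are normal, so either may be the numerator; only the conjunction is reversed.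
  ... | false = subst (λ t → Represents true t _) (∧-comm v′ v)
    (represents-quotient true v′ v (correct (ih (there (here refl))) l eq_q) (correct (ih (here refl)) k eqₚ))
  evalNode-correct (bin σ p q) I (normalisation {r = r} {m} {v} k l) eq ih with bin-injective eq
  ... | refl , eqₚ , eq_q with name p ≤ᵇ name q in le
  ... | true  = represents-quotient m true v (correct (ih (here refl)) k eqₚ) (correct (ih (there (here refl))) l eq_q)
  -- In this order `gateName []` would belong to the denominator, but it is the least name.
  ... | false = ⊥-elim (subst T le (≤⇒≤ᵇ (subst₂ _≤_ (sym eqₚ) (sym eq_q) (n≤appendBits 1 r))))
  evalNode-correct (compl _)   I (constant v) () ih
  evalNode-correct (bin _ _ _) I (constant v) () ih
  evalNode-correct (input _)   I (negation _) () ih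
  evalNode-correct (bin _ _ _) I (negation _) () ih
  evalNode-correct (input _)   I (conjunction _ _) () ih
  evalNode-correct (compl _)   I (conjunction _ _) () ih
  evalNode-correct (input _)   I (normalisation _ _) () ih
  evalNode-correct (compl _)   I (normalisation _ _) () ih

  evalGate-correct : ∀ g (a : Acc _⟶_ g) → Correct g (evalGate g a)
  evalGate-correct g (acc rs) {e} e∈ eq with described g
  ... | e₀ , e₀∈ , rec with nodeRecord-injective (Circuit.node C g) (shape e₀) rec
  -- Names determine labels and labels are unique, so the entry named like `g` is also the one whose
  -- shape `g` has.
  ... | eq₀ , eqν with unique-label unique e∈ e₀∈ (gateName-injective (trans eq eq₀))
  ... | refl = evalNode-correct (Circuit.node C g) (λ p∈ → evalGate _ (rs p∈))
    (sound⇒justified sound e∈) eqν (λ p∈ → evalGate-correct _ (rs p∈))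

  result-correct : ∀ {p m v} → Known es p m v → name output ≡ gateName p → 1 ∈ result ⇔ v ≡ true
  result-correct {p} {m} {v} (ν , e∈) eq = mk⇔ (1∈⇒true m r) (true⇒1∈ m r)
    where
    r : Represents m v result
    r = evalGate-correct output (⟶-wellFounded output) e∈ (sym eq)

-- The entries as a circuit, gate `i` being the `i`-th entry. Edges come from later positions, which
-- gives acyclicity and makes the identity a reverse topological order.
module Construction (es : List Entry) (sound : Sound es) (unique : Unique (map label es))
  {out : List Bool} {m v : Bool} (out-known : Known es out m v) where

  size : ℕ
  size = length es

  labels : ∀ es → Fin (length es) → List Bool
  labels es i = label (lookup es i)

  Later : ∀ {n} → (Fin n → List Bool) → Fin n → List Bool → Set
  Later ℓ i p = ∃ λ j → i Fin.< j × ℓ j ≡ p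

  known⇒later : ∀ {e es p m v} → Known es p m v → Later (labels (e ∷ es)) zero p
  known⇒later {p = p} (ν , e∈) = suc (Any.index e∈) , s≤s z≤n , cong label (sym (lookup-index e∈))

  later-suc : ∀ {e es i p} → Later (labels es) i p → Later (labels (e ∷ es)) (suc i) p
  later-suc (j , i<j , eq) = suc j , s≤s i<j , eq

  preds-later : ∀ {es} → Sound es → ∀ i → All (Later (labels es) i) (preds (shape (lookup es i)))
  preds-later (constant v ∷ s)        zero = []
  preds-later (negation k ∷ s)        zero = known⇒later k ∷ []
  preds-later (conjunction k l ∷ s)   zero = known⇒later k ∷ known⇒later l ∷ []
  preds-later (normalisation k l ∷ s) zero = known⇒later k ∷ known⇒later l ∷ []
  preds-later (j ∷ s)                 (suc i) = All.map later-suc (preds-later s i)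

  resolve : ∀ {n} {ℓ : Fin n → List Bool} {i} ν → All (Later ℓ i) (preds ν) → Node (Fin n)
  resolve (input n)   []            = input n
  resolve (compl _)   (a ∷ [])      = compl (proj₁ a)
  resolve (bin σ _ _) (a ∷ a′ ∷ []) = bin σ (proj₁ a) (proj₁ a′)

  resolve-label : ∀ {n} {ℓ : Fin n → List Bool} {i} ν (as : All (Later ℓ i) (preds ν)) →
    mapNode ℓ (resolve ν as) ≡ ν
  resolve-label (input n)   []            = refl
  resolve-label (compl _)   (a ∷ [])      = cong compl (proj₂ (proj₂ a))
  resolve-label (bin σ _ _) (a ∷ a′ ∷ []) = cong₂ (bin σ) (proj₂ (proj₂ a)) (proj₂ (proj₂ a′))

  resolve-< : ∀ {n} {ℓ : Fin n → List Bool} {i p} ν (as : All (Later ℓ i) (preds ν)) →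
    p ∈ₗ preds (resolve ν as) → i Fin.< p
  resolve-< (compl _)   (a ∷ [])      (here refl)         = proj₁ (proj₂ a)
  resolve-< (bin σ _ _) (a ∷ a′ ∷ []) (here refl)         = proj₁ (proj₂ a)
  resolve-< (bin σ _ _) (a ∷ a′ ∷ []) (there (here refl)) = proj₁ (proj₂ a′)
  resolve-< (input _)   []            ()

  resolve-allowed : ∀ {e es n} {ℓ : Fin n → List Bool} {i} → Justified es e →
    (as : All (Later ℓ i) (preds (shape e))) → Allowed 𝒬 (resolve (shape e) as)
  resolve-allowed (constant _)        []           = tt
  resolve-allowed (negation _)        (_ ∷ [])     = inj₁ refl
  resolve-allowed (conjunction _ _)   (_ ∷ _ ∷ []) = inj₂ refl
  resolve-allowed (normalisation _ _) (_ ∷ _ ∷ []) = inj₂ refl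

  name : Fin size → ℕ
  name i = gateName (label (lookup es i))

  lookup-unique : ∀ {es} → Unique (map label es) → ∀ i j → label (lookup es i) ≡ label (lookup es j) → i ≡ j
  lookup-unique {_ ∷ _} u       zero    zero    eq = refl
  lookup-unique {_ ∷ es} (n ∷ u) zero    (suc j) eq = contradiction eq (All.lookup n (∈-map⁺ label (∈-lookup {xs = es} j)))
  lookup-unique {_ ∷ es} (n ∷ u) (suc i) zero    eq = contradiction (sym eq) (All.lookup n (∈-map⁺ label (∈-lookup {xs = es} i)))
  lookup-unique {_ ∷ _} (n ∷ u) (suc i) (suc j) eq = cong suc (lookup-unique u i j eq)

  gate : Fin size → Node (Fin size)
  gate i = resolve (shape (lookup es i)) (preds-later sound i)

  edge-< : ∀ {p g} → p ∈ₗ preds (gate g) → g Fin.< p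
  edge-< {g = g} = resolve-< (shape (lookup es g)) (preds-later sound g)

  path-< : ∀ {p g} → TransClosure (λ p g → p ∈ₗ preds (gate g)) p g → g Fin.< p
  path-< [ e ]   = edge-< e
  path-< (e ∷ p) = <-trans (path-< p) (edge-< e)

  circuit : Circuit 𝒬
  circuit = record
    { size           = size
    ; name           = name
    ; name-injective = λ {i} {j} eq → lookup-unique unique i j (gateName-injective eq)
    ; node           = gate
    ; allowed        = λ i → resolve-allowed (sound⇒justified sound (∈-lookup {xs = es} i)) (preds-later sound i)
    ; output         = Any.index (proj₂ out-known)
    ; acyclic        = λ g p → <-irrefl refl (path-< p)
    }

  nodeRecord-resolve : ∀ {n} (ℓ : Fin n → List Bool) k ν (μ : Node (Fin n)) →
    mapNode ℓ μ ≡ ν → nodeRecord (gateName ∘ ℓ) k μ ≡ nodeRecord gateName k ν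
  nodeRecord-resolve ℓ k _ (input _)   refl = refl
  nodeRecord-resolve ℓ k _ (compl _)   refl = refl
  nodeRecord-resolve ℓ k _ (bin _ _ _) refl = refl

  record≡ : ∀ i → nodeRecord name (name i) (gate i) ≡ entryRecord (lookup es i)
  record≡ i = nodeRecord-resolve (labels es) (name i) _ _
    (resolve-label (shape (lookup es i)) (preds-later sound i))

  output-name : name (Any.index (proj₂ out-known)) ≡ gateName out
  output-name = cong (gateName ∘ label) (sym (lookup-index (proj₂ out-known)))

-- Injectivity of the encoding of instances

instanceRecords : List Bool → List Entry → List (List ℕ)
instanceRecords out es = (gateName out ∷ []) ∷ map entryRecord es ++ (1 ∷ []) ∷ []

encodeEntries : List Bool → List Entry → List Bool
encodeEntries out es = concatMap encodeRecord (instanceRecords out es)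

circuitRecords : ∀ {𝒪} (C : Circuit 𝒪) → Permutation′ (Circuit.size C) → List (List ℕ)
circuitRecords C order =
  map (λ i → let g = order ⟨$⟩ʳ i in nodeRecord name (name g) (node g)) (allFin size)
  where open Circuit C

encodeInstance-records : ∀ {𝒪} (C : Circuit 𝒪) order b → encodeInstance C order b ≡
  concatMap encodeRecord ((Circuit.name C (Circuit.output C) ∷ []) ∷ circuitRecords C order ++ (b ∷ []) ∷ [])
encodeInstance-records C order b = begin
  (hd ++ concatMap (λ i → encodeRecord (r i)) (allFin size)) ++ encodeRecord (b ∷ [])
    ≡⟨ ++-assoc hd _ _ ⟩
  hd ++ (concatMap (λ i → encodeRecord (r i)) (allFin size) ++ encodeRecord (b ∷ []))
    ≡⟨ cong₂ (λ l l′ → hd ++ (l ++ l′)) (concatMap-map encodeRecord r (allFin size)) (++-identityʳ (encodeRecord (b ∷ []))) ⟨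
  hd ++ (concatMap encodeRecord (map r (allFin size)) ++ (encodeRecord (b ∷ []) ++ []))
    ≡⟨ cong (hd ++_) (concatMap-++ encodeRecord (map r (allFin size)) ((b ∷ []) ∷ [])) ⟨
  hd ++ concatMap encodeRecord (circuitRecords C order ++ (b ∷ []) ∷ []) ∎
  where
  open Circuit C
  open ≡-Reasoning
  hd = encodeRecord (name output ∷ [])
  r : Fin size → List ℕ
  r i = nodeRecord name (name (order ⟨$⟩ʳ i)) (node (order ⟨$⟩ʳ i))

-- The word determines its list of records; the first one names the output, the last one is `b`, and
-- the gates lie between.
encoding-injective : ∀ {𝒪} (C : Circuit 𝒪) order b out es →
  encodeEntries out es ≡ encodeInstance C order b →
  gateName out ≡ Circuit.name C (Circuit.output C) × map entryRecord es ≡ circuitRecords C order × 1 ≡ b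
encoding-injective C order b out es eq
  with ∷-injective (concatMap-encodeRecord-injective (instanceRecords out es)
         ((Circuit.name C (Circuit.output C) ∷ []) ∷ circuitRecords C order ++ (b ∷ []) ∷ [])
         (trans eq (encodeInstance-records C order b)))
... | eq-out , eq-rest with ∷ʳ-injective (map entryRecord es) (circuitRecords C order) eq-rest
... | eq-gates , eq-b = ∷-injectiveˡ eq-out , eq-gates , ∷-injectiveˡ eq-b

module _ (es : List Entry) (sound : Sound es) (unique : Unique (map label es))
  {out : List Bool} {m v : Bool} (out-known : Known es out m v) where

  true⇒MC : v ≡ true → encodeEntries out es ∈ MC 𝒬
  true⇒MC v≡true = circuit , Perm.id , 1 , edge-< , encoded , Equivalence.from (result-correct out-known output-name) v≡true
    where
    open Construction es sound unique out-known
    open Semantics circuit es sound unique (λ g → lookup es g , ∈-lookup {xs = es} g , record≡ g)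
    open ≡-Reasoning
    records : circuitRecords circuit Perm.id ≡ map entryRecord es
    records = begin
      map (λ i → nodeRecord name (name i) (gate i)) (allFin size) ≡⟨ map-cong record≡ (allFin size) ⟩
      map (entryRecord ∘ lookup es) (allFin size)                 ≡⟨ map-∘ (allFin size) ⟩
      map entryRecord (map (lookup es) (allFin size))             ≡⟨ cong (map entryRecord) (map-tabulate (λ i → i) (lookup es)) ⟩
      map entryRecord (tabulate (lookup es))                      ≡⟨ cong (map entryRecord) (tabulate-lookup es) ⟩
      map entryRecord es                                          ∎
    encoded : encodeEntries out es ≡ encodeInstance circuit Perm.id 1
    encoded = begin
      concatMap encodeRecord ((gateName out ∷ []) ∷ map entryRecord es ++ (1 ∷ []) ∷ [])
        ≡⟨ cong₂ (λ n rs → concatMap encodeRecord ((n ∷ []) ∷ rs ++ (1 ∷ []) ∷ [])) output-name records ⟨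
      concatMap encodeRecord ((Circuit.name circuit (Circuit.output circuit) ∷ []) ∷ circuitRecords circuit Perm.id ++ (1 ∷ []) ∷ [])
        ≡⟨ encodeInstance-records circuit Perm.id 1 ⟨
      encodeInstance circuit Perm.id 1 ∎

  -- The witness is an arbitrary circuit. As `order` is a permutation, each of its gates is listed
  -- somewhere, and injectivity turns its record into that of an entry, which is what `Semantics`
  -- asks for.
  MC⇒true : encodeEntries out es ∈ MC 𝒬 → v ≡ true
  MC⇒true (C , order , b , _ , eq , b∈)
    with encoding-injective C order b out es eq
  ... | eq-out , eq-gates , refl = Equivalence.to (result-correct out-known (sym eq-out)) b∈
    where
    open Circuit C
    described : ∀ g → ∃ λ e → e ∈ₗ es × nodeRecord name (name g) (node g) ≡ entryRecord e
    described g = ∈-map⁻ entryRecord (subst₂ _∈ₗ_ (cong (λ g → nodeRecord name (name g) (node g)) (Perm.inverseʳ order)) (sym eq-gates)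
      (∈-map⁺ (λ i → nodeRecord name (name (order ⟨$⟩ʳ i)) (node (order ⟨$⟩ʳ i))) (∈-allFin (order ⟨$⟩ˡ g))))
    open Semantics C es sound unique described

-- The circuit of a cellular automaton

-- Self-delimiting, so that digits and tags can be joined without separators and still be read off
-- uniquely.
unary : ℕ → List Bool
unary zero    = false ∷ []
unary (suc n) = true ∷ unary n

unary-injective : ∀ m n {xs ys} → unary m ++ xs ≡ unary n ++ ys → m ≡ n × xs ≡ ys
unary-injective zero    zero    refl = refl , refl
unary-injective (suc m) (suc n) eq with unary-injective m n (∷-injectiveʳ eq)
... | refl , eq′ = refl , eq′
unary-injective zero    (suc n) ()
unary-injective (suc m) zero    ()

unary-nonempty : ∀ (xs : List Bool) n ys → xs ++ unary n ++ ys ≢ []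
unary-nonempty []       zero    ys ()
unary-nonempty []       (suc n) ys ()
unary-nonempty (x ∷ xs) n       ys ()

range : ℕ → ℕ → List ℕ
range k zero    = []
range k (suc n) = k ∷ range (suc k) n

range-++ : ∀ k m n → range k (m + n) ≡ range k m ++ range (k + m) n
range-++ k zero    n = cong (λ j → range j n) (sym (+-identityʳ k))
range-++ k (suc m) n = cong (k ∷_) (trans (range-++ (suc k) m n)
  (cong (λ j → range (suc k) m ++ range j n) (sym (+-suc k m))))

∈-range⁻ : ∀ {i} k n → i ∈ₗ range k n → k ≤ i × i < k + n
∈-range⁻ k (suc n) (here refl) = ≤-refl , m<m+n k (s≤s z≤n)
∈-range⁻ {i} k (suc n) (there i∈) with ∈-range⁻ (suc k) n i∈
... | k< , i< = <⇒≤ k< , subst (i <_) (sym (+-suc k n)) i<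

range-complete : ∀ {i} k n → k ≤ i → i < k + n → i ∈ₗ range k n
range-complete {i} k zero    k≤ i< = contradiction (subst (i <_) (+-identityʳ k) i<) (≤⇒≯ k≤)
range-complete {i} k (suc n) k≤ i< with m≤n⇒m<n∨m≡n k≤
... | inj₁ k< = there (range-complete (suc k) n k< (subst (i <_) (+-suc k n) i<))
... | inj₂ refl = here refl

range-unique : ∀ k n → Unique (range k n)
range-unique k zero    = []
range-unique k (suc n) = All.tabulate (λ i∈ → <⇒≢ (proj₁ (∈-range⁻ (suc k) n i∈))) ∷ range-unique (suc k) n

unique-concatMap : ∀ {A B : Set} (f : A → List B) {xs} → Unique xs →
  (∀ {a} → a ∈ₗ xs → Unique (f a)) →
  (∀ {a a′ y} → a ∈ₗ xs → a′ ∈ₗ xs → y ∈ₗ f a → y ∈ₗ f a′ → a ≡ a′) → Unique (concatMap f xs)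
unique-concatMap f []      uf sep = []
unique-concatMap f {a ∷ xs} (a∉ ∷ u) uf sep = Uniqueₚ.++⁺ (uf (here refl))
  (unique-concatMap f u (uf ∘ there) (λ p q → sep (there p) (there q)))
  λ (y∈ , y∈′) → let (a′ , a′∈ , y∈fa′) = find (∈-concatMap⁻ f {xs = xs} y∈′) in
    All.lookup a∉ a′∈ (sep (here refl) (there a′∈) y∈ y∈fa′)

module _ (b : ℕ) where
  open Numerals b

  -- The two counters are interleaved because the tape holds their digits in pairs, and a single
  -- sweep is to print an address.
  address : List Digit → List Digit → List Bool
  address (s ∷ ss) (i ∷ is) = (unary (toℕ s) ++ unary (toℕ i)) ++ address ss is
  address _        _        = []

  address-injective : ∀ ss is ss′ is′ {xs ys} → length ss ≡ length is → length ss ≡ length ss′ → length ss′ ≡ length is′ →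
    address ss is ++ xs ≡ address ss′ is′ ++ ys → ss ≡ ss′ × is ≡ is′ × xs ≡ ys
  address-injective []       []       []         []         _ _ _ eq = refl , refl , eq
  address-injective (s ∷ ss) (i ∷ is) (s′ ∷ ss′) (i′ ∷ is′) {xs} {ys} l₁ l₂ l₃ eq
    with unary-injective (toℕ s) (toℕ s′) (trans (sym (assoc₄ (unary (toℕ s)) (unary (toℕ i)) (address ss is) xs))
           (trans eq (assoc₄ (unary (toℕ s′)) (unary (toℕ i′)) (address ss′ is′) ys)))
    where
    assoc₄ : ∀ (as bs cs ds : List Bool) → ((as ++ bs) ++ cs) ++ ds ≡ as ++ (bs ++ (cs ++ ds))
    assoc₄ as bs cs ds = trans (++-assoc (as ++ bs) cs ds) (++-assoc as bs (cs ++ ds))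
  ... | eqₛ , eq₁ with unary-injective (toℕ i) (toℕ i′) eq₁
  ... | eqᵢ , eq₂ with address-injective ss is ss′ is′ (suc-injective l₁) (suc-injective l₂) (suc-injective l₃) eq₂
  ... | refl , refl , eq₃ = cong (_∷ ss) (toℕ-injective eqₛ) , cong (_∷ is) (toℕ-injective eqᵢ) , eq₃

record Automaton : Set where
  field
    states    : ℕ
    rule      : Fin states → Fin states → Fin states → Fin states
    initially : InputSymbol → Fin states
    accepting : Fin states

  module _ (N : ℕ) (x : List Bool) where
    diagram : ℕ → ℕ → Fin states
    diagram zero    i = initially (readInput x i)
    diagram (suc t) i = rule (diagram t (shift N before i)) (diagram t i) (diagram t (shift N after i))

-- Boolean formulas as gate templates relative to a cell

module Templates (𝒜 : Automaton) where
  open Automaton 𝒜 renaming (states to m)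

  tag : Fin m → ℕ → List Bool
  tag c j = unary (toℕ c) ++ unary j

  -- Relative references let finitely many templates serve the whole diagram. `local c j` is gate
  -- `j` of the formula for the present cell being in state `c`, with root 0; `earlier` points to
  -- such a root one time step before.
  data Ref : Set where
    unit    : Ref
    local   : Fin m → ℕ → Ref
    earlier : Offset → Fin m → Ref

  data Expr : Set where
    verum : Expr
    cell  : Offset → Fin m → Expr
    neg   : Expr → Expr
    _and_ : Expr → Expr → Expr

  Valuation : Set
  Valuation = Offset → Fin m → Bool

  eval : Valuation → Expr → Bool
  eval ρ verum      = true
  eval ρ (cell o c) = ρ o c
  eval ρ (neg e)    = not (eval ρ e)
  eval ρ (e and f)  = eval ρ e ∧ eval ρ f

  size : Expr → ℕ
  size verum      = 0
  size (cell _ _) = 0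
  size (neg e)    = 2 + size e
  size (e and f)  = 1 + (size e + size f)

  root : Fin m → ℕ → Expr → Ref
  root c j verum       = unit
  root c j (cell o c′) = earlier o c′
  root c j (neg _)     = local c j
  root c j (_ and _)   = local c j

  record Template : Set where
    constructor template
    field
      ref    : Ref
      node   : Node Ref
      normal : Bool
      value  : Valuation → Bool

  open Template

  -- Preorder numbering: the root comes before its predecessors, and each subexpression takes a
  -- block of consecutive numbers. A negation takes two gates, the complement and the quotient that
  -- makes it normal again.
  gates : Fin m → ℕ → Expr → List Template
  gates c j verum      = []
  gates c j (cell _ _) = []
  gates c j (neg e)    =
    template (local c j) (bin quotient unit (local c (1 + j))) true (λ ρ → eval ρ (neg e)) ∷
    template (local c (1 + j)) (compl (root c (2 + j) e)) false (λ ρ → eval ρ (neg e)) ∷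
    gates c (2 + j) e
  gates c j (e and f)  =
    template (local c j) (bin quotient (root c (1 + j) e) (root c (1 + j + size e) f)) true (λ ρ → eval ρ (e and f)) ∷
    gates c (1 + j) e ++ gates c (1 + j + size e) f

  refs-gates : ∀ c j e → map ref (gates c j e) ≡ map (local c) (range j (size e))
  refs-gates c j verum      = refl
  refs-gates c j (cell _ _) = refl
  refs-gates c j (neg e)    = cong (λ l → local c j ∷ local c (1 + j) ∷ l) (refs-gates c (2 + j) e)
  refs-gates c j (e and f)  = cong (local c j ∷_) (begin
    map ref (gates c (1 + j) e ++ gates c (1 + j + size e) f)
      ≡⟨ map-++ ref (gates c (1 + j) e) _ ⟩
    map ref (gates c (1 + j) e) ++ map ref (gates c (1 + j + size e) f)
      ≡⟨ cong₂ _++_ (refs-gates c (1 + j) e) (refs-gates c (1 + j + size e) f) ⟩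
    map (local c) (range (1 + j) (size e)) ++ map (local c) (range (1 + j + size e) (size f))
      ≡⟨ map-++ (local c) (range (1 + j) (size e)) _ ⟨
    map (local c) (range (1 + j) (size e) ++ range (1 + j + size e) (size f))
      ≡⟨ cong (map (local c)) (range-++ (1 + j) (size e) (size f)) ⟨
    map (local c) (range (1 + j) (size e + size f)) ∎)
    where open ≡-Reasoning

  instantiate : (Ref → List Bool) → Valuation → Template → Entry
  instantiate bits ρ t = entry (bits (ref t)) (mapNode bits (node t)) (normal t) (value t ρ)

  module _ (bits : Ref → List Bool) (bits-unit : bits unit ≡ []) (ρ : Valuation) where

    Ready : List Entry → Set
    Ready es = Sound es × Known es [] true true × (∀ o c → Known es (bits (earlier o c)) true (ρ o c))

    inst : List Template → List Entry
    inst = map (instantiate bits ρ)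

    -- Entries must find their predecessors further down, so the gates of the right operand are
    -- added first and those of the left operand on top of them.
    gates-sound : ∀ {es} c j e → Ready es →
      Ready (inst (gates c j e) ++ es) × Known (inst (gates c j e) ++ es) (bits (root c j e)) true (eval ρ e)
    gates-sound c j verum r@(s , u , k) = r , subst (λ p → Known _ p true true) (sym bits-unit) u
    gates-sound c j (cell o c′) r@(s , u , k) = r , k o c′
    gates-sound {es} c j (neg e) r with gates-sound c (2 + j) e r
    ... | (s , u , k) , kₑ =
      (subst (λ p → Justified es₁ (entry (bits (local c j)) (bin quotient p (bits (local c (1 + j)))) true _)) (sym bits-unit)
         (normalisation (known-there u) (_ , here refl))
       ∷ negation kₑ ∷ s
       , known-there (known-there u)
       , λ o c′ → known-there (known-there (k o c′)))
      , (_ , here refl)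
      where
      es₁ = instantiate bits ρ (template (local c (1 + j)) (compl (root c (2 + j) e)) false (λ ρ → eval ρ (neg e))) ∷ inst (gates c (2 + j) e) ++ es
    gates-sound {es} c j (e and f) r
      rewrite map-++ (instantiate bits ρ) (gates c (1 + j) e) (gates c (1 + j + size e) f)
            | ++-assoc (inst (gates c (1 + j) e)) (inst (gates c (1 + j + size e) f)) es
      with gates-sound c (1 + j + size e) f r
    ... | r′ , k_f with gates-sound c (1 + j) e r′
    ... | (s , u , k) , kₑ =
      (conjunction kₑ (known-++ (inst (gates c (1 + j) e)) k_f) ∷ s , known-there u , λ o c′ → known-there (k o c′))
      , (_ , here refl)

  -- A disjunction over neighbourhoods by De Morgan: a cell enters state `c` unless none of the
  -- triples that produce `c` is present.
  noneOf : List (Fin m × Fin m × Fin m) → Expr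
  noneOf []                 = verum
  noneOf ((l , c , r) ∷ us) = neg (cell before l and (cell here c and cell after r)) and noneOf us

  triples : List (Fin m × Fin m × Fin m)
  triples = cartesianProduct (allFin m) (cartesianProduct (allFin m) (allFin m))

  produces? : ∀ c (u : Fin m × Fin m × Fin m) → Dec (rule (proj₁ u) (proj₁ (proj₂ u)) (proj₂ (proj₂ u)) ≡ c)
  produces? c (l , h , r) = rule l h r Fin.≟ c

  update : Fin m → Expr
  update c = neg (noneOf (filter (produces? c) triples))

  stateOf : (Offset → Fin m) → Valuation
  stateOf σ o c = does (σ o Fin.≟ c)

  does-sound : ∀ {c d : Fin m} → does (c Fin.≟ d) ≡ true → c ≡ d
  does-sound {c} {d} eq with c Fin.≟ d
  ... | yes p = p

  does-refl : ∀ (c : Fin m) → does (c Fin.≟ c) ≡ true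
  does-refl c with c Fin.≟ c
  ... | yes p = refl
  ... | no ¬p = contradiction refl ¬p

  noneOf-true : ∀ σ us → ¬ (σ before , σ here , σ after) ∈ₗ us → eval (stateOf σ) (noneOf us) ≡ true
  noneOf-true σ []                 ∉ = refl
  noneOf-true σ ((l , c , r) ∷ us) ∉ with σ before Fin.≟ l | σ here Fin.≟ c | σ after Fin.≟ r
  ... | yes refl | yes refl | yes refl = contradiction (here refl) ∉
  ... | no _     | _        | _        = noneOf-true σ us (∉ ∘ there)
  ... | yes _    | no _     | _        = noneOf-true σ us (∉ ∘ there)
  ... | yes _    | yes _    | no _     = noneOf-true σ us (∉ ∘ there)

  noneOf-false : ∀ σ us → (σ before , σ here , σ after) ∈ₗ us → eval (stateOf σ) (noneOf us) ≡ false
  noneOf-false σ (_ ∷ us) (here refl)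
    rewrite does-refl (σ before) | does-refl (σ here) | does-refl (σ after) = refl
  noneOf-false σ ((l , c , r) ∷ us) (there u∈) rewrite noneOf-false σ us u∈ =
    ∧-comm (not (stateOf σ before l ∧ (stateOf σ here c ∧ stateOf σ after r))) false

  eval-update : ∀ σ c → eval (stateOf σ) (update c) ≡ does (rule (σ before) (σ here) (σ after) Fin.≟ c)
  eval-update σ c with rule (σ before) (σ here) (σ after) Fin.≟ c
  ... | yes eq = cong not (noneOf-false σ _ (∈-filter⁺ (produces? c)
    (∈-cartesianProduct⁺ (∈-allFin (σ before)) (∈-cartesianProduct⁺ (∈-allFin (σ here)) (∈-allFin (σ after)))) eq))
  ... | no ¬eq = cong not (noneOf-true σ (filter (produces? c) triples) λ u∈ →
    ¬eq (proj₂ (∈-filter⁻ (produces? c) {xs = triples} u∈)))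

  -- The flag marks the last row of the list, which is time 0; there the truth values are constants
  -- determined by the input symbol.
  cellTemplates : Bool → InputSymbol → Fin m → List Template
  cellTemplates false a c = gates c 0 (update c)
  cellTemplates true  a c =
    let v = does (initially a Fin.≟ c) in template (local c 0) (input (bitValue v)) true (λ _ → v) ∷ []

  templates : Bool → InputSymbol → List Template
  templates final a = concatMap (cellTemplates final a) (allFin m)

  cellSize : Bool → Fin m → ℕ
  cellSize false c = size (update c)
  cellSize true  c = 1

  indices : Bool → List (Fin m × ℕ)
  indices final = concatMap (λ c → map (c ,_) (range 0 (cellSize final c))) (allFin m)

  refs-templates : ∀ final a → map ref (templates final a) ≡ map (uncurry local) (indices final)
  refs-templates final a = begin
    map ref (concatMap (cellTemplates final a) (allFin m)) ≡⟨ map-concatMap ref (cellTemplates final a) (allFin m) ⟩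
    concatMap (map ref ∘ cellTemplates final a) (allFin m) ≡⟨ concatMap-cong (refs final) (allFin m) ⟩
    concatMap (λ c → map (local c) (range 0 (cellSize final c))) (allFin m)
      ≡⟨ concatMap-cong (λ c → map-∘ (range 0 (cellSize final c))) (allFin m) ⟩
    concatMap (λ c → map (uncurry local) (map (c ,_) (range 0 (cellSize final c)))) (allFin m)
      ≡⟨ map-concatMap (uncurry local) (λ c → map (c ,_) (range 0 (cellSize final c))) (allFin m) ⟨
    map (uncurry local) (indices final) ∎
    where
    open ≡-Reasoning
    refs : ∀ final c → map ref (cellTemplates final a c) ≡ map (local c) (range 0 (cellSize final c))
    refs false c = refs-gates c 0 (update c)
    refs true  c = refl

  indices-unique : ∀ final → Unique (indices final)
  indices-unique final = unique-concatMap _ (Uniqueₚ.allFin⁺ m)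
    (λ {c} _ → Uniqueₚ.map⁺ (cong proj₂) (range-unique 0 (cellSize final c)))
    (λ {c} {c′} _ _ y∈ y∈′ → trans (sym (cong proj₁ (proj₂ (proj₂ (∈-map⁻ (c ,_) y∈)))))
                                   (cong proj₁ (proj₂ (proj₂ (∈-map⁻ (c′ ,_) y∈′)))))

-- The diagram as a sound list of entries with distinct labels

module Layout (b : ℕ) (𝒜 : Automaton) (w : ℕ) (x : List Bool) where
  open Numerals b
  open Automaton 𝒜 renaming (states to m)
  open Templates 𝒜

  N : ℕ
  N = base ^ w

  location : ℕ → ℕ → List Bool
  location s i = address b (numeral w s) (numeral w i)

  bits : ℕ → ℕ → Ref → List Bool
  bits s i unit          = []
  bits s i (local c j)   = location s i ++ tag c j
  -- The preceding time step is the next row of the list. In the last row `suc s` would wrap to 0,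
  -- but the templates of that row are input gates only.
  bits s i (earlier o c) = location (suc s) (shift N o i) ++ tag c 0

  cellAt : ℕ → ℕ → Fin m
  cellAt s i = diagram N x (N ∸ suc s) i

  valuation : ℕ → ℕ → Valuation
  valuation s i = stateOf (λ o → cellAt (suc s) (shift N o i))

  -- Rows are listed by decreasing time: row s is the configuration at time N ∸ 1 ∸ s.
  block : ℕ → ℕ → List Entry
  block s i = map (instantiate (bits s i) (valuation s i)) (templates (carryOut w s) (readInput x i))

  row : ℕ → List Entry
  row s = concatMap (block s) (range 0 N)

  one : Entry
  one = entry [] (input 1) true true

  entries : List Entry
  entries = concatMap row (range 0 N) ++ one ∷ []

  KnownAt : List Entry → ℕ → ℕ → Set
  KnownAt es s i = ∀ c → Known es (bits s i (local c 0)) true (does (cellAt s i Fin.≟ c))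

  RowKnown : List Entry → ℕ → Set
  RowKnown es s = ∀ {i} → i < N → KnownAt es s i

  Below : ℕ → List Entry → Set
  Below s es = Sound es × Known es [] true true × (suc s < N → RowKnown es (suc s))

  cells-sound : ∀ {s i es} (expr : Fin m → Expr) → Ready (bits s i) refl (valuation s i) es → ∀ cs →
    let es′ = map (instantiate (bits s i) (valuation s i)) (concatMap (λ c → gates c 0 (expr c)) cs) ++ es in
    Ready (bits s i) refl (valuation s i) es′
    × (∀ {c} → c ∈ₗ cs → Known es′ (bits s i (root c 0 (expr c))) true (eval (valuation s i) (expr c)))
  cells-sound expr r [] = r , λ ()
  cells-sound {s} {i} {es} expr r (c ∷ cs)
    rewrite map-++ (instantiate (bits s i) (valuation s i)) (gates c 0 (expr c)) (concatMap (λ c → gates c 0 (expr c)) cs)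
          | ++-assoc (map (instantiate (bits s i) (valuation s i)) (gates c 0 (expr c)))
              (map (instantiate (bits s i) (valuation s i)) (concatMap (λ c → gates c 0 (expr c)) cs)) es
    with cells-sound expr r cs
  ... | r′ , k with gates-sound (bits s i) refl (valuation s i) c 0 (expr c) r′
  ... | r″ , k′ = r″ , λ { (here refl) → k′
                         ; (there c∈)  → known-++ (map (instantiate (bits s i) (valuation s i)) (gates c 0 (expr c))) (k c∈) }

  constants-sound : ∀ {s i es} a → Sound es → ∀ cs →
    let inst = map (instantiate (bits s i) (valuation s i)) (concatMap (cellTemplates true a) cs) in
    Sound (inst ++ es)
    × (∀ {c} → c ∈ₗ cs → Known (inst ++ es) (bits s i (local c 0)) true (does (initially a Fin.≟ c)))
  constants-sound a s []       = s , λ ()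
  constants-sound a s (c ∷ cs) with constants-sound a s cs
  ... | s′ , k = constant _ ∷ s′ , λ { (here refl) → _ , here refl ; (there c∈) → known-there (k c∈) }

  remaining : ∀ s → suc s < N → N ∸ suc s ≡ suc (N ∸ suc (suc s))
  remaining s lt = +-∸-assoc 1 lt

  cellAt-update : ∀ {s} i → suc s < N → cellAt s i ≡
    rule (cellAt (suc s) (shift N before i)) (cellAt (suc s) (shift N here i)) (cellAt (suc s) (shift N after i))
  cellAt-update {s} i lt = cong (λ t → diagram N x t i) (remaining s lt)

  cellAt-initial : ∀ {s} i → suc s ≡ N → cellAt s i ≡ initially (readInput x i)
  cellAt-initial {s} i eq = cong (λ t → diagram N x t i) (trans (cong (_∸ suc s) (sym eq)) (n∸n≡0 (suc s)))

  -- The carry out of the row counter is raised exactly in the last row, so it selects between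
  -- update formulas and constants without a comparison of numbers.
  block-sound : ∀ {s i es} → s < N → i < N → Below s es →
    Sound (block s i ++ es) × KnownAt (block s i ++ es) s i
  block-sound {s} {i} {es} s< i< (snd , u , k) with m≤n⇒m<n∨m≡n s<
  ... | inj₁ lt rewrite carryOut-below w s lt
    with cells-sound {s} {i} update (snd , u , λ o c → k lt (shift< b N o i<) c) (allFin m)
  ... | (snd′ , _) , k′ = snd′ , λ c → subst (Known _ _ true)
    (trans (eval-update (λ o → cellAt (suc s) (shift N o i)) c) (cong (λ d → does (d Fin.≟ c)) (sym (cellAt-update i lt))))
    (k′ (∈-allFin c))
  block-sound {s} {i} {es} s< i< (snd , u , k) | inj₂ eq rewrite proj₁ (wrap-around w s eq)
    with constants-sound {s} {i} (readInput x i) snd (allFin m)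
  ... | snd′ , k′ = snd′ , λ c → subst (Known _ _ true)
    (cong (λ d → does (d Fin.≟ c)) (sym (cellAt-initial i eq))) (k′ (∈-allFin c))

  -- Blocks refer only to the row below, never to each other. So the cells can be added one by one
  -- while `Below s` persists.
  row-sound : ∀ {s es} → s < N → Below s es → ∀ k r → k + r ≤ N →
    let es′ = concatMap (block s) (range k r) ++ es in
    Below s es′ × (∀ {i} → i ∈ₗ range k r → KnownAt es′ s i)
  row-sound s< bl k zero    le = bl , λ ()
  row-sound {s} {es} s< bl k (suc r) le
    rewrite ++-assoc (block s k) (concatMap (block s) (range (suc k) r)) es
    with row-sound s< bl (suc k) r (subst (_≤ N) (+-suc k r) le)
  ... | bl′@(_ , u , kn) , ka with block-sound s< (<-≤-trans (m<m+n k (s≤s z≤n)) le) bl′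
  ... | snd′ , kb =
    (snd′ , known-++ (block s k) u , λ lt i< c → known-++ (block s k) (kn lt i< c))
    , λ { (here refl) → kb ; (there i∈) c → known-++ (block s k) (ka i∈ c) }

  rows-sound : ∀ s r → s + r ≡ N → let es = concatMap row (range s r) ++ one ∷ [] in
    Sound es × Known es [] true true × (s < N → RowKnown es s)
  -- Here `s` equals `N`, so there is no row to be known yet.
  rows-sound s zero    eq = constant true ∷ [] , (_ , here refl) , λ s< →
    contradiction s< (≤⇒≯ (≤-reflexive (sym (trans (sym (+-identityʳ s)) eq))))
  rows-sound s (suc r) eq
    rewrite ++-assoc (row s) (concatMap row (range (suc s) r)) (one ∷ [])
    with row-sound {s} (<-≤-trans (m<m+n s (s≤s z≤n)) (≤-reflexive eq))
           (rows-sound (suc s) r (trans (sym (+-suc s r)) eq)) 0 N ≤-refl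
  ... | (snd , u , _) , k = snd , u , λ _ i< → k (range-complete 0 N z≤n i<)

  entries-sound : Sound entries
  entries-sound = proj₁ (rows-sound 0 N refl)

  output : List Bool
  output = bits 0 0 (local accepting 0)

  N>0 : 0 < N
  N>0 = m^n>0 base w

  output-known : Known entries output true (does (cellAt 0 0 Fin.≟ accepting))
  output-known = proj₂ (proj₂ (rows-sound 0 N refl)) N>0 N>0 accepting

  location-injective : ∀ {s i s′ i′ ys zs} → s < N → i < N → s′ < N → i′ < N →
    location s i ++ ys ≡ location s′ i′ ++ zs → s ≡ s′ × i ≡ i′ × ys ≡ zs
  location-injective {s} {i} {s′} {i′} s< i< s′< i′< eq
    with address-injective b (numeral w s) (numeral w i) (numeral w s′) (numeral w i′)
           (trans (length-numeral w s) (sym (length-numeral w i)))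
           (trans (length-numeral w s) (sym (length-numeral w s′)))
           (trans (length-numeral w s′) (sym (length-numeral w i′))) eq
  ... | eqₛ , eqᵢ , eq′ = numeral-injective w s< s′< eqₛ , numeral-injective w i< i′< eqᵢ , eq′

  labels-block : ∀ s i → map Entry.label (block s i) ≡
    map (λ (c , j) → location s i ++ tag c j) (indices (carryOut w s))
  labels-block s i = begin
    map Entry.label (map (instantiate (bits s i) (valuation s i)) ts) ≡⟨ map-∘ ts ⟨
    map (bits s i ∘ Template.ref) ts                                 ≡⟨ map-∘ ts ⟩
    map (bits s i) (map Template.ref ts)                             ≡⟨ cong (map (bits s i)) (refs-templates (carryOut w s) (readInput x i)) ⟩
    map (bits s i) (map (uncurry local) (indices (carryOut w s)))    ≡⟨ map-∘ (indices (carryOut w s)) ⟨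
    map (λ (c , j) → location s i ++ tag c j) (indices (carryOut w s)) ∎
    where
    open ≡-Reasoning
    ts = templates (carryOut w s) (readInput x i)

  tag-injective : ∀ {c j c′ j′} → tag c j ≡ tag c′ j′ → (c , j) ≡ (c′ , j′)
  tag-injective {c} {j} {c′} {j′} eq with unary-injective (toℕ c) (toℕ c′) eq
  ... | eq₁ , eq₂ with toℕ-injective eq₁ | unary-injective j j′ (cong (_++ []) eq₂)
  ... | refl | refl , _ = refl

  labels-concatMap : ∀ (f : ℕ → List Entry) ks → map Entry.label (concatMap f ks) ≡ concatMap (map Entry.label ∘ f) ks
  labels-concatMap f ks = map-concatMap Entry.label f ks

  in-range : ∀ {i} → i ∈ₗ range 0 N → i < N
  in-range i∈ = proj₂ (∈-range⁻ 0 N i∈)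

  block-unique : ∀ {s i} → s < N → i < N → Unique (map Entry.label (block s i))
  block-unique {s} {i} s< i< rewrite labels-block s i = Uniqueₚ.map⁺
    (λ eq → tag-injective (proj₂ (proj₂ (location-injective s< i< s< i< eq)))) (indices-unique (carryOut w s))

  ∈-block : ∀ {s i y} → y ∈ₗ map Entry.label (block s i) → ∃ λ c → ∃ λ j → y ≡ location s i ++ tag c j
  ∈-block {s} {i} y∈ rewrite labels-block s i =
    let ((c , j) , _ , eq) = ∈-map⁻ (λ (c , j) → location s i ++ tag c j) y∈ in c , j , eq

  rowLabels : ℕ → List (List Bool)
  rowLabels s = concatMap (map Entry.label ∘ block s) (range 0 N)

  row-unique : ∀ {s} → s < N → Unique (rowLabels s)
  row-unique {s} s< = unique-concatMap _ (range-unique 0 N) (λ i∈ → block-unique s< (in-range i∈))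
    λ {i} {i′} i∈ i′∈ y∈ y∈′ →
      let (c , j , eq) = ∈-block {s} {i} y∈ ; (c′ , j′ , eq′) = ∈-block {s} {i′} y∈′ in
      proj₁ (proj₂ (location-injective s< (in-range i∈) s< (in-range i′∈) (trans (sym eq) eq′)))

  ∈-row : ∀ {s y} → y ∈ₗ rowLabels s → ∃ λ i → i < N × ∃ λ c → ∃ λ j → y ≡ location s i ++ tag c j
  ∈-row {s} y∈ with find (∈-concatMap⁻ (map Entry.label ∘ block s) {xs = range 0 N} y∈)
  ... | i , i∈ , y∈′ = i , in-range i∈ , ∈-block {s} {i} y∈′

  labels-entries : map Entry.label entries ≡ concatMap rowLabels (range 0 N) ++ [] ∷ []
  labels-entries = trans (map-++ Entry.label (concatMap row (range 0 N)) (one ∷ []))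
    (cong (_++ [] ∷ []) (trans (labels-concatMap row (range 0 N))
      (concatMap-cong (λ s → labels-concatMap (block s) (range 0 N)) (range 0 N))))

  -- Addresses are decodable and separate rows and cells; tags separate the gates of one cell. Tags
  -- are nonempty, which leaves the empty label to `one`.
  entries-unique : Unique (map Entry.label entries)
  entries-unique rewrite labels-entries = Uniqueₚ.++⁺
    (unique-concatMap _ (range-unique 0 N) (λ s∈ → row-unique (in-range s∈))
      λ {s} {s′} s∈ s′∈ y∈ y∈′ →
        let (i , i< , c , j , eq) = ∈-row {s} y∈ ; (i′ , i′< , c′ , j′ , eq′) = ∈-row {s′} y∈′ in
        proj₁ (location-injective (in-range s∈) i< (in-range s′∈) i′< (trans (sym eq) eq′)))
    ([] ∷ [])
    λ { (y∈ , here refl) →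
          let (s , s∈ , y∈ₛ) = find (∈-concatMap⁻ rowLabels {xs = range 0 N} y∈)
              (i , _ , c , j , eq) = ∈-row {s} y∈ₛ
          in unary-nonempty (location s i) (toℕ c) (unary j) (sym eq) }

  layout-correct : encodeEntries output entries ∈ MC 𝒬 ⇔ diagram N x (N ∸ 1) 0 ≡ accepting
  layout-correct = mk⇔
    (λ mc → does-sound (MC⇒true entries entries-sound entries-unique output-known mc))
    (λ eq → true⇒MC entries entries-sound entries-unique output-known (trans (cong (λ d → does (d Fin.≟ accepting)) eq) (does-refl accepting)))

-- Transducers from sweeping machines

finite-↔ : ∀ {A B : Set} → A ↔ B → Finite B → Finite A
finite-↔ A↔B (n , B↔n) = n , (B↔n ↔-∘ A↔B)

finite-Fin : ∀ n → Finite (Fin n)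
finite-Fin n = n , ↔-id (Fin n)

finite-⊤ : Finite ⊤
finite-⊤ = 1 , ↔-sym 1↔⊤

finite-Bool : Finite Bool
finite-Bool = 2 , ↔-sym 2↔Bool

finite-⊎ : ∀ {A B : Set} → Finite A → Finite B → Finite (A ⊎ B)
finite-⊎ (m , A↔m) (n , B↔n) = m + n , (↔-sym +↔⊎ ↔-∘ (A↔m ⊎-↔ B↔n))

finite-× : ∀ {A B : Set} → Finite A → Finite B → Finite (A × B)
finite-× (m , A↔m) (n , B↔n) = m * n , (↔-sym *↔× ↔-∘ (A↔m ×-↔ B↔n))

finite-Maybe : ∀ {A : Set} → Finite A → Finite (Maybe A)
finite-Maybe fin = finite-↔ (mk↔ₛ′
  (λ { nothing → inj₁ tt ; (just a) → inj₂ a }) (λ { (inj₁ _) → nothing ; (inj₂ a) → just a })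
  (λ { (inj₁ _) → refl ; (inj₂ _) → refl }) (λ { nothing → refl ; (just _) → refl }))
  (finite-⊎ finite-⊤ fin)

finite-InputSymbol : Finite InputSymbol
finite-InputSymbol = finite-↔ (mk↔ₛ′
  (λ { leftEnd → nothing ; rightEnd → just nothing ; (bit b) → just (just b) })
  (λ { nothing → leftEnd ; (just nothing) → rightEnd ; (just (just b)) → bit b })
  (λ { nothing → refl ; (just nothing) → refl ; (just (just _)) → refl })
  (λ { leftEnd → refl ; rightEnd → refl ; (bit _) → refl }))
  (finite-Maybe (finite-Maybe finite-Bool))

bounded-Fin : ∀ n (f : Fin n → ℕ) → ∃ λ M → ∀ i → f i ≤ M
bounded-Fin zero    f = 0 , λ ()
bounded-Fin (suc n) f with bounded-Fin n (f ∘ suc)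
... | M , f≤M = f zero ⊔ M , λ { zero → m≤m⊔n (f zero) M ; (suc i) → ≤-trans (f≤M i) (m≤n⊔m (f zero) M) }

bounded : ∀ {A : Set} → Finite A → (f : A → ℕ) → ∃ λ M → ∀ a → f a ≤ M
bounded (n , A↔n) f with bounded-Fin n (f ∘ Inverse.from A↔n)
... | M , f≤M = M , λ a → subst (λ a → f a ≤ M) (Inverse.strictlyInverseʳ A↔n a) (f≤M (Inverse.to A↔n a))

-- Saturates to stay within `Fin`; `toℕ-next` covers the positions inside a word or program of
-- length at most `L`.
next : ∀ {L} → Fin (suc L) → Fin (suc L)
next {L} j = fromℕ< {suc (toℕ j) ⊓ L} (s≤s (m⊓n≤n (suc (toℕ j)) L))

toℕ-next : ∀ {L} (j : Fin (suc L)) → toℕ j < L → toℕ (next j) ≡ suc (toℕ j)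
toℕ-next {L} j j<L = trans (toℕ-fromℕ< (s≤s (m⊓n≤n (suc (toℕ j)) L))) (m≤n⇒m⊓n≡m j<L)

drop-suc : ∀ {A : Set} n (xs : List A) {y ys} → drop n xs ≡ y ∷ ys → drop (suc n) xs ≡ ys × n < length xs
drop-suc zero    (x ∷ xs) refl = refl , s≤s z≤n
drop-suc (suc n) (x ∷ xs) eq   = let (eq′ , lt) = drop-suc n xs eq in eq′ , s≤s lt
drop-suc zero    []       ()
drop-suc (suc n) []       ()

iterate-+ : ∀ {A : Set} (f : A → A) m n x → iterate f (m + n) x ≡ iterate f n (iterate f m x)
iterate-+ f zero    n x = refl
iterate-+ f (suc m) n x = iterate-+ f m n (f x)

iterate-fixed : ∀ {A : Set} (f : A → A) n {x} → f x ≡ x → iterate f n x ≡ x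
iterate-fixed f zero    eq = refl
iterate-fixed f (suc n) eq = trans (cong (iterate f n) eq) (iterate-fixed f n eq)

cells-writeMove : ∀ {Γ : Set} (bl : Γ) t (a : Γ × Dir) → cells t ≤ cells (writeMove bl t a)
cells-writeMove bl (tape []       _ rs)       (_ , left)  = ≤-refl
cells-writeMove bl (tape (l ∷ ls) _ rs)       (_ , left)  = ≤-reflexive (sym (+-suc (length ls) _))
cells-writeMove bl (tape ls       _ rs)       (_ , stay)  = ≤-refl
cells-writeMove bl (tape ls       _ [])       (_ , right) = n≤1+n _
cells-writeMove bl (tape ls       _ (r ∷ rs)) (_ , right) = ≤-reflexive (+-suc (length ls) _)

module _ {A : Set} (final : A → Bool) (f : A → A) where

  infixr 5 _then_

  -- Every configuration that is left must be non-final: transducers freeze once they halt, while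
  -- the step functions of the intermediate machines do not test for halting.
  data _⟶*_ (x : A) : A → Set where
    done  : x ⟶* x
    _then_ : ∀ {y} → final x ≡ false → f x ⟶* y → x ⟶* y

  ⟶*-trans : ∀ {x y z} → x ⟶* y → y ⟶* z → x ⟶* z
  ⟶*-trans done         r = r
  ⟶*-trans (nf then q) r = nf then ⟶*-trans q r

  ⟶*-≡ : ∀ {x y z} → x ⟶* y → y ≡ z → x ⟶* z
  ⟶*-≡ r refl = r

record WordConfiguration (State Γ : Set) : Set where
  constructor ⟨_,_,_,_⟩
  field
    state  : State
    inHead : ℕ
    work   : Tape Γ
    out    : List Bool

-- An intermediate model: one work tape, and a whole word of output per step.
record WordMachine : Set₁ where
  field
    State Γ      : Set
    state-finite : Finite State
    Γ-finite     : Finite Γ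
    blankΓ       : Γ
    start        : State
    halting      : State → Bool
    δ            : State → InputSymbol → Γ → State × Dir × (Γ × Dir) × List Bool

  Configuration : Set
  Configuration = WordConfiguration State Γ

  step : List Bool → Configuration → Configuration
  step x ⟨ q , i , t , o ⟩ =
    let (q′ , d , a , word) = δ q (readInput x i) (scanned t)
    in ⟨ q′ , moveInput x d i , writeMove blankΓ t a , o ++ word ⟩

  Reaches : List Bool → Configuration → Configuration → Set
  Reaches x = _⟶*_ (halting ∘ WordConfiguration.state) (step x)

-- Printing words one bit per step

module Printing (M : WordMachine) where
  open WordMachine M

  longest : ∃ λ L → ∀ q a g → length (proj₂ (proj₂ (proj₂ (δ q a g)))) ≤ L
  longest with bounded (finite-× state-finite (finite-× finite-InputSymbol Γ-finite))
                 (λ (q , a , g) → length (proj₂ (proj₂ (proj₂ (δ q a g)))))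
  ... | L , ≤L = L , λ q a g → ≤L (q , a , g)

  L : ℕ
  L = proj₁ longest

  -- The second component of a state counts the bits of the current word
  -- printed so far.
  State′ : Set
  State′ = State × Fin (suc L)

  -- All bits but the last are printed with both heads at rest and the scanned symbol restored, so
  -- that `δ` yields the same word again; the actual move accompanies the last bit.
  emit : State′ → Γ → State × Dir × (Γ × Dir) → List Bool →
    State′ × Dir × Vec (Γ × Dir) 1 × Maybe Bool
  emit (q , j) g (q′ , d , a) []          = (q′ , zero) , d , a ∷ [] , nothing
  emit (q , j) g (q′ , d , a) (b ∷ [])    = (q′ , zero) , d , a ∷ [] , just b
  emit (q , j) g (q′ , d , a) (b ∷ _ ∷ _) = (q , next j) , stay , (g , stay) ∷ [] , just b

  δ′ : State′ → InputSymbol → Vec Γ 1 → State′ × Dir × Vec (Γ × Dir) 1 × Maybe Bool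
  δ′ (q , j) s (g ∷ []) = let (q′ , d , a , word) = δ q s g in
    emit (q , j) g (q′ , d , a) (drop (toℕ j) word)

  transducer : Transducer
  transducer = record
    { State        = State′
    ; Γ            = Γ
    ; state-finite = finite-× state-finite (finite-Fin (suc L))
    ; Γ-finite     = Γ-finite
    ; blankΓ       = blankΓ
    ; k            = 1
    ; start        = start , zero
    ; halting      = halting ∘ proj₁
    ; δ            = δ′
    }

  module 𝒯 = Transducer transducer

  embed : Configuration → 𝒯.Config
  embed ⟨ q , i , t , o ⟩ = config (q , zero) i (t ∷ []) o

  perform : List Bool → ℕ → Tape Γ → List Bool → State′ × Dir × Vec (Γ × Dir) 1 × Maybe Bool → 𝒯.Config
  perform x i t o (q′ , d , actions , b) =
    config q′ (moveInput x d i) (Vec.zipWith (writeMove blankΓ) (t ∷ []) actions) (o ++ fromMaybe b)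

  step-printing : ∀ x q j i t o {rest} → halting q ≡ false →
    let (q′ , d , a , word) = δ q (readInput x i) (scanned t) in
    drop (toℕ j) word ≡ rest →
    𝒯.step x (config (q , j) i (t ∷ []) o) ≡ perform x i t o (emit (q , j) (scanned t) (q′ , d , a) rest)
  step-printing x q j i t o running refl rewrite running = refl

  print : ∀ x q (j : Fin (suc L)) i t o rest → halting q ≡ false →
    let (q′ , d , a , word) = δ q (readInput x i) (scanned t) in
    drop (toℕ j) word ≡ rest →
    ∃ λ n → iterate (𝒯.step x) n (config (q , j) i (t ∷ []) o) ≡
      config (q′ , zero) (moveInput x d i) (writeMove blankΓ t a ∷ []) (o ++ rest)
  print x q j i t o []       running eq = 1 , step-printing x q j i t o running eq
  print x q j i t o (b ∷ []) running eq = 1 , step-printing x q j i t o running eq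
  print x q j i t o (b ∷ c ∷ rest) running eq =
    let word       = proj₂ (proj₂ (proj₂ (δ q (readInput x i) (scanned t))))
        (eq′ , j<) = drop-suc (toℕ j) word eq
        j+1        = toℕ-next j (<-≤-trans j< (proj₂ longest q (readInput x i) (scanned t)))
        (n , run)  = print x q (next j) i t (o ++ b ∷ []) (c ∷ rest) running
                       (trans (cong (λ k → drop k word) j+1) eq′)
    in suc n , trans (cong (iterate (𝒯.step x) n) (step-printing x q j i t o running eq))
         (trans run (cong (config _ _ _) (++-assoc o (b ∷ []) (c ∷ rest))))

  simulates : ∀ x {c c′} → Reaches x c c′ → ∃ λ n → iterate (𝒯.step x) n (embed c) ≡ embed c′
  simulates x done = 0 , refl
  simulates x {⟨ q , i , t , o ⟩} (running then r) with print x q zero i t o _ running refl | simulates x r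
  ... | m , eq | n , eq′ = m + n , trans (iterate-+ (𝒯.step x) m n _) (trans (cong (iterate (𝒯.step x) n) eq) eq′)

  used : 𝒯.Config → ℕ
  used c = cells (Vec.head (TransducerConfig.work c))

  used-step : ∀ x c → used c ≤ used (𝒯.step x c)
  used-step x (config q i (t ∷ []) o) with halting (proj₁ q)
  ... | true  = ≤-refl
  ... | false with δ′ q (readInput x i) (scanned t ∷ [])
  ... | _ , _ , a ∷ [] , _ = cells-writeMove blankΓ t a

  used-iterate : ∀ x n c → used c ≤ used (iterate (𝒯.step x) n c)
  used-iterate x zero    c = ≤-refl
  used-iterate x (suc n) c = ≤-trans (used-step x c) (used-iterate x n (𝒯.step x c))

  halted-fixed : ∀ x c → 𝒯.halting (TransducerConfig.state c) ≡ true → 𝒯.step x c ≡ c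
  halted-fixed x c eq rewrite eq = refl

  -- The number of visited cells never decreases, so it is largest at the end.
  used-bounded : ∀ x n c → let c′ = iterate (𝒯.step x) n c in
    𝒯.halting (TransducerConfig.state c′) ≡ true → ∀ t → used (iterate (𝒯.step x) t c) ≤ used c′
  used-bounded x n c halted t with ≤-total t n
  ... | inj₁ t≤n = subst (λ k → used (iterate (𝒯.step x) t c) ≤ used (iterate (𝒯.step x) k c)) (m+[n∸m]≡n t≤n)
    (≤-trans (used-iterate x (n ∸ t) _) (≤-reflexive (cong used (sym (iterate-+ (𝒯.step x) t (n ∸ t) c)))))
  ... | inj₂ n≤t = ≤-reflexive (cong used (begin
    iterate (𝒯.step x) t c                                ≡⟨ cong (λ k → iterate (𝒯.step x) k c) (m+[n∸m]≡n n≤t) ⟨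
    iterate (𝒯.step x) (n + (t ∸ n)) c                    ≡⟨ iterate-+ (𝒯.step x) n (t ∸ n) c ⟩
    iterate (𝒯.step x) (t ∸ n) (iterate (𝒯.step x) n c)   ≡⟨ iterate-fixed (𝒯.step x) (t ∸ n) (halted-fixed x _ halted) ⟩
    iterate (𝒯.step x) n c                                ∎))
    where open ≡-Reasoning

  logspace : ∀ {f : List Bool → List Bool} k →
    (∀ x → ∃ λ c → Reaches x ⟨ start , 1 , blankTape blankΓ , [] ⟩ c × halting (WordConfiguration.state c) ≡ true
                   × WordConfiguration.out c ≡ f x × cells (WordConfiguration.work c) ≤ k * ⌈log₂ length x ⌉ + k) →
    LogspaceComputable f
  logspace {f} k terminates = transducer , correct , k , space
    where
    correct : ∀ x → ∃ λ t → 𝒯.halting (TransducerConfig.state (𝒯.run t x)) ≡ true × TransducerConfig.out (𝒯.run t x) ≡ f x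
    correct x with terminates x
    ... | c , r , halted , eq , _ with simulates x r
    ... | n , run = n , trans (cong (𝒯.halting ∘ TransducerConfig.state) run) halted
                      , trans (cong TransducerConfig.out run) eq

    single : ∀ {m} (ts : Vec (Tape Γ) 1) → cells (Vec.head ts) ≤ m → VecAll (λ τ → cells τ ≤ m) ts
    single (t ∷ []) le = le ∷ []

    space : ∀ x t → VecAll (λ τ → cells τ ≤ k * ⌈log₂ length x ⌉ + k) (TransducerConfig.work (𝒯.run t x))
    space x t with terminates x
    ... | c , r , halted , _ , le with simulates x r
    ... | n , run = single _ (≤-trans
      (used-bounded x n 𝒯.initial (trans (cong (𝒯.halting ∘ TransducerConfig.state) run) halted) t)
      (≤-trans (≤-reflexive (cong used run)) le))

-- Machines that sweep over a list of digits

record SweeperConfiguration (Control Digit : Set) : Set where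
  constructor ⟪_,_,_,_⟫
  field
    control : Control
    digits  : List Digit
    inHead  : ℕ
    out     : List Bool

-- The work tape holds a list of digits.  In one step the digits are read and
-- rewritten from left to right by a finite automaton with states Carry; at the
-- right end one digit may be appended and the input head may move.
record Sweeper : Set₁ where
  field
    Control Carry Digit : Set
    control-finite : Finite Control
    carry-finite   : Finite Carry
    digit-finite   : Finite Digit
    start  : Control
    carry₀ : Carry
    halted : Control → Bool
    visit  : Control → Carry → Digit → Carry × Digit × List Bool
    turn   : Control → Carry → InputSymbol → Control × Maybe Digit × Dir × List Bool

  sweep : Control → Carry → List Digit → Carry × List Digit × List Bool
  sweep c κ []       = κ , [] , []
  sweep c κ (d ∷ ds) =
    let (κ′ , d′ , o)    = visit c κ d
        (κ″ , ds′ , o′) = sweep c κ′ ds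
    in κ″ , d′ ∷ ds′ , o ++ o′

  Situation : Set
  Situation = SweeperConfiguration Control Digit

  pass : List Bool → Situation → Situation
  pass x ⟪ c , ds , h , o ⟫ =
    let (κ , ds′ , o₁)          = sweep c carry₀ ds
        (c′ , extra , dir , o₂) = turn c κ (readInput x h)
    in ⟪ c′ , ds′ ++ fromMaybe extra , moveInput x dir h , o ++ (o₁ ++ o₂) ⟫

  Passes : List Bool → Situation → Situation → Set
  Passes x = _⟶*_ (halted ∘ SweeperConfiguration.control) (pass x)

module Sweeping (S : Sweeper) where
  open Sweeper S

  -- `boot` puts a mark on the leftmost cell, which stays there and tells the returning head where
  -- to turn.
  Mode : Set
  Mode = ⊤ ⊎ (Control × Carry) ⊎ Control

  pattern boot     = inj₁ tt
  pattern scan c κ = inj₂ (inj₁ (c , κ))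
  pattern back c   = inj₂ (inj₂ c)

  Γ : Set
  Γ = Maybe (Maybe Digit)

  pattern empty = nothing
  pattern mark  = just nothing
  pattern dig d = just (just d)

  extraCell : Maybe Digit → Γ
  extraCell nothing  = empty
  extraCell (just d) = dig d

  scanDigit : Control → Carry × Digit × List Bool → Mode × Dir × (Γ × Dir) × List Bool
  scanDigit c (κ , d , o) = scan c κ , stay , (dig d , right) , o

  turnBack : Control × Maybe Digit × Dir × List Bool → Mode × Dir × (Γ × Dir) × List Bool
  turnBack (c , extra , dir , o) = back c , dir , (extraCell extra , left) , o

  δ : Mode → InputSymbol → Γ → Mode × Dir × (Γ × Dir) × List Bool
  δ boot       a g       = scan start carry₀ , stay , (mark , right) , []
  δ (scan c κ) a (dig d) = scanDigit c (visit c κ d)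
  δ (scan c κ) a empty   = turnBack (turn c κ a)
  -- A scan starts to the right of the mark, and the way back crosses digits only. So this case and
  -- that of a blank on the way back do not occur in the simulated runs; the machine idles there.
  δ (scan c κ) a mark    = scan c κ , stay , (mark , stay) , []
  δ (back c)   a (dig d) = back c , stay , (dig d , left) , []
  δ (back c)   a mark    = scan c carry₀ , stay , (mark , right) , []
  δ (back c)   a empty   = back c , stay , (empty , stay) , []

  halting : Mode → Bool
  halting (scan c κ) = halted c
  halting _          = false

  machine : WordMachine
  machine = record
    { State        = Mode
    ; Γ            = Γ
    ; state-finite = finite-⊎ finite-⊤ (finite-⊎ (finite-× control-finite carry-finite) control-finite)
    ; Γ-finite     = finite-Maybe (finite-Maybe digit-finite)
    ; blankΓ       = empty
    ; start        = boot
    ; halting      = halting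
    ; δ            = δ
    }

  open WordMachine machine using (State; Configuration; Reaches; step)

  atLeft : List Γ → List Γ → Tape Γ
  atLeft ls []       = tape ls empty []
  atLeft ls (g ∷ gs) = tape ls g gs

  atRight : List Γ → List Γ → Tape Γ
  atRight []       gs = tape [] empty gs
  atRight (l ∷ ls) gs = tape ls l gs

  move-right : ∀ ls g h gs → writeMove empty (tape ls g gs) (h , right) ≡ atLeft (h ∷ ls) gs
  move-right ls g h []       = refl
  move-right ls g h (_ ∷ gs) = refl

  ⟶-trans : ∀ {x a b c} → Reaches x a b → Reaches x b c → Reaches x a c
  ⟶-trans {x} = ⟶*-trans (WordMachine.halting machine ∘ WordConfiguration.state) (step x)

  digs : List Digit → List Γ
  digs = map (λ d → dig d)

  scanning : ∀ x c κ ls ds gs h o → halted c ≡ false →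
    let (κ′ , ds′ , o′) = sweep c κ ds in
    Reaches x (⟨_,_,_,_⟩ (scan c κ) h (atLeft ls (digs ds ++ gs)) o)
              (⟨_,_,_,_⟩ (scan c κ′) h (atLeft (digs ds′ ʳ++ ls) gs) (o ++ o′))
  scanning x c κ ls []       gs h o nh = ⟶*-≡ _ _ done (cong (⟨_,_,_,_⟩ _ _ _) (sym (++-identityʳ o)))
  scanning x c κ ls (d ∷ ds) gs h o nh with visit c κ d in eq
  ... | κ′ , d′ , o₁ = nh then
    subst₂ (Reaches x)
      (trans (cong (λ t → ⟨_,_,_,_⟩ (scan c κ′) h t (o ++ o₁)) (sym (move-right ls (dig d) (dig d′) (digs ds ++ gs)))) lem)
      (cong (⟨_,_,_,_⟩ _ _ _) (++-assoc o o₁ _))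
      (scanning x c κ′ (dig d′ ∷ ls) ds gs h (o ++ o₁) nh)
    where
    lem : ⟨_,_,_,_⟩ (scan c κ′) h (writeMove empty (tape ls (dig d) (digs ds ++ gs)) (dig d′ , right)) (o ++ o₁)
        ≡ step x (⟨_,_,_,_⟩ (scan c κ) h (tape ls (dig d) (digs ds ++ gs)) o)
    lem rewrite eq = refl

  out-++[] : ∀ {x m h t o c} → Reaches x ⟨ m , h , t , o ⟩ c → Reaches x ⟨ m , h , t , o ++ [] ⟩ c
  out-++[] {x} {m} {h} {t} {o} {c} = subst (λ o′ → Reaches x ⟨ m , h , t , o′ ⟩ c) (sym (++-identityʳ o))

  returning : ∀ x c ds gs h o →
    Reaches x ⟨ back c , h , atRight (digs ds ++ mark ∷ []) gs , o ⟩
              ⟨ scan c carry₀ , h , atLeft (mark ∷ []) (digs ds ʳ++ gs) , o ⟩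
  returning x c []            gs h o = refl then
    ⟶*-≡ _ _ done (cong₂ (⟨_,_,_,_⟩ (scan c carry₀) h) (move-right [] mark mark gs) (++-identityʳ o))
  returning x c (d ∷ [])      gs h o = refl then out-++[] (returning x c [] (dig d ∷ gs) h o)
  returning x c (d ∷ d′ ∷ ds) gs h o = refl then out-++[] (returning x c (d′ ∷ ds) (dig d ∷ gs) h o)

  -- The cell in which the head turns counts as visited even if no digit is appended, so the tape
  -- may end with one explicit blank.
  data Blanks : List Γ → Set where
    none   : Blanks []
    single : Blanks (empty ∷ [])

  data Home : Situation → Configuration → Set where
    home : ∀ {c ds h o gs} → Blanks gs →
      Home ⟪ c , ds , h , o ⟫ ⟨ scan c carry₀ , h , atLeft (mark ∷ []) (digs ds ++ gs) , o ⟩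

  scanned-blank : ∀ ls {gs} → Blanks gs → atLeft ls gs ≡ tape ls empty []
  scanned-blank ls none   = refl
  scanned-blank ls single = refl

  digs-ʳ++ : ∀ ds gs → digs ds ʳ++ gs ≡ digs (reverse ds) ++ gs
  digs-ʳ++ ds gs = trans (ʳ++-defn (digs ds)) (cong (_++ gs) (sym (reverse-map (λ d → dig d) ds)))

  digs-reverse-ʳ++ : ∀ ds gs → digs (reverse ds) ʳ++ gs ≡ digs ds ++ gs
  digs-reverse-ʳ++ ds gs = trans (digs-ʳ++ (reverse ds) gs) (cong (λ l → digs l ++ gs) (reverse-involutive ds))

  turning-left : ∀ ds g → writeMove empty (tape (digs ds ++ mark ∷ []) empty []) (g , left) ≡
    atRight (digs ds ++ mark ∷ []) (g ∷ [])
  turning-left []       g = refl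
  turning-left (d ∷ ds) g = refl

  extra-digs : ∀ ds extra → ∃ λ gs → Blanks gs ×
    digs ds ++ extraCell extra ∷ [] ≡ digs (ds ++ fromMaybe extra) ++ gs
  extra-digs ds nothing  = empty ∷ [] , single , cong (λ l → digs l ++ empty ∷ []) (sym (++-identityʳ ds))
  extra-digs ds (just d) = [] , none , trans (sym (map-++ (λ d → dig d) ds (d ∷ []))) (sym (++-identityʳ _))

  -- The head scans to the first blank, turns there in one step and returns to the mark. Both
  -- directions reverse the digits on the zipper, and the two reversals cancel.
  pass-simulated : ∀ x {c ds h o k} → halted c ≡ false → Home ⟪ c , ds , h , o ⟫ k →
    ∃ λ k′ → Reaches x k k′ × Home (pass x ⟪ c , ds , h , o ⟫) k′
  pass-simulated x {c} {ds} {h} {o} nh (home {gs = gs} blanks) =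
    let (κ , ds′ , o₁)          = sweep c carry₀ ds
        (c′ , extra , dir , o₂) = turn c κ (readInput x h)
        (gs′ , blanks′ , eq)    = extra-digs ds′ extra
        at-end = trans (scanned-blank (digs ds′ ʳ++ mark ∷ []) blanks)
                   (cong (λ ls → tape ls empty []) (digs-ʳ++ ds′ (mark ∷ [])))
        back-home = ⟨ scan c′ carry₀ , moveInput x dir h
                    , atLeft (mark ∷ []) (digs (reverse ds′) ʳ++ extraCell extra ∷ []) , (o ++ o₁) ++ o₂ ⟩
    in _ , ⟶-trans (⟶*-≡ _ _ (scanning x c carry₀ (mark ∷ []) ds gs h o nh)
                     (cong (λ t → ⟨ scan c κ , h , t , o ++ o₁ ⟩) at-end))
             (nh then ⟶*-≡ _ _
               (subst (λ t → Reaches x ⟨ back c′ , moveInput x dir h , t , (o ++ o₁) ++ o₂ ⟩ back-home)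
                 (sym (turning-left (reverse ds′) (extraCell extra)))
                 (returning x c′ (reverse ds′) (extraCell extra ∷ []) (moveInput x dir h) ((o ++ o₁) ++ o₂)))
               (cong₂ (λ ls o → ⟨ scan c′ carry₀ , moveInput x dir h , atLeft (mark ∷ []) ls , o ⟩)
                 (trans (digs-reverse-ʳ++ ds′ (extraCell extra ∷ [])) eq) (++-assoc o o₁ o₂)))
         , home blanks′

  passes-simulated : ∀ x {s s′ k} → Passes x s s′ → Home s k → ∃ λ k′ → Reaches x k k′ × Home s′ k′
  passes-simulated x done        hm = _ , done , hm
  passes-simulated x (nh then r) hm with pass-simulated x nh hm
  ... | k₁ , r₁ , hm₁ with passes-simulated x r hm₁
  ... | k₂ , r₂ , hm₂ = k₂ , ⟶-trans r₁ r₂ , hm₂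

  cells-atLeft : ∀ gs → cells (atLeft (mark ∷ []) gs) ≤ 2 + length gs
  cells-atLeft []       = ≤-refl
  cells-atLeft (g ∷ gs) = n≤1+n _

  cells-home : ∀ {s k} → Home s k →
    cells (WordConfiguration.work k) ≤ 3 + length (SweeperConfiguration.digits s)
  cells-home (home {ds = ds} {gs = gs} blanks) = begin
    cells (atLeft (mark ∷ []) (digs ds ++ gs)) ≤⟨ cells-atLeft (digs ds ++ gs) ⟩
    2 + length (digs ds ++ gs)                 ≡⟨ cong (2 +_) (trans (length-++ (digs ds)) (cong (_+ length gs) (length-map _ ds))) ⟩
    2 + (length ds + length gs)                ≤⟨ +-monoʳ-≤ 2 (+-monoʳ-≤ (length ds) (blanks≤1 blanks)) ⟩
    2 + (length ds + 1)                        ≡⟨ cong (2 +_) (+-comm (length ds) 1) ⟩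
    3 + length ds                              ∎
    where
    open ≤-Reasoning
    blanks≤1 : ∀ {gs} → Blanks gs → length gs ≤ 1
    blanks≤1 none   = z≤n
    blanks≤1 single = ≤-refl

  home-halted : ∀ {c ds h o k} → Home ⟪ c , ds , h , o ⟫ k → halted c ≡ true →
    WordMachine.halting machine (WordConfiguration.state k) ≡ true × WordConfiguration.out k ≡ o
  home-halted (home _) eq = eq , refl

  logspace : ∀ {f : List Bool → List Bool} (n : ℕ) →
    (∀ x → ∃ λ c → ∃ λ ds → ∃ λ h → Passes x ⟪ start , [] , 1 , [] ⟫ ⟪ c , ds , h , f x ⟫ ×
           halted c ≡ true × length ds ≤ n + ⌈log₂ length x ⌉) →
    LogspaceComputable f
  logspace {f} n terminates = Printing.logspace machine (3 + n) λ x →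
    let (c , ds , h , r , halts , len) = terminates x
        (k , r′ , hm) = passes-simulated x r (home none)
        (halts′ , out≡) = home-halted hm halts
    in k , (refl then r′) , halts′ , out≡ , (begin
         cells (WordConfiguration.work k)                     ≤⟨ cells-home hm ⟩
         3 + length ds                                        ≤⟨ +-monoʳ-≤ 3 len ⟩
         3 + (n + ⌈log₂ length x ⌉)                           ≡⟨ +-comm (3 + n) _ ⟩
         ⌈log₂ length x ⌉ + (3 + n)                           ≤⟨ +-monoˡ-≤ (3 + n) (m≤m+n ⌈log₂ length x ⌉ _) ⟩
         (3 + n) * ⌈log₂ length x ⌉ + (3 + n)                 ∎)
    where open ≤-Reasoning

-- The transducer that prints the circuit

-- Without the closing comma, since a gate name is printed in pieces: sentinel bit, address, tag.
spell : List Bool → List Bool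
spell bs = concatMap tokenBits (map digit bs)

spell-++ : ∀ bs cs → spell (bs ++ cs) ≡ spell bs ++ spell cs
spell-++ bs cs = trans (cong (concatMap tokenBits) (map-++ digit bs cs)) (concatMap-++ tokenBits (map digit bs) (map digit cs))

numberBits : ℕ → List Bool
numberBits n = concatMap tokenBits (numberTokens n)

numberBits-gateName : ∀ bs → numberBits (gateName bs) ≡ spell (true ∷ []) ++ (spell bs ++ tokenBits comma)
numberBits-gateName bs = begin
  concatMap tokenBits (map digit (toBinary (gateName bs)) ++ comma ∷ [])
    ≡⟨ concatMap-++ tokenBits (map digit (toBinary (gateName bs))) (comma ∷ []) ⟩
  spell (toBinary (gateName bs)) ++ tokenBits comma ≡⟨ cong (λ l → spell l ++ tokenBits comma) (toBinary-gateName bs) ⟩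
  spell (true ∷ []) ++ (spell bs ++ tokenBits comma) ∎
  where open ≡-Reasoning

encodeRecord-numbers : ∀ ns → encodeRecord ns ≡ concatMap numberBits ns ++ tokenBits end
encodeRecord-numbers []       = refl
encodeRecord-numbers (n ∷ ns) = begin
  concatMap tokenBits ((numberTokens n ++ concatMap numberTokens ns) ++ end ∷ [])
    ≡⟨ cong (concatMap tokenBits) (++-assoc (numberTokens n) _ _) ⟩
  concatMap tokenBits (numberTokens n ++ recordTokens ns)
    ≡⟨ concatMap-++ tokenBits (numberTokens n) (recordTokens ns) ⟩
  numberBits n ++ encodeRecord ns                        ≡⟨ cong (numberBits n ++_) (encodeRecord-numbers ns) ⟩
  numberBits n ++ (concatMap numberBits ns ++ tokenBits end) ≡⟨ ++-assoc (numberBits n) _ _ ⟨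
  concatMap numberBits (n ∷ ns) ++ tokenBits end         ∎
  where open ≡-Reasoning

-- The input head rests on the end marker while the cells of the diagram go on beyond the input;
-- both see `rightEnd`.
readInput-saturates : ∀ x i → readInput x (i ⊓ suc (length x)) ≡ readInput x i
readInput-saturates x       zero          = refl
readInput-saturates []      (suc zero)    = refl
readInput-saturates []      (suc (suc i)) = refl
readInput-saturates (b ∷ x) (suc zero)    = refl
readInput-saturates (b ∷ x) (suc (suc i)) = readInput-saturates x (suc i)

readInput-inside : ∀ x {k} → k < length x → ∃ λ b → readInput x (suc k) ≡ bit b
readInput-inside (b ∷ x) {zero}  _        = b , refl
readInput-inside (b ∷ x) {suc k} (s≤s lt) = readInput-inside x lt

readInput-end : ∀ x → readInput x (suc (length x)) ≡ rightEnd
readInput-end []      = refl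
readInput-end (b ∷ x) = readInput-end x

readInput≢leftEnd : ∀ x i → readInput x (suc i) ≢ leftEnd
readInput≢leftEnd (b ∷ x) (suc i) = readInput≢leftEnd x i
readInput≢leftEnd []      i       ()
readInput≢leftEnd (b ∷ x) zero    ()

-- The base is at least 2, so that digits can also hold bits.
module Program (b′ : ℕ) (𝒜 : Automaton) where
  b : ℕ
  b = suc b′

  open Numerals b
  open Automaton 𝒜 renaming (states to m) using (initially; accepting)
  open Templates 𝒜

  -- Fixed text is printed when a sweep turns, an address digit by digit during the sweep. Each
  -- instruction takes one pass.
  data Instruction : Set where
    literal : List Bool → Instruction
    spelled : (nextRow : Bool) → Offset → Instruction

  refCode : Ref → List Instruction
  refCode unit          = literal (numberBits (gateName [])) ∷ []
  refCode (local c j)   = literal (spell (true ∷ [])) ∷ spelled false here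
    ∷ literal (spell (tag c j) ++ tokenBits comma) ∷ []
  refCode (earlier o c) = literal (spell (true ∷ [])) ∷ spelled true o
    ∷ literal (spell (tag c 0) ++ tokenBits comma) ∷ []

  templateCode : Template → List Instruction
  templateCode (template r ν _ _) =
    refCode r ++ literal (numberBits (labelCode ν)) ∷ concatMap refCode (preds ν) ++ literal (tokenBits end) ∷ []

  -- The program of a cell depends on its position only through the flag of the last row and the
  -- input symbol, so there are finitely many programs and the program counter fits into the
  -- control.
  Kind : Set
  Kind = (Bool × InputSymbol) ⊎ Bool

  pattern cellCode final a = inj₁ (final , a)
  pattern header         = inj₂ false
  pattern footer         = inj₂ true

  code : Kind → List Instruction
  code (cellCode final a) = concatMap templateCode (templates final a)
  code header           = refCode (local accepting 0) ++ literal (tokenBits end) ∷ []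
  -- The gate `one` has name `gateName []`, which is 1, and input label 1; the second record is the
  -- number `b = 1` of the instance.
  code footer           = literal (encodeRecord (1 ∷ 1 ∷ [])) ∷ literal (encodeRecord (1 ∷ [])) ∷ []

  kind-finite : Finite Kind
  kind-finite = finite-⊎ (finite-× finite-Bool finite-InputSymbol) finite-Bool

  codeBound : ∃ λ M → ∀ k → length (code k) ≤ M
  codeBound = bounded kind-finite (length ∘ code)

  M : ℕ
  M = proj₁ codeBound

  data Stage : Set where
    count clear rewind test advanceCell advanceRow stop : Stage

  stage-finite : Finite Stage
  stage-finite = 7 , mk↔ₛ′
    (λ { count → # 0 ; clear → # 1 ; rewind → # 2 ; test → # 3 ; advanceCell → # 4 ; advanceRow → # 5 ; stop → # 6 })
    (λ { zero → count ; (suc zero) → clear ; (suc (suc zero)) → rewind ; (suc (suc (suc zero))) → test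
       ; (suc (suc (suc (suc zero)))) → advanceCell ; (suc (suc (suc (suc (suc zero))))) → advanceRow
       ; (suc (suc (suc (suc (suc (suc zero)))))) → stop })
    (λ { zero → refl ; (suc zero) → refl ; (suc (suc zero)) → refl ; (suc (suc (suc zero))) → refl
       ; (suc (suc (suc (suc zero)))) → refl ; (suc (suc (suc (suc (suc zero))))) → refl
       ; (suc (suc (suc (suc (suc (suc zero)))))) → refl })
    (λ { count → refl ; clear → refl ; rewind → refl ; test → refl ; advanceCell → refl ; advanceRow → refl ; stop → refl })

  Control : Set
  Control = Stage ⊎ (Kind × Fin (suc M))

  pattern at s      = inj₁ s
  pattern exec k pc = inj₂ (k , pc)

  -- The two components count rows and cells.
  Pair : Set
  Pair = Digit × Digit

  -- Whether an increment or decrement is still pending in either component.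
  Pending : Set
  Pending = Bool × Bool

  rowOffset : Bool → Offset
  rowOffset false = here
  rowOffset true  = after

  instruction : Kind → Fin (suc M) → Maybe Instruction
  instruction k pc = head (drop (toℕ pc) (code k))

  visitInstruction : Maybe Instruction → Pending → Pair → Pending × Pair × List Bool
  visitInstruction (just (spelled r o)) (κₛ , κᵢ) (dₛ , dᵢ) =
    -- The neighbour's digits are computed for printing only. The stored pair is unchanged, so no
    -- pass has to undo the offset.
    let (κₛ′ , dₛ′) = offsetDigit b (rowOffset r) κₛ dₛ
        (κᵢ′ , dᵢ′) = offsetDigit b o κᵢ dᵢ
    in (κₛ′ , κᵢ′) , (dₛ , dᵢ) , spell (unary (toℕ dₛ′) ++ unary (toℕ dᵢ′))
  visitInstruction _ κ d = κ , d , []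

  onePair : Pair
  onePair = suc zero , zero

  visit : Control → Pending → Pair → Pending × Pair × List Bool
  visit (at count)       (true , κ)  (zero , _)  = (false , κ) , onePair , []
  visit (at count)       (true , κ)  (suc _ , _) = (true , κ) , (zero , zero) , []
  visit (at count)       (false , κ) d           = (false , κ) , d , []
  visit (at clear)       κ           d           = κ , (zero , zero) , []
  -- A trial increment of the row counter: the digits stay, and the carry tells whether this is the
  -- last row.
  visit (at test)        (κₛ , κᵢ)   (dₛ , dᵢ)   = (proj₁ (incDigit κₛ dₛ) , κᵢ) , (dₛ , dᵢ) , []
  visit (at advanceCell) (κₛ , κᵢ)   (dₛ , dᵢ)   = (κₛ , proj₁ (incDigit κᵢ dᵢ)) , (dₛ , proj₂ (incDigit κᵢ dᵢ)) , []
  visit (at advanceRow)  (κₛ , κᵢ)   (dₛ , dᵢ)   = (proj₁ (incDigit κₛ dₛ) , κᵢ) , (proj₂ (incDigit κₛ dₛ) , dᵢ) , []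
  visit (at rewind)      κ           d           = κ , d , []
  visit (at stop)        κ           d           = κ , d , []
  visit (exec k pc)      κ           d           = visitInstruction (instruction k pc) κ d

  enter : Kind → Control
  enter k = exec k zero

  continuation : Kind → Control
  continuation (cellCode _ _) = at advanceCell
  continuation header       = at rewind
  continuation footer       = at stop

  turnInstruction : Kind → Fin (suc M) → Maybe Instruction → Control × Maybe Pair × Dir × List Bool
  turnInstruction k pc nothing                = continuation k , nothing , stay , []
  turnInstruction k pc (just (literal word))  = exec k (next pc) , nothing , stay , word
  turnInstruction k pc (just (spelled _ _))   = exec k (next pc) , nothing , stay , []

  turn : Control → Pending → InputSymbol → Control × Maybe Pair × Dir × List Bool
  turn (at count)       (κ , _) (bit _)   = at count , (if κ then just onePair else nothing) , right , []
  -- The sweep that meets the end marker has incremented as well, so the digits left behind are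
  -- those of n + 1.
  turn (at count)       (κ , _) _         = at clear , (if κ then just onePair else nothing) , stay , []
  turn (at clear)       _       _         = enter header , nothing , stay , []
  turn (at rewind)      _       leftEnd   = at test , nothing , stay , []
  turn (at rewind)      _       _         = at rewind , nothing , left , []
  turn (at test)        (κ , _) a         = enter (cellCode κ a) , nothing , stay , []
  turn (at advanceCell) (_ , true)  _     = at advanceRow , nothing , stay , []
  -- The input head follows the cell counter until it reaches the end marker.
  turn (at advanceCell) (_ , false) _     = at test , nothing , right , []
  turn (at advanceRow)  (true , _)  _     = enter footer , nothing , stay , []
  turn (at advanceRow)  (false , _) _     = at rewind , nothing , stay , []
  turn (at stop)        _       _         = at stop , nothing , stay , []
  turn (exec k pc)      _       _         = turnInstruction k pc (instruction k pc)

  stopped : Control → Bool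
  stopped (at stop) = true
  stopped _         = false

  sweeper : Sweeper
  sweeper = record
    { Control        = Control
    ; Carry          = Pending
    ; Digit          = Pair
    ; control-finite = finite-⊎ stage-finite (finite-× kind-finite (finite-Fin (suc M)))
    ; carry-finite   = finite-× finite-Bool finite-Bool
    ; digit-finite   = finite-× (finite-Fin (suc b)) (finite-Fin (suc b))
    ; start          = at count
    ; carry₀         = true , true
    ; halted         = stopped
    ; visit          = visit
    ; turn           = turn
    }

  open Sweeper sweeper using (sweep; Passes; pass)

  infixr 6 _⨾_
  _⨾_ : ∀ {x s s′ s″} → Passes x s s′ → Passes x s′ s″ → Passes x s s″
  _⨾_ = ⟶*-trans _ _

  single : ∀ {x s s′} → stopped (SweeperConfiguration.control s) ≡ false → pass x s ≡ s′ → Passes x s s′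
  single running refl = running then done

  sweep-test : ∀ κₛ κᵢ ss is → length ss ≡ length is →
    sweep (at test) (κₛ , κᵢ) (zip ss is) ≡ ((proj₁ (ripple incDigit κₛ ss) , κᵢ) , zip ss is , [])
  sweep-test κₛ κᵢ []       []       _  = refl
  sweep-test κₛ κᵢ (s ∷ ss) (i ∷ is) eq rewrite sweep-test (proj₁ (incDigit κₛ s)) κᵢ ss is (suc-injective eq) = refl

  sweep-advanceCell : ∀ κₛ κᵢ ss is → length ss ≡ length is →
    sweep (at advanceCell) (κₛ , κᵢ) (zip ss is) ≡
      ((κₛ , proj₁ (ripple incDigit κᵢ is)) , zip ss (proj₂ (ripple incDigit κᵢ is)) , [])
  sweep-advanceCell κₛ κᵢ []       []       _  = refl
  sweep-advanceCell κₛ κᵢ (s ∷ ss) (i ∷ is) eq rewrite sweep-advanceCell κₛ (proj₁ (incDigit κᵢ i)) ss is (suc-injective eq) = refl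

  sweep-advanceRow : ∀ κₛ κᵢ ss is → length ss ≡ length is →
    sweep (at advanceRow) (κₛ , κᵢ) (zip ss is) ≡
      ((proj₁ (ripple incDigit κₛ ss) , κᵢ) , zip (proj₂ (ripple incDigit κₛ ss)) is , [])
  sweep-advanceRow κₛ κᵢ []       []       _  = refl
  sweep-advanceRow κₛ κᵢ (s ∷ ss) (i ∷ is) eq rewrite sweep-advanceRow (proj₁ (incDigit κₛ s)) κᵢ ss is (suc-injective eq) = refl

  sweep-rewind : ∀ κ ds → sweep (at rewind) κ ds ≡ (κ , ds , [])
  sweep-rewind κ []       = refl
  sweep-rewind κ (d ∷ ds) rewrite sweep-rewind κ ds = refl

  sweep-clear : ∀ κ ds → sweep (at clear) κ ds ≡ (κ , zip (numeral (length ds) 0) (numeral (length ds) 0) , [])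
  sweep-clear κ []       = refl
  sweep-clear κ (d ∷ ds) rewrite sweep-clear κ ds = refl

  bitPair : Bool → Pair
  bitPair false = zero , zero
  bitPair true  = onePair

  sweep-count : ∀ κ κᵢ bs → let ((κ′ , _) , ds , o) = sweep (at count) (κ , κᵢ) (map bitPair bs) in
    ds ++ fromMaybe (if κ′ then just onePair else nothing) ≡ map bitPair (if κ then increment bs else bs) × o ≡ []
  sweep-count false κᵢ []           = refl , refl
  sweep-count true  κᵢ []           = refl , refl
  sweep-count false κᵢ (b ∷ bs)     = let (eq , eq′) = sweep-count false κᵢ bs in cong (bitPair b ∷_) eq , eq′
  sweep-count true  κᵢ (false ∷ bs) = let (eq , eq′) = sweep-count false κᵢ bs in cong (onePair ∷_) eq , eq′
  sweep-count true  κᵢ (true ∷ bs)  = let (eq , eq′) = sweep-count true κᵢ bs in cong ((zero , zero) ∷_) eq , eq′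

  sweep-exec : ∀ k pc κ {i} ds → instruction k pc ≡ i → (∀ κ d → visitInstruction i κ d ≡ (κ , d , [])) →
    sweep (exec k pc) κ ds ≡ (κ , ds , [])
  sweep-exec k pc κ []       eq idle = refl
  sweep-exec k pc κ (d ∷ ds) refl idle rewrite idle κ d | sweep-exec k pc κ ds refl idle = refl

  sweep-spelled : ∀ k pc κₛ κᵢ r o ss is → instruction k pc ≡ just (spelled r o) → length ss ≡ length is →
    proj₂ (sweep (exec k pc) (κₛ , κᵢ) (zip ss is)) ≡
      (zip ss is , spell (address b (proj₂ (ripple (offsetDigit b (rowOffset r)) κₛ ss))
                                    (proj₂ (ripple (offsetDigit b o) κᵢ is))))
  sweep-spelled k pc κₛ κᵢ r o []       []       eq _ = refl
  sweep-spelled k pc κₛ κᵢ r o (s ∷ ss) (i ∷ is) eq len rewrite eq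
    with sweep-spelled k pc (proj₁ (offsetDigit b (rowOffset r) κₛ s)) (proj₁ (offsetDigit b o κᵢ i)) r o ss is eq (suc-injective len)
  ... | eq′ = cong₂ _,_ (cong ((s , i) ∷_) (cong proj₁ eq′))
    (trans (cong (word ++_) (cong proj₂ eq′))
           (sym (spell-++ (unary (toℕ (proj₂ (offsetDigit b (rowOffset r) κₛ s))) ++ unary (toℕ (proj₂ (offsetDigit b o κᵢ i)))) _)))
    where word = spell (unary (toℕ (proj₂ (offsetDigit b (rowOffset r) κₛ s))) ++ unary (toℕ (proj₂ (offsetDigit b o κᵢ i))))

  -- The complete run of the printing sweeper

  module Execution (x : List Bool) where
    n : ℕ
    n = length x

    w : ℕ
    w = numeralWidth n

    open Layout b 𝒜 w x

    pairs : ℕ → ℕ → List Pair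
    pairs s i = zip (numeral w s) (numeral w i)

    same-length : ∀ s i → length (numeral w s) ≡ length (numeral w i)
    same-length s i = trans (length-numeral w s) (sym (length-numeral w i))

    print : ℕ → ℕ → Instruction → List Bool
    print s i (literal word) = word
    print s i (spelled r o)  = spell (location (if r then suc s else s) (shift N o i))

    printAll : ℕ → ℕ → List Instruction → List Bool
    printAll s i = concatMap (print s i)

    print-refCode : ∀ s i r → printAll s i (refCode r) ≡ numberBits (gateName (bits s i r))
    print-refCode s i unit          = ++-identityʳ _
    print-refCode s i (local c j)   = begin
      spell (true ∷ []) ++ (spell (location s i) ++ ((spell (tag c j) ++ tokenBits comma) ++ []))
        ≡⟨ cong (λ l → spell (true ∷ []) ++ (spell (location s i) ++ l)) (++-identityʳ _) ⟩
      spell (true ∷ []) ++ (spell (location s i) ++ (spell (tag c j) ++ tokenBits comma))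
        ≡⟨ cong (spell (true ∷ []) ++_) (++-assoc (spell (location s i)) (spell (tag c j)) _) ⟨
      spell (true ∷ []) ++ ((spell (location s i) ++ spell (tag c j)) ++ tokenBits comma)
        ≡⟨ cong (λ l → spell (true ∷ []) ++ (l ++ tokenBits comma)) (spell-++ (location s i) (tag c j)) ⟨
      spell (true ∷ []) ++ (spell (location s i ++ tag c j) ++ tokenBits comma)
        ≡⟨ numberBits-gateName (location s i ++ tag c j) ⟨
      numberBits (gateName (bits s i (local c j))) ∎
      where open ≡-Reasoning
    -- The text is that of a local reference made from the neighbour's place in row `suc s`.
    print-refCode s i (earlier o c) = print-refCode (suc s) (shift N o i) (local c 0)

    printAll-++ : ∀ s i is js → printAll s i (is ++ js) ≡ printAll s i is ++ printAll s i js
    printAll-++ s i = concatMap-++ (print s i)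

    print-refCodes : ∀ s i rs → printAll s i (concatMap refCode rs) ≡ concatMap numberBits (map (gateName ∘ bits s i) rs)
    print-refCodes s i []       = refl
    print-refCodes s i (r ∷ rs) = trans (printAll-++ s i (refCode r) (concatMap refCode rs))
      (cong₂ _++_ (print-refCode s i r) (print-refCodes s i rs))

    nodeRecord-mapNode : ∀ {G H : Set} (f : G → H) (g : H → ℕ) k ν →
      nodeRecord g k (mapNode f ν) ≡ k ∷ labelCode ν ∷ map (g ∘ f) (preds ν)
    nodeRecord-mapNode f g k (input _)   = refl
    nodeRecord-mapNode f g k (compl _)   = refl
    nodeRecord-mapNode f g k (bin _ _ _) = refl

    print-templateCode : ∀ s i t → printAll s i (templateCode t) ≡
      encodeRecord (entryRecord (instantiate (bits s i) (valuation s i) t))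
    print-templateCode s i (template r ν m v) = begin
      printAll s i (refCode r ++ literal (numberBits (labelCode ν)) ∷ rest)
        ≡⟨ printAll-++ s i (refCode r) _ ⟩
      printAll s i (refCode r) ++ (numberBits (labelCode ν) ++ printAll s i rest)
        ≡⟨ cong₂ (λ l l′ → l ++ (numberBits (labelCode ν) ++ l′)) (print-refCode s i r) rest-printed ⟩
      name ++ (numberBits (labelCode ν) ++ (ps ++ tokenBits end))
        ≡⟨ cong (name ++_) (++-assoc (numberBits (labelCode ν)) ps _) ⟨
      name ++ ((numberBits (labelCode ν) ++ ps) ++ tokenBits end)
        ≡⟨ ++-assoc name _ _ ⟨
      concatMap numberBits (gateName (bits s i r) ∷ labelCode ν ∷ map (gateName ∘ bits s i) (preds ν)) ++ tokenBits end
        ≡⟨ encodeRecord-numbers (gateName (bits s i r) ∷ labelCode ν ∷ map (gateName ∘ bits s i) (preds ν)) ⟨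
      encodeRecord (gateName (bits s i r) ∷ labelCode ν ∷ map (gateName ∘ bits s i) (preds ν))
        ≡⟨ cong encodeRecord (nodeRecord-mapNode (bits s i) gateName (gateName (bits s i r)) ν) ⟨
      encodeRecord (nodeRecord gateName (gateName (bits s i r)) (mapNode (bits s i) ν)) ∎
      where
      open ≡-Reasoning
      rest = concatMap refCode (preds ν) ++ literal (tokenBits end) ∷ []
      name = numberBits (gateName (bits s i r))
      ps   = concatMap numberBits (map (gateName ∘ bits s i) (preds ν))
      rest-printed : printAll s i rest ≡ ps ++ tokenBits end
      rest-printed = trans (printAll-++ s i (concatMap refCode (preds ν)) _)
        (cong (_++ tokenBits end) (print-refCodes s i (preds ν)))

    entryBits : List Entry → List Bool
    entryBits = concatMap (encodeRecord ∘ entryRecord)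

    entryBits-++ : ∀ es fs → entryBits (es ++ fs) ≡ entryBits es ++ entryBits fs
    entryBits-++ = concatMap-++ (encodeRecord ∘ entryRecord)

    print-block : ∀ s i → printAll s i (code (cellCode (carryOut w s) (readInput x i))) ≡ entryBits (block s i)
    print-block s i = go (templates (carryOut w s) (readInput x i))
      where
      go : ∀ ts → printAll s i (concatMap templateCode ts) ≡ entryBits (map (instantiate (bits s i) (valuation s i)) ts)
      go []       = refl
      go (t ∷ ts) = trans (printAll-++ s i (templateCode t) (concatMap templateCode ts))
        (cong₂ _++_ (print-templateCode s i t) (go ts))

    print-header : printAll 0 0 (code header) ≡ encodeRecord (gateName output ∷ [])
    print-header = begin
      printAll 0 0 (code header) ≡⟨ printAll-++ 0 0 (refCode (local accepting 0)) (literal (tokenBits end) ∷ []) ⟩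
      printAll 0 0 (refCode (local accepting 0)) ++ tokenBits end
        ≡⟨ cong (_++ tokenBits end) (print-refCode 0 0 (local accepting 0)) ⟩
      numberBits (gateName output) ++ tokenBits end
        ≡⟨ cong (_++ tokenBits end) (++-identityʳ (numberBits (gateName output))) ⟨
      concatMap numberBits (gateName output ∷ []) ++ tokenBits end
        ≡⟨ encodeRecord-numbers (gateName output ∷ []) ⟨
      encodeRecord (gateName output ∷ []) ∎
      where open ≡-Reasoning

    ⟪⟫-out : ∀ {c : Control} {ds : List Pair} {h o o′} → o ≡ o′ → ⟪ c , ds , h , o ⟫ ≡ ⟪ c , ds , h , o′ ⟫
    ⟪⟫-out {c} {ds} {h} = cong ⟪ c , ds , h ,_⟫

    exec-step : ∀ {s i} k pc h o ins → i < N → instruction k pc ≡ just ins →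
      Passes x ⟪ exec k pc , pairs s i , h , o ⟫ ⟪ exec k (next pc) , pairs s i , h , o ++ print s i ins ⟫
    exec-step {s} {i} k pc h o (literal word) i< eq = single refl lem
      where
      lem : pass x ⟪ exec k pc , pairs s i , h , o ⟫ ≡ ⟪ exec k (next pc) , pairs s i , h , o ++ word ⟫
      lem rewrite sweep-exec k pc (true , true) (pairs s i) eq (λ _ _ → refl) | eq | ++-identityʳ (pairs s i) = refl
    exec-step {s} {i} k pc h o (spelled r off) i< eq = single refl lem
      where
      rows : ∀ r → proj₂ (ripple (offsetDigit b (rowOffset r)) true (numeral w s)) ≡ numeral w (if r then suc s else s)
      rows false = ripple-here b true (numeral w s)
      rows true  = refl
      lem : pass x ⟪ exec k pc , pairs s i , h , o ⟫ ≡
        ⟪ exec k (next pc) , pairs s i , h , o ++ spell (location (if r then suc s else s) (shift N off i)) ⟫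
      lem rewrite sweep-spelled k pc true true r off (numeral w s) (numeral w i) eq (same-length s i)
                | eq | ++-identityʳ (pairs s i) | rows r | ripple-offset b w off i<
                | ++-identityʳ (spell (location (if r then suc s else s) (shift N off i))) = refl

    exec-end : ∀ {s i} k pc h o → instruction k pc ≡ nothing →
      Passes x ⟪ exec k pc , pairs s i , h , o ⟫ ⟪ continuation k , pairs s i , h , o ⟫
    exec-end {s} {i} k pc h o eq = single refl lem
      where
      lem : pass x ⟪ exec k pc , pairs s i , h , o ⟫ ≡ ⟪ continuation k , pairs s i , h , o ⟫
      lem rewrite sweep-exec k pc (true , true) (pairs s i) eq (λ _ _ → refl) | eq | ++-identityʳ (pairs s i) | ++-identityʳ o = refl

    execute-from : ∀ {s i} k pc h o is → i < N → drop (toℕ pc) (code k) ≡ is →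
      Passes x ⟪ exec k pc , pairs s i , h , o ⟫ ⟪ continuation k , pairs s i , h , o ++ printAll s i is ⟫
    execute-from {s} {i} k pc h o []         i< eq =
      exec-end {s} {i} k pc h o (cong head eq) ⨾ ⟶*-≡ _ _ done (⟪⟫-out (sym (++-identityʳ o)))
    execute-from {s} {i} k pc h o (ins ∷ is) i< eq =
      let (eq′ , lt) = drop-suc (toℕ pc) (code k) eq
          eq″ = trans (cong (λ j → drop j (code k)) (toℕ-next pc (<-≤-trans lt (proj₂ codeBound k)))) eq′
      in exec-step {s} {i} k pc h o ins i< (cong head eq)
         ⨾ execute-from {s} {i} k (next pc) h (o ++ print s i ins) is i< eq″
         ⨾ ⟶*-≡ _ _ done (⟪⟫-out (++-assoc o (print s i ins) (printAll s i is)))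

    execute : ∀ {s i} k h o → i < N →
      Passes x ⟪ enter k , pairs s i , h , o ⟫ ⟪ continuation k , pairs s i , h , o ++ printAll s i (code k) ⟫
    execute {s} {i} k h o i< = execute-from {s} {i} k zero h o (code k) i< refl

    headAt : ℕ → ℕ
    headAt i = i ⊓ suc n

    headAt-suc : ∀ i → suc (headAt i) ⊓ suc n ≡ headAt (suc i)
    headAt-suc i = cong suc (begin
      (i ⊓ suc n) ⊓ n ≡⟨ ⊓-assoc i (suc n) n ⟩
      i ⊓ (suc n ⊓ n) ≡⟨ cong (i ⊓_) (m≥n⇒m⊓n≡n (n≤1+n n)) ⟩
      i ⊓ n           ∎)
      where open ≡-Reasoning

    test-pass : ∀ s i o → Passes x ⟪ at test , pairs s i , headAt i , o ⟫
      ⟪ enter (cellCode (carryOut w s) (readInput x i)) , pairs s i , headAt i , o ⟫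
    test-pass s i o = single refl lem
      where
      lem : pass x ⟪ at test , pairs s i , headAt i , o ⟫ ≡
        ⟪ enter (cellCode (carryOut w s) (readInput x i)) , pairs s i , headAt i , o ⟫
      lem rewrite sweep-test true true (numeral w s) (numeral w i) (same-length s i)
                | readInput-saturates x i | ++-identityʳ (pairs s i) | ++-identityʳ o = refl

    cell-pass : ∀ {s i} o → i < N → Passes x ⟪ at test , pairs s i , headAt i , o ⟫
      ⟪ at advanceCell , pairs s i , headAt i , o ++ entryBits (block s i) ⟫
    cell-pass {s} {i} o i< =
      test-pass s i o ⨾ execute {s} {i} (cellCode (carryOut w s) (readInput x i)) (headAt i) o i<
      ⨾ ⟶*-≡ _ _ done (⟪⟫-out (cong (o ++_) (print-block s i)))

    next-cell : ∀ {s i} o → suc i < N → Passes x ⟪ at advanceCell , pairs s i , headAt i , o ⟫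
      ⟪ at test , pairs s (suc i) , headAt (suc i) , o ⟫
    next-cell {s} {i} o lt = single refl lem
      where
      lem : pass x ⟪ at advanceCell , pairs s i , headAt i , o ⟫ ≡ ⟪ at test , pairs s (suc i) , headAt (suc i) , o ⟫
      lem rewrite sweep-advanceCell true true (numeral w s) (numeral w i) (same-length s i)
                | carryOut-below w i lt | headAt-suc i | ++-identityʳ (pairs s (suc i)) | ++-identityʳ o = refl

    -- The overflow itself resets the cell counter, so a new row starts at 0 without a clearing
    -- pass.
    last-cell : ∀ {s i} o → suc i ≡ N → Passes x ⟪ at advanceCell , pairs s i , headAt i , o ⟫
      ⟪ at advanceRow , pairs s 0 , headAt i , o ⟫
    last-cell {s} {i} o eq = single refl lem
      where
      lem : pass x ⟪ at advanceCell , pairs s i , headAt i , o ⟫ ≡ ⟪ at advanceRow , pairs s 0 , headAt i , o ⟫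
      lem rewrite sweep-advanceCell true true (numeral w s) (numeral w i) (same-length s i)
                | proj₁ (wrap-around w i eq) | proj₂ (wrap-around w i eq) | ++-identityʳ (pairs s 0) | ++-identityʳ o = refl

    row-passes : ∀ {s} r i o → i + suc r ≡ N → ∃ λ h → Passes x ⟪ at test , pairs s i , headAt i , o ⟫
      ⟪ at advanceRow , pairs s 0 , h , o ++ entryBits (concatMap (block s) (range i (suc r))) ⟫
    row-passes {s} zero i o eq = headAt i ,
      (cell-pass {s} {i} o (≤-reflexive eq′) ⨾ last-cell {s} {i} _ eq′
       ⨾ ⟶*-≡ _ _ done (⟪⟫-out (cong (λ es → o ++ entryBits es) (sym (++-identityʳ (block s i))))))
      where
      eq′ : suc i ≡ N
      eq′ = trans (sym (+-comm i 1)) eq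
    row-passes {s} (suc r) i o eq =
      let (h , rest) = row-passes {s} r (suc i) (o ++ entryBits (block s i)) eq′
      in h , (cell-pass {s} {i} o (<-trans (n<1+n i) lt) ⨾ next-cell {s} {i} _ lt ⨾ rest
              ⨾ ⟶*-≡ _ _ done (⟪⟫-out (trans (++-assoc o _ _)
                  (cong (o ++_) (sym (entryBits-++ (block s i) (concatMap (block s) (range (suc i) (suc r)))))))))
      where
      eq′ : suc i + suc r ≡ N
      eq′ = trans (sym (+-suc i (suc r))) eq
      lt : suc i < N
      lt = <-≤-trans (m<m+n (suc i) (s≤s z≤n)) (≤-reflexive eq′)

    rewinding : ∀ h ds o → Passes x ⟪ at rewind , ds , h , o ⟫ ⟪ at test , ds , 0 , o ⟫
    rewinding zero    ds o = single refl lem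
      where
      lem : pass x ⟪ at rewind , ds , 0 , o ⟫ ≡ ⟪ at test , ds , 0 , o ⟫
      lem rewrite sweep-rewind (true , true) ds | ++-identityʳ ds | ++-identityʳ o = refl
    rewinding (suc h) ds o = single refl lem ⨾ rewinding h ds o
      where
      lem : pass x ⟪ at rewind , ds , suc h , o ⟫ ≡ ⟪ at rewind , ds , h , o ⟫
      lem rewrite sweep-rewind (true , true) ds with readInput x (suc h) in eq
      ... | leftEnd  = contradiction eq (readInput≢leftEnd x h)
      ... | rightEnd rewrite ++-identityʳ ds | ++-identityʳ o = refl
      ... | bit _    rewrite ++-identityʳ ds | ++-identityʳ o = refl

    next-row : ∀ {s} h o → suc s < N → Passes x ⟪ at advanceRow , pairs s 0 , h , o ⟫ ⟪ at rewind , pairs (suc s) 0 , h , o ⟫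
    next-row {s} h o lt = single refl lem
      where
      lem : pass x ⟪ at advanceRow , pairs s 0 , h , o ⟫ ≡ ⟪ at rewind , pairs (suc s) 0 , h , o ⟫
      lem rewrite sweep-advanceRow true true (numeral w s) (numeral w 0) (same-length s 0)
                | carryOut-below w s lt | ++-identityʳ (pairs (suc s) 0) | ++-identityʳ o = refl

    last-row : ∀ {s} h o → suc s ≡ N → Passes x ⟪ at advanceRow , pairs s 0 , h , o ⟫ ⟪ enter footer , pairs 0 0 , h , o ⟫
    last-row {s} h o eq = single refl lem
      where
      lem : pass x ⟪ at advanceRow , pairs s 0 , h , o ⟫ ≡ ⟪ enter footer , pairs 0 0 , h , o ⟫
      lem rewrite sweep-advanceRow true true (numeral w s) (numeral w 0) (same-length s 0)
                | proj₁ (wrap-around w s eq) | proj₂ (wrap-around w s eq) | ++-identityʳ (pairs 0 0) | ++-identityʳ o = refl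

    suc-pred-N : suc (pred N) ≡ N
    suc-pred-N = suc-pred N {{>-nonZero N>0}}

    full-row : ∀ {s} o → ∃ λ h → Passes x ⟪ at test , pairs s 0 , 0 , o ⟫
      ⟪ at advanceRow , pairs s 0 , h , o ++ entryBits (row s) ⟫
    full-row {s} o = subst
      (λ k → ∃ λ h → Passes x ⟪ at test , pairs s 0 , 0 , o ⟫
               ⟪ at advanceRow , pairs s 0 , h , o ++ entryBits (concatMap (block s) (range 0 k)) ⟫)
      suc-pred-N (row-passes {s} (pred N) 0 o suc-pred-N)

    rows-passes : ∀ r s h o → s + suc r ≡ N → ∃ λ h′ → Passes x ⟪ at rewind , pairs s 0 , h , o ⟫
      ⟪ enter footer , pairs 0 0 , h′ , o ++ entryBits (concatMap row (range s (suc r))) ⟫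
    rows-passes zero s h o eq =
      let (h₁ , in-row) = full-row {s} o
      in h₁ , (rewinding h (pairs s 0) o ⨾ in-row ⨾ last-row {s} h₁ _ (trans (sym (+-comm s 1)) eq)
               ⨾ ⟶*-≡ _ _ done (⟪⟫-out (cong (λ es → o ++ entryBits es) (sym (++-identityʳ (row s))))))
    rows-passes (suc r) s h o eq =
      let (h₁ , in-row) = full-row {s} o
          eq′ = trans (sym (+-suc s (suc r))) eq
          lt  = <-≤-trans (m<m+n (suc s) (s≤s z≤n)) (≤-reflexive eq′)
          (h₂ , rest) = rows-passes r (suc s) h₁ (o ++ entryBits (row s)) eq′
      in h₂ , (rewinding h (pairs s 0) o ⨾ in-row ⨾ next-row {s} h₁ _ lt ⨾ rest
               ⨾ ⟶*-≡ _ _ done (⟪⟫-out (trans (++-assoc o _ _)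
                   (cong (o ++_) (sym (entryBits-++ (row s) (concatMap row (range (suc s) (suc r)))))))))

    main-loop : ∀ h o → ∃ λ h′ → Passes x ⟪ at rewind , pairs 0 0 , h , o ⟫
      ⟪ enter footer , pairs 0 0 , h′ , o ++ entryBits (concatMap row (range 0 N)) ⟫
    main-loop h o = subst
      (λ k → ∃ λ h′ → Passes x ⟪ at rewind , pairs 0 0 , h , o ⟫
               ⟪ enter footer , pairs 0 0 , h′ , o ++ entryBits (concatMap row (range 0 k)) ⟫)
      suc-pred-N (rows-passes (pred N) 0 h o suc-pred-N)

    -- The tape starts empty, so 0 has no digits here, unlike in `littleEndian`; from 1 on the two
    -- agree.
    counter : ℕ → List Bool
    counter zero    = []
    counter (suc k) = littleEndian (suc k)

    increment-counter : ∀ k → increment (counter k) ≡ counter (suc k)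
    increment-counter zero    = refl
    increment-counter (suc k) = refl

    count-bit : ∀ {k} → k < n → Passes x ⟪ at count , map bitPair (counter k) , suc k , [] ⟫
      ⟪ at count , map bitPair (counter (suc k)) , suc (suc k) , [] ⟫
    count-bit {k} lt = single refl lem
      where
      lem : pass x ⟪ at count , map bitPair (counter k) , suc k , [] ⟫ ≡
        ⟪ at count , map bitPair (counter (suc k)) , suc (suc k) , [] ⟫
      lem rewrite proj₂ (readInput-inside x lt) | proj₂ (sweep-count true true (counter k))
                | proj₁ (sweep-count true true (counter k)) | increment-counter k
                | m≤n⇒m⊓n≡m {suc k} {n} lt = refl

    count-end : Passes x ⟪ at count , map bitPair (counter n) , suc n , [] ⟫
      ⟪ at clear , map bitPair (counter (suc n)) , suc n , [] ⟫
    count-end = single refl lem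
      where
      lem : pass x ⟪ at count , map bitPair (counter n) , suc n , [] ⟫ ≡
        ⟪ at clear , map bitPair (counter (suc n)) , suc n , [] ⟫
      lem rewrite readInput-end x | proj₂ (sweep-count true true (counter n))
                | proj₁ (sweep-count true true (counter n)) | increment-counter n = refl

    counting : ∀ r k → k + r ≡ n → Passes x ⟪ at count , map bitPair (counter k) , suc k , [] ⟫
      ⟪ at count , map bitPair (counter n) , suc n , [] ⟫
    counting zero    k eq = ⟶*-≡ _ _ done (cong (λ k → ⟪ at count , map bitPair (counter k) , suc k , [] ⟫) (trans (sym (+-identityʳ k)) eq))
    counting (suc r) k eq = count-bit (<-≤-trans (m<m+n k (s≤s z≤n)) (≤-reflexive eq)) ⨾ counting r (suc k) (trans (sym (+-suc k r)) eq)

    clearing : Passes x ⟪ at clear , map bitPair (counter (suc n)) , suc n , [] ⟫ ⟪ enter header , pairs 0 0 , suc n , [] ⟫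
    clearing = single refl lem
      where
      lem : pass x ⟪ at clear , map bitPair (counter (suc n)) , suc n , [] ⟫ ≡ ⟪ enter header , pairs 0 0 , suc n , [] ⟫
      lem rewrite sweep-clear (true , true) (map bitPair (counter (suc n))) | length-map bitPair (counter (suc n))
                | ++-identityʳ (pairs 0 0) = refl

    encodeEntries-bits : encodeEntries output entries ≡
      (encodeRecord (gateName output ∷ []) ++ entryBits (concatMap row (range 0 N))) ++ printAll 0 0 (code footer)
    encodeEntries-bits = begin
      hd ++ concatMap encodeRecord (map entryRecord entries ++ (1 ∷ []) ∷ [])
        ≡⟨ cong (hd ++_) (concatMap-++ encodeRecord (map entryRecord entries) _) ⟩
      hd ++ (concatMap encodeRecord (map entryRecord entries) ++ tl)
        ≡⟨ cong (λ l → hd ++ (l ++ tl)) (concatMap-map encodeRecord entryRecord entries) ⟩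
      hd ++ (entryBits entries ++ tl)
        ≡⟨ cong (λ l → hd ++ (l ++ tl)) (entryBits-++ (concatMap row (range 0 N)) (one ∷ [])) ⟩
      hd ++ ((entryBits (concatMap row (range 0 N)) ++ entryBits (one ∷ [])) ++ tl)
        ≡⟨ cong (hd ++_) (++-assoc (entryBits (concatMap row (range 0 N))) (entryBits (one ∷ [])) tl) ⟩
      hd ++ (entryBits (concatMap row (range 0 N)) ++ (entryBits (one ∷ []) ++ tl))
        ≡⟨ ++-assoc hd _ _ ⟨
      (hd ++ entryBits (concatMap row (range 0 N))) ++ (entryBits (one ∷ []) ++ tl) ∎
      where
      open ≡-Reasoning
      hd = encodeRecord (gateName output ∷ [])
      tl = encodeRecord (1 ∷ []) ++ []

    full-run : ∃ λ h → Passes x ⟪ at count , [] , 1 , [] ⟫ ⟪ at stop , pairs 0 0 , h , encodeEntries output entries ⟫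
    full-run =
      let (h , loop) = main-loop (suc n) (printAll 0 0 (code header))
      in h , (counting n 0 refl ⨾ count-end ⨾ clearing ⨾ execute {0} {0} header (suc n) [] N>0 ⨾ loop
              ⨾ execute {0} {0} footer h _ N>0
              ⨾ ⟶*-≡ _ _ done (⟪⟫-out (trans
                  (cong (λ l → (l ++ entryBits (concatMap row (range 0 N))) ++ printAll 0 0 (code footer)) print-header)
                  (sym encodeEntries-bits))))

    length-pairs : length (pairs 0 0) ≡ w
    length-pairs = go w
      where
      go : ∀ w → length (zip (numeral w 0) (numeral w 0)) ≡ w
      go zero    = refl
      go (suc w) = cong suc (go w)

  reduction : List Bool → List Bool
  reduction x = encodeEntries output entries
    where open Layout b 𝒜 (numeralWidth (length x)) x

  reduction-logspace : LogspaceComputable reduction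
  reduction-logspace = Sweeping.logspace sweeper 2 λ x → let open Execution x in
    at stop , pairs 0 0 , proj₁ full-run , proj₂ full-run , refl
    , ≤-trans (≤-reflexive length-pairs) (numeralWidth≤log (length x))

-- Cellular automata from deciders

module Simulation (M : Decider) where
  open Decider M

  -- Cell 0 of the automaton is the left end of the tape: it releases the head
  -- in the first step and is a wall afterwards.  Cell suc i is cell i of the
  -- tape.  The Boolean component of Content is a signal that spreads to the
  -- left from an accepting head.
  data Base : Set where
    boot wall : Base
    sym′      : Cell Aux → Base
    head′     : State → Cell Aux → Base

  finite-Cell : Finite (Cell Aux)
  finite-Cell = finite-↔ (mk↔ₛ′
    (λ { blank → inj₁ tt ; (bit b) → inj₂ (inj₁ b) ; (aux a) → inj₂ (inj₂ a) })
    (λ { (inj₁ _) → blank ; (inj₂ (inj₁ b)) → bit b ; (inj₂ (inj₂ a)) → aux a })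
    (λ { (inj₁ _) → refl ; (inj₂ (inj₁ _)) → refl ; (inj₂ (inj₂ _)) → refl })
    (λ { blank → refl ; (bit _) → refl ; (aux _) → refl }))
    (finite-⊎ finite-⊤ (finite-⊎ finite-Bool aux-finite))

  finite-Base : Finite Base
  finite-Base = finite-↔ (mk↔ₛ′
    (λ { boot → inj₁ true ; wall → inj₁ false ; (sym′ a) → inj₂ (nothing , a) ; (head′ q a) → inj₂ (just q , a) })
    (λ { (inj₁ true) → boot ; (inj₁ false) → wall ; (inj₂ (nothing , a)) → sym′ a ; (inj₂ (just q , a)) → head′ q a })
    (λ { (inj₁ true) → refl ; (inj₁ false) → refl ; (inj₂ (nothing , _)) → refl ; (inj₂ (just _ , _)) → refl })
    (λ { boot → refl ; wall → refl ; (sym′ _) → refl ; (head′ _ _) → refl }))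
    (finite-⊎ finite-Bool (finite-× (finite-Maybe state-finite) finite-Cell))

  Action : Set
  Action = Maybe (State × Cell Aux × Dir)

  act : State → Cell Aux → Action
  act q a = maybe′ (λ _ → nothing) (just (δ q a)) (verdict q)

  goesRight goesLeft : Action → Maybe State
  goesRight (just (q , _ , right)) = just q
  goesRight _                      = nothing
  goesLeft  (just (q , _ , left))  = just q
  goesLeft  _                      = nothing

  fromLeft fromRight : Base → Maybe State
  fromLeft boot        = just start
  fromLeft (head′ q a) = goesRight (act q a)
  fromLeft _           = nothing
  fromRight (head′ q a) = goesLeft (act q a)
  fromRight _           = nothing

  place : Maybe State → Cell Aux → Base
  place nothing  a = sym′ a
  place (just q) a = head′ q a

  leave : Base → State → Cell Aux → Action → Base
  leave l    q a nothing                = head′ q a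
  leave l    q a (just (q′ , a′ , stay))  = head′ q′ a′
  leave l    q a (just (q′ , a′ , right)) = sym′ a′
  -- At the wall a move to the left keeps the head in place, as on the leftmost cell of the tape.
  leave wall q a (just (q′ , a′ , left))  = head′ q′ a′
  leave _    q a (just (q′ , a′ , left))  = sym′ a′

  baseRule : Base → Base → Base → Base
  baseRule l boot        r = wall
  baseRule l wall        r = wall
  -- The rows that arise hold at most one head, so at most one side delivers a state.
  baseRule l (sym′ a)    r = place (fromLeft l <∣> fromRight r) a
  baseRule l (head′ q a) r = leave l q a (act q a)

  -- Configurations of the decider as rows of the automaton

  infixr 5 _◂_
  _◂_ : Base → (ℕ → Base) → ℕ → Base
  (c ◂ r) zero    = c
  (c ◂ r) (suc i) = r i

  evolve : Base → (ℕ → Base) → ℕ → Base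
  evolve l r i = baseRule ((l ◂ r) i) (r i) (r (suc i))

  rightPart : List (Cell Aux) → ℕ → Base
  rightPart []       = λ _ → sym′ blank
  rightPart (r ∷ rs) = sym′ r ◂ rightPart rs

  plug : List (Cell Aux) → (ℕ → Base) → ℕ → Base
  plug []       R = R
  plug (l ∷ ls) R = plug ls (sym′ l ◂ R)

  row : Config → ℕ → Base
  row (q , tape ls a rs) = plug ls (head′ q a ◂ rightPart rs)

  plug-cong : ∀ ls {R S} → (∀ i → R i ≡ S i) → ∀ i → plug ls R i ≡ plug ls S i
  plug-cong []       eq = eq
  plug-cong (l ∷ ls) eq = plug-cong ls λ { zero → refl ; (suc i) → eq i }

  edge : List (Cell Aux) → Base
  edge []      = wall
  edge (l ∷ _) = sym′ l

  -- A right neighbour that sends no head to the left. The left neighbours quantified over are the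
  -- wall or a plain symbol, which send none either.
  Calm : Base → Set
  Calm c = ∀ ls a → baseRule (edge ls) (sym′ a) c ≡ sym′ a

  calm-sym : ∀ b → Calm (sym′ b)
  calm-sym b []      a = refl
  calm-sym b (_ ∷ _) a = refl

  calm-head : ∀ q a → goesLeft (act q a) ≡ nothing → Calm (head′ q a)
  calm-head q a eq []      b rewrite eq = refl
  calm-head q a eq (_ ∷ _) b rewrite eq = refl

  -- The symbols to the left of the active part do not change, so a step may be computed on the
  -- active part alone.
  evolve-plug : ∀ ls R → Calm (R 0) → ∀ i → evolve wall (plug ls R) i ≡ plug ls (evolve (edge ls) R) i
  evolve-plug []       R calm i = refl
  evolve-plug (l ∷ ls) R calm i = trans (evolve-plug ls (sym′ l ◂ R) (calm-sym l) i)
    (plug-cong ls (λ { zero → calm ls l ; (suc i) → refl }) i)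

  evolve-right : ∀ p rs → fromLeft p ≡ nothing → ∀ i → evolve p (rightPart rs) i ≡ rightPart rs i
  evolve-right p []           eq zero    rewrite eq = refl
  evolve-right p []           eq (suc i) = refl
  evolve-right p (r ∷ [])     eq zero    rewrite eq = refl
  evolve-right p (r ∷ _ ∷ _)  eq zero    rewrite eq = refl
  evolve-right p (r ∷ rs)     eq (suc i) = evolve-right (sym′ r) rs refl i

  perform : State → Tape (Cell Aux) → Action → Config
  perform q t nothing           = q , t
  perform q t (just (q′ , action)) = q′ , writeMove blank t action

  step-perform : ∀ q t → step (q , t) ≡ perform q t (act q (scanned t))
  step-perform q t with verdict q
  ... | just _  = refl
  ... | nothing = refl

  -- The action is a variable tied by an equation, so that cases can be split on it while the rules
  -- of the neighbouring cells still mention `act q a`.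
  evolve-perform : ∀ q ls a rs α → act q a ≡ α → ∀ i →
    evolve wall (row (q , tape ls a rs)) i ≡ row (perform q (tape ls a rs) α) i
  evolve-perform q ls a rs nothing eq i = trans
    (evolve-plug ls (head′ q a ◂ rightPart rs) (calm-head q a (cong goesLeft eq)) i)
    (plug-cong ls (λ { zero → cong (leave (edge ls) q a) eq
                     ; (suc i) → evolve-right (head′ q a) rs (cong goesRight eq) i }) i)
  evolve-perform q ls a rs (just (q′ , a′ , stay)) eq i = trans
    (evolve-plug ls (head′ q a ◂ rightPart rs) (calm-head q a (cong goesLeft eq)) i)
    (plug-cong ls (λ { zero → cong (leave (edge ls) q a) eq
                     ; (suc i) → evolve-right (head′ q a) rs (cong goesRight eq) i }) i)
  evolve-perform q ls a [] (just (q′ , a′ , right)) eq i = trans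
    (evolve-plug ls (head′ q a ◂ rightPart []) (calm-head q a (cong goesLeft eq)) i)
    (plug-cong ls (λ { zero → cong (leave (edge ls) q a) eq
                     ; (suc zero) → cong (λ α → place (goesRight α <∣> nothing) blank) eq
                     ; (suc (suc i)) → refl }) i)
  evolve-perform q ls a (r ∷ rs) (just (q′ , a′ , right)) eq i = trans
    (evolve-plug ls (head′ q a ◂ rightPart (r ∷ rs)) (calm-head q a (cong goesLeft eq)) i)
    (plug-cong ls (λ { zero → cong (leave (edge ls) q a) eq
                     ; (suc zero) → cong (λ α → place (goesRight α <∣> fromRight (rightPart rs 0)) r) eq
                     ; (suc (suc i)) → evolve-right (sym′ r) rs refl i }) i)
  evolve-perform q [] a rs (just (q′ , a′ , left)) eq zero    = cong (leave wall q a) eq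
  evolve-perform q [] a rs (just (q′ , a′ , left)) eq (suc i) = evolve-right (head′ q a) rs (cong goesRight eq) i
  -- The head moves onto `l`, so `l` joins the active part and only `ls` remains as the unchanged
  -- prefix.
  evolve-perform q (l ∷ ls) a rs (just (q′ , a′ , left)) eq i = trans
    (evolve-plug ls (sym′ l ◂ head′ q a ◂ rightPart rs) (calm-sym l) i)
    (plug-cong ls (λ { zero → trans (cong (λ p → place (p <∣> goesLeft (act q a)) l) (edge-still ls))
                                    (cong (λ α → place (goesLeft α) l) eq)
                     ; (suc zero) → cong (leave (sym′ l) q a) eq
                     ; (suc (suc i)) → evolve-right (head′ q a) rs (cong goesRight eq) i }) i)
    where
    edge-still : ∀ ls → fromLeft (edge ls) ≡ nothing
    edge-still []      = refl
    edge-still (_ ∷ _) = refl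

  evolve-row : ∀ c i → evolve wall (row c) i ≡ row (step c) i
  evolve-row (q , t@(tape ls a rs)) i = trans (evolve-perform q ls a rs (act q a) refl i)
    (cong (λ c → row c i) (sym (step-perform q t)))

  initialBase : InputSymbol → Base
  initialBase leftEnd  = boot
  initialBase rightEnd = sym′ blank
  initialBase (bit b)  = sym′ (bit b)

  -- The diagram on an unbounded half-line, hence without a seam. By `pred`, cell 0 is its own left
  -- neighbour, which is harmless as `boot` and `wall` ignore their neighbours.
  baseDiagram : List Bool → ℕ → ℕ → Base
  baseDiagram x zero    i = initialBase (readInput x i)
  baseDiagram x (suc t) i = baseRule (baseDiagram x t (pred i)) (baseDiagram x t i) (baseDiagram x t (suc i))

  base-initial : ∀ x i → initialBase (readInput x (suc i)) ≡ rightPart (map bit x) i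
  base-initial []      i       = refl
  base-initial (b ∷ x) zero    = refl
  base-initial (b ∷ x) (suc i) = base-initial x i

  runFrom : List Bool → ℕ → Config
  runFrom x zero    = initial x
  runFrom x (suc t) = step (runFrom x t)

  base-wall : ∀ x t → baseDiagram x (suc t) 0 ≡ wall
  base-wall x zero    = refl
  base-wall x (suc t) rewrite base-wall x t = refl

  -- Both shifts by one come from cell 0: it lies outside the tape, and the first step is spent on
  -- releasing the head from it.
  base-row : ∀ x t i → baseDiagram x (suc t) (suc i) ≡ row (runFrom x t) i
  base-row []      zero    zero    = refl
  base-row (b ∷ x) zero    zero    = refl
  base-row x       zero    (suc i)
    rewrite base-initial x i | base-initial x (suc i) | base-initial x (2 + i) =
    trans (evolve-right wall (map bit x) refl (suc i)) (initial-row x)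
    where
    initial-row : ∀ x → rightPart (map bit x) (suc i) ≡ row (initial x) (suc i)
    initial-row []      = refl
    initial-row (_ ∷ _) = refl
  base-row x       (suc t) zero    rewrite base-wall x t | base-row x t 0 | base-row x t 1 = evolve-row (runFrom x t) 0
  base-row x       (suc t) (suc i) rewrite base-row x t i | base-row x t (suc i) | base-row x t (2 + i) = evolve-row (runFrom x t) (suc i)

  -- The acceptance signal

  isJustTrue : Maybe Bool → Bool
  isJustTrue (just b) = b
  isJustTrue nothing  = false

  accepts : Base → Bool
  accepts (head′ q _) = isJustTrue (verdict q)
  accepts _           = false

  -- A flag that stays once set and moves left by one cell per step: the head may accept anywhere,
  -- but the output gate looks at cell 0.
  signal : List Bool → ℕ → ℕ → Bool
  signal x zero    i = false
  signal x (suc t) i = signal x t i ∨ (signal x t (suc i) ∨ accepts (baseDiagram x t i))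

  signal-persists : ∀ x {t i} k → signal x t i ≡ true → signal x (k + t) i ≡ true
  signal-persists x zero    eq = eq
  signal-persists x {t} {i} (suc k) eq rewrite signal-persists x {t} {i} k eq = refl

  signal-travels : ∀ x {t} i → signal x t i ≡ true → signal x (i + t) 0 ≡ true
  signal-travels x     zero    eq = eq
  signal-travels x {t} (suc i) eq = subst (λ k → signal x k 0 ≡ true) (+-suc i t) (signal-travels x i shifted)
    where
    shifted : signal x (suc t) i ≡ true
    shifted rewrite eq = ∨-zeroʳ (signal x t i)

  signal-starts : ∀ x {t i} → accepts (baseDiagram x t i) ≡ true → signal x (suc t) i ≡ true
  signal-starts x {t} {i} eq rewrite eq | ∨-zeroʳ (signal x t (suc i)) = ∨-zeroʳ (signal x t i)

  no-signal : ∀ x → (∀ t i → accepts (baseDiagram x t i) ≡ false) → ∀ t i → signal x t i ≡ false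
  no-signal x never zero    i = refl
  no-signal x never (suc t) i rewrite no-signal x never t i | no-signal x never t (suc i) | never t i = refl

  plug-beyond : ∀ ls R j → plug ls R (length ls + j) ≡ R j
  plug-beyond []       R j = refl
  plug-beyond (l ∷ ls) R j = trans (cong (plug ls (sym′ l ◂ R)) (sym (+-suc (length ls) j)))
    (plug-beyond ls (sym′ l ◂ R) (suc j))

  headPosition : Config → ℕ
  headPosition (_ , t) = length (Tape.before t)

  accepts-head : ∀ c → accepts (row c (headPosition c)) ≡ isJustTrue (verdict (proj₁ c))
  accepts-head (q , tape ls a rs) = cong accepts (trans (cong (plug ls _) (sym (+-identityʳ (length ls))))
    (plug-beyond ls (head′ q a ◂ rightPart rs) 0))

  accepts-plug : ∀ {v} ls R → (∀ i → accepts (R i) ≡ true → v ≡ true) → ∀ i → accepts (plug ls R i) ≡ true → v ≡ true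
  accepts-plug []       R imp = imp
  accepts-plug (l ∷ ls) R imp = accepts-plug ls (sym′ l ◂ R) λ { (suc i) → imp i }

  accepts-right : ∀ rs i → accepts (rightPart rs i) ≡ false
  accepts-right []       i       = refl
  accepts-right (r ∷ rs) zero    = refl
  accepts-right (r ∷ rs) (suc i) = accepts-right rs i

  accepts-row : ∀ c i → accepts (row c i) ≡ true → isJustTrue (verdict (proj₁ c)) ≡ true
  accepts-row (q , tape ls a rs) = accepts-plug ls (head′ q a ◂ rightPart rs)
    λ { zero eq → eq ; (suc i) eq → case trans (sym eq) (accepts-right rs i) of λ () }

  iterate-suc : ∀ t (c : Config) → iterate step (suc t) c ≡ step (iterate step t c)
  iterate-suc zero    c = refl
  iterate-suc (suc t) c = iterate-suc t (step c)

  run≡runFrom : ∀ x t → run t x ≡ runFrom x t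
  run≡runFrom x zero    = refl
  run≡runFrom x (suc t) = trans (iterate-suc t (initial x)) (cong step (run≡runFrom x t))

  headPosition-writeMove : ∀ q t (a : Cell Aux × Dir) → headPosition (q , writeMove blank t a) ≤ suc (headPosition (q , t))
  headPosition-writeMove q (tape []       _ rs)       (_ , left)  = z≤n
  headPosition-writeMove q (tape (l ∷ ls) _ rs)       (_ , left)  = ≤-trans (n≤1+n _) (n≤1+n _)
  headPosition-writeMove q (tape ls       _ rs)       (_ , stay)  = n≤1+n _
  headPosition-writeMove q (tape ls       _ [])       (_ , right) = ≤-refl
  headPosition-writeMove q (tape ls       _ (r ∷ rs)) (_ , right) = ≤-refl

  headPosition-step : ∀ c → headPosition (step c) ≤ suc (headPosition c)
  headPosition-step (q , t) with verdict q
  ... | just _  = n≤1+n _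
  ... | nothing = headPosition-writeMove q t (proj₂ (δ q (scanned t)))

  headPosition-initial : ∀ x → headPosition (initial x) ≡ 0
  headPosition-initial []      = refl
  headPosition-initial (_ ∷ _) = refl

  headPosition≤time : ∀ x t → headPosition (runFrom x t) ≤ t
  headPosition≤time x zero    = ≤-reflexive (headPosition-initial x)
  headPosition≤time x (suc t) = ≤-trans (headPosition-step (runFrom x t)) (s≤s (headPosition≤time x t))

  halted-stays : ∀ x t {v} → verdict (proj₁ (runFrom x t)) ≡ just v → ∀ k → runFrom x (k + t) ≡ runFrom x t
  halted-stays x t eq zero    = refl
  halted-stays x t eq (suc k) = trans (cong step (halted-stays x t eq k)) (stopped-step (runFrom x t) eq)
    where
    stopped-step : ∀ c {v} → verdict (proj₁ c) ≡ just v → step c ≡ c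
    stopped-step (q , _) eq rewrite eq = refl

  one-verdict : ∀ x t u {v v′} → verdict (proj₁ (runFrom x t)) ≡ just v → verdict (proj₁ (runFrom x u)) ≡ just v′ → v ≡ v′
  one-verdict x t u eq eq′ with ≤-total t u
  ... | inj₁ t≤u = just-injective (trans (sym eq) (trans
    (sym (cong (verdict ∘ proj₁) (trans (cong (runFrom x) (sym (m∸n+n≡m t≤u))) (halted-stays x t eq (u ∸ t))))) eq′))
  ... | inj₂ u≤t = just-injective (trans (sym eq) (trans
    (cong (verdict ∘ proj₁) (trans (cong (runFrom x) (sym (m∸n+n≡m u≤t))) (halted-stays x u eq′ (t ∸ u)))) eq′))

  -- Acceptance shows at time t + 1 in cell h + 1, raises the flag there at time t + 2, and the flag
  -- needs h + 1 more steps to reach cell 0. As h ≤ t, time 3 + 2t is enough.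
  accept-signal : ∀ x t → verdict (proj₁ (runFrom x t)) ≡ just true → ∀ {u} → 3 + (t + t) ≤ u → signal x u 0 ≡ true
  accept-signal x t eq {u} le = subst (λ k → signal x k 0 ≡ true) (m∸n+n≡m arrival≤)
    (signal-persists x (u ∸ arrival) (signal-travels x (suc h) (signal-starts x {suc t} {suc h} (trans
      (cong accepts (base-row x t h)) (trans (accepts-head (runFrom x t)) (cong isJustTrue eq))))))
    where
    h = headPosition (runFrom x t)
    arrival = suc h + suc (suc t)
    arrival≤ : arrival ≤ u
    arrival≤ = ≤-trans (≤-trans (+-monoˡ-≤ (2 + t) (s≤s (headPosition≤time x t)))
      (≤-reflexive (cong suc (trans (+-suc t (suc t)) (cong suc (+-suc t t)))))) le

  -- A flag requires an accepting head at some time, but a halted decider keeps its verdict, so it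
  -- cannot also reject.
  reject-signal : ∀ x t → verdict (proj₁ (runFrom x t)) ≡ just false → ∀ u → signal x u 0 ≡ false
  reject-signal x t eq u = no-signal x never u 0
    where
    never : ∀ u i → accepts (baseDiagram x u i) ≡ false
    never zero i with readInput x i
    ... | leftEnd  = refl
    ... | rightEnd = refl
    ... | bit _    = refl
    never (suc u) zero rewrite base-wall x u = refl
    never (suc u) (suc i) with accepts (baseDiagram x (suc u) (suc i)) in accepted
    ... | false = refl
    ... | true  with verdict (proj₁ (runFrom x u)) in eqᵤ | accepts-row (runFrom x u) i (trans (cong accepts (sym (base-row x u i))) accepted)
    ...   | just true | _ = one-verdict x u t eqᵤ eq

  -- Coding the contents of a cell as automaton states

  Content : Set
  Content = Base × Bool

  finite-Content : Finite Content
  finite-Content = finite-× finite-Base finite-Bool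

  contentRule : Content → Content → Content → Content
  contentRule (l , _) (c , σ) (r , τ) = baseRule l c r , σ ∨ (τ ∨ accepts c)

  module Coded (finite : Finite Content) where
    open Inverse (proj₂ finite) using (to; from; strictlyInverseʳ)

    automaton : Automaton
    automaton = record
      { states    = proj₁ finite
      ; rule      = λ l c r → to (contentRule (from l) (from c) (from r))
      ; initially = λ a → to (initialBase a , false)
      ; accepting = to (wall , true)
      }

    open Automaton automaton using (diagram)

    shift-inside : ∀ {N i} → suc i < N → shift N after i ≡ suc i
    shift-inside {N} {i} lt with suc i <ᵇ N in eq
    ... | true  = refl
    ... | false = ⊥-elim (subst T eq (<⇒<ᵇ lt))

    left-irrelevant : ∀ x t l r → baseRule l (baseDiagram x t 0) r ≡ baseDiagram x (suc t) 0
    left-irrelevant x zero    l r = refl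
    left-irrelevant x (suc t) l r rewrite base-wall x t = refl

    -- The right end of the automaton is not felt inside this light cone; the
    -- left neighbour of cell 0 is irrelevant.
    diagram-correct : ∀ N x t i → i + t < N → diagram N x t i ≡ to (baseDiagram x t i , signal x t i)
    diagram-correct N x zero    i       lt = refl
    diagram-correct N x (suc t) zero    lt
      rewrite diagram-correct N x t 0 (<-trans (n<1+n t) lt)
            | shift-inside {N} {0} (≤-<-trans (s≤s z≤n) lt) | diagram-correct N x t 1 lt
            | strictlyInverseʳ (baseDiagram x t 0 , signal x t 0) | strictlyInverseʳ (baseDiagram x t 1 , signal x t 1) =
      cong (λ c → to (c , signal x (suc t) 0)) (left-irrelevant x t _ _)
    diagram-correct N x (suc t) (suc i) lt
      rewrite diagram-correct N x t i (≤-<-trans (+-mono-≤ (n≤1+n i) (n≤1+n t)) lt)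
            | diagram-correct N x t (suc i) (≤-<-trans (+-monoʳ-≤ (suc i) (n≤1+n t)) lt)
            | shift-inside {N} {suc i} (≤-<-trans (≤-trans (s≤s (≤-trans (s≤s (m≤m+n i t)) (≤-reflexive (sym (+-suc i t))))) ≤-refl) lt)
            | diagram-correct N x t (2 + i) (subst (_< N) (cong suc (+-suc i t)) lt)
            | strictlyInverseʳ (baseDiagram x t i , signal x t i)
            | strictlyInverseʳ (baseDiagram x t (suc i) , signal x t (suc i))
            | strictlyInverseʳ (baseDiagram x t (2 + i) , signal x t (2 + i)) = refl

    -- Cell 0 at time N - 1 lies just inside the light cone. `2 ≤ N` makes this time positive, so
    -- that `boot` has become `wall`.
    corner : ∀ {N} x → 2 ≤ N → diagram N x (N ∸ 1) 0 ≡ to (wall , signal x (N ∸ 1) 0)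
    corner {suc (suc u)} x _ = trans (diagram-correct (2 + u) x (suc u) 0 ≤-refl)
      (cong (λ c → to (c , signal x (suc u) 0)) (base-wall x u))
    corner {suc zero} x (s≤s ())

    accept-corner : ∀ {N} x t → verdict (proj₁ (run t x)) ≡ just true → 4 + (t + t) ≤ N →
      diagram N x (N ∸ 1) 0 ≡ Automaton.accepting automaton
    accept-corner {N} x t eq le = trans (corner x (≤-trans (s≤s (s≤s z≤n)) le))
      (cong (λ σ → to (wall , σ)) (accept-signal x t (subst (λ c → verdict (proj₁ c) ≡ just true) (run≡runFrom x t) eq)
        (∸-monoˡ-≤ 1 le)))

    reject-corner : ∀ {N} x t → verdict (proj₁ (run t x)) ≡ just false → 2 ≤ N →
      diagram N x (N ∸ 1) 0 ≢ Automaton.accepting automaton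
    reject-corner {N} x t eq le accepted = case trans (sym (reject-signal x t
        (subst (λ c → verdict (proj₁ c) ≡ just false) (run≡runFrom x t) eq) (N ∸ 1)))
      (cong proj₂ (trans (sym (strictlyInverseʳ (wall , signal x (N ∸ 1) 0)))
        (trans (cong from (trans (sym (corner x le)) accepted)) (strictlyInverseʳ (wall , true))))) of λ ()

-- The reduction

k<2^k : ∀ k → k < 2 ^ k
k<2^k zero    = s≤s z≤n
k<2^k (suc k) = ≤-trans (+-mono-≤ (≤-trans (s≤s z≤n) (k<2^k k)) (k<2^k k))
  (≤-reflexive (cong (2 ^ k +_) (sym (+-identityʳ (2 ^ k)))))

-- With p = (n + 2)^k both n^k and k are at most p, hence 4 + 2t ≤ 8p, and the 3 in the exponent
-- absorbs the factor 8. Finally n + 2 ≤ 2^w turns the polynomial into a power of a fixed base with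
-- exponent w.
time-bound : ∀ n k {t} → t ≤ n ^ k + k → 4 + (t + t) ≤ suc (suc (2 ^ (k + 3))) ^ numeralWidth n
time-bound n k {t} t≤ = begin
  4 + (t + t)                                 ≤⟨ +-mono-≤ (*-monoʳ-≤ 4 one≤p) (+-mono-≤ t≤p+p t≤p+p) ⟩
  4 * p + ((p + p) + (p + p))                 ≡⟨ solve 1 (λ p → con 4 :* p :+ ((p :+ p) :+ (p :+ p)) := p :* con 8) refl p ⟩
  p * 2 ^ 3                                   ≤⟨ *-monoʳ-≤ p (^-monoˡ-≤ 3 (m≤n+m 2 n)) ⟩
  p * (n + 2) ^ 3                             ≡⟨ ^-distribˡ-+-* (n + 2) k 3 ⟨
  (n + 2) ^ (k + 3)                           ≤⟨ ^-monoˡ-≤ (k + 3) (≤-trans (≤-reflexive (+-comm n 2)) (n<2^numeralWidth n)) ⟩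
  (2 ^ w) ^ (k + 3)                           ≡⟨ ^-*-assoc 2 w (k + 3) ⟩
  2 ^ (w * (k + 3))                           ≡⟨ cong (2 ^_) (*-comm w (k + 3)) ⟩
  2 ^ ((k + 3) * w)                           ≡⟨ ^-*-assoc 2 (k + 3) w ⟨
  -- The two successors are those of `Program`: `b` is `suc b′` and the base is `suc b`.
  (2 ^ (k + 3)) ^ w                           ≤⟨ ^-monoˡ-≤ w (≤-trans (n≤1+n _) (n≤1+n _)) ⟩
  suc (suc (2 ^ (k + 3))) ^ w                 ∎
  where
  open ≤-Reasoning
  open +-*-Solver
  w = numeralWidth n
  p = (n + 2) ^ k
  2^k≤p : 2 ^ k ≤ p
  2^k≤p = ^-monoˡ-≤ k (m≤n+m 2 n)
  one≤p : 1 ≤ p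
  one≤p = ≤-trans (≤-trans (s≤s z≤n) (k<2^k k)) 2^k≤p
  t≤p+p : t ≤ p + p
  t≤p+p = ≤-trans t≤ (+-mono-≤ (^-monoˡ-≤ k (m≤m+n n 2)) (≤-trans (<⇒≤ (k<2^k k)) 2^k≤p))

theorem8 : P-hard (MC (｛ complement ｝ ∪ ｛ binary quotient ｝))
theorem8 L (M , k , decides) = reduction , reduction-logspace , equivalent
  where
  open Simulation M
  open Coded finite-Content
  open Automaton automaton using (diagram)
  open Program (2 ^ (k + 3)) automaton using (b; reduction; reduction-logspace)

  equivalent : ∀ x → x ∈ L ⇔ reduction x ∈ MC 𝒬
  equivalent x = mk⇔ (λ x∈ → from (complete verdict x∈)) (λ f∈ → sound verdict (to f∈))
    where
    open Layout b automaton (numeralWidth (length x)) x using (N; layout-correct)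
    open Equivalence layout-correct using (to; from)
    open Decider M using (run)
    t       = proj₁ (decides x)
    verdict = proj₂ (proj₂ (decides x))

    enough : 4 + (t + t) ≤ N
    enough = time-bound (length x) k (proj₁ (proj₂ (decides x)))

    Accepting : Set
    Accepting = diagram N x (N ∸ 1) 0 ≡ Automaton.accepting automaton

    Verdict : Set
    Verdict = Decider.verdict M (proj₁ (run t x)) ≡ just true × x ∈ L
            ⊎ Decider.verdict M (proj₁ (run t x)) ≡ just false × x ∉ L

    complete : Verdict → x ∈ L → Accepting
    complete (inj₁ (eq , _)) _  = accept-corner x t eq enough
    complete (inj₂ (_ , x∉)) x∈ = contradiction x∈ x∉

    sound : Verdict → Accepting → x ∈ L
    sound (inj₁ (_ , x∈)) _   = x∈
    sound (inj₂ (eq , _)) accepted = contradiction accepted (reject-corner x t eq (≤-trans (s≤s (s≤s z≤n)) enough))
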